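{- Let $k\ge 1$ and $1\le i\le k$ be integers. For all integers $n,j\ge 0$, $$\overline{B}_{k,i}(n,j)=\overline{C}_{k,i}(n,j)=\overline{D}_{k,i}(n,j)=\overline{E}_{k,i}(n,j),$$ where these four quantities are defined as follows. (1) $\overline{B}_{k,i}(n,j)$ is the number of overpartitions $(\lambda_1,\dots,\lambda_s)$ of $n$ with exactly $j$ overlined parts such that at most $i-1$ parts are equal to $1$ and, for every $\ell$ with $\ell+k-1\le s$, $\lambda_\ell-\lambda_{\ell+k-1}\ge 1$ if $\lambda_{\ell+k-1}$ is overlined and $\lambda_\ell-\lambda_{\ell+k-1}\ge 2$ otherwise. (2) $\overline{C}_{k,i}(n,j)$ is the number of Frobenius symbols of weight $n$ having exactly $j$ non-overlined entries in the bottom row and all of whose successive ranks lie in the interval $[-i+2,\,2k-i-1]$. (3) $\overline{D}_{k,i}(n,j)$ is the number of overpartitions of $n$ with exactly $j$ overlined parts which have $i-1$ successive Durfee squares followed by $k-i$ successive Durfee rectangles, the first one being a generalized Durfee square (if $i\ge2$) or a generalized Durfee rectangle (if $i=1$). (4) $\overline{E}_{k,i}(n,j)$ is the number of lattice paths satisfying the special $(k,i)$-conditions, with major index $n$ and exactly $j$ South steps.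
   Context: An overpartition of $n$ is a non-increasing sequence of positive integers summing to $n$ in which the final occurrence of each value may (or may not) be overlined. Frobenius symbols: a Frobenius symbol is a two-rowed array $\begin{pmatrix}a_1&\cdots&a_N\\ b_1&\cdots&b_N\end{pmatrix}$ ($N\ge0$) where $a_1>a_2>\cdots>a_N\ge0$ are integers and $b_1\ge\cdots\ge b_N\ge 0$ are integers in which the first occurrence of each value may be overlined; its weight is $N+\sum_m(a_m+b_m)$. Frobenius symbols of weight $n$ are in bijection with overpartitions of $n$ (the Frobenius representation of an overpartition), so counting overpartitions by properties of their Frobenius representation is the same as counting these arrays. The $m$-th successive rank of the symbol is $r_m=a_m-b_m-\#\{m'>m: b_{m'}\text{ is not overlined}\}$. Durfee dissection: for an overpartition $\lambda$, list its parts as all overlined parts in decreasing order followed by all non-overlined parts in decreasing order: $\rho_1,\rho_2,\dots$ (with $\rho_m=0$ beyond the number of parts). The generalized Durfee square of $\lambda$ has size $N$, where $N$ is the largest integer $\ge0$ such that (number of overlined parts) + (number of non-overlined parts $\ge N$) $\ge N$; its remainder is the ordinary partition $(\rho_{N+1},\rho_{N+2},\dots)$ (these are non-overlined and $\le N$). $\lambda$ has a generalized Durfee rectangle of size $N$ if $N$ is the size of its generalized Durfee square and $\rho_{N+1}=N$; its remainder is then $(\rho_{N+2},\rho_{N+3},\dots)$. For an ordinary partition $\mu$, its Durfee square has size $d$ = the largest $d\ge0$ with $\mu_d\ge d$, with remainder $(\mu_{d+1},\mu_{d+2},\dots)$; $\mu$ has a Durfee rectangle (a rectangle with $d$ columns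 and $d+1$ rows, the part of the diagram to its right having at most $d$ nonzero rows) of size $d\ge0$ if $\mu_{d+1}=d$ (such $d$ is unique), with remainder $(\mu_{d+2},\dots)$. "$\lambda$ has $i-1$ successive Durfee squares followed by $k-i$ successive Durfee rectangles, the first one being generalized" means: for $i\ge2$, one takes the generalized Durfee square of $\lambda$, then $i-2$ successive Durfee squares of the successive remainders, then $k-i$ successive Durfee rectangles of the successive remainders (each of which must exist); for $i=1$, $\lambda$ must have a generalized Durfee rectangle, followed by $k-2$ successive Durfee rectangles of the successive remainders; in both cases the remainder after these $k-1$ blocks must be empty (blocks of size $0$ allowed). For $k=1$ this means $\lambda$ is empty. Lattice paths: paths in the first quadrant starting on the $y$-axis, ending on the $x$-axis, using unit steps North-East $(x,y)\to(x+1,y+1)$, South-East $(x,y)\to(x+1,y-1)$, South $(x,y)\to(x,y-1)$ and East $(x,0)\to(x+1,0)$ (East steps only at height $0$). A South step may only occur immediately after a North-East step. A path is either empty or ends with a South-East or South step. The height of a vertex is its $y$-coordinate. A path satisfies the special $(k,i)$-conditions if it starts at $(0,k-i)$ and all its vertices have height $<k$. A peak is a vertex preceded by a North-East step and followed by a South or South-East step. The major index of a path is the sum of the $x$-coordinates of its peaks. -}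

module Defs where

open import Data.Bool using (Bool; true; false; _∧_; _∨_; not; T; if_then_else_)
open import Data.Nat using (ℕ; zero; suc; _+_; _∸_; _≡ᵇ_; _<ᵇ_; _≤ᵇ_)
open import Data.Integer as ℤ using (ℤ; +_)
open import Data.Product using (Σ; _×_; _,_; proj₁; proj₂)
open import Data.List using (List; []; _∷_; _++_; length; drop; map)
open import Data.Nat.ListAction using (sum)
open import Data.Maybe using (Maybe; just; nothing)
open import Relation.Nullary.Decidable using (does)

countB : {A : Set} → (A → Bool) → List A → ℕ
countB p []       = 0
countB p (x ∷ xs) = (if p x then 1 else 0) + countB p xs

filterB : {A : Set} → (A → Bool) → List A → List A
filterB p []       = []
filterB p (x ∷ xs) = if p x then x ∷ filterB p xs else filterB p xs

-- m-th entry (1-based) of a list of naturals, 0 beyond the end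
-- (and ρ₀ := 0, never used)
entry : List ℕ → ℕ → ℕ
entry []       _             = 0
entry (x ∷ xs) zero          = 0
entry (x ∷ xs) (suc zero)    = x
entry (x ∷ xs) (suc (suc m)) = entry xs (suc m)

largestUpTo : (ℕ → Bool) → ℕ → ℕ
largestUpTo p zero    = 0
largestUpTo p (suc b) = if p (suc b) then suc b else largestUpTo p b

_≤ℤ_ : ℤ → ℤ → Bool
x ≤ℤ y = does (x ℤ.≤? y)

-- Overpartitions
-- An overpartition is a list of parts (λ₁, λ₂, …, λₛ), each part a pair
-- (value , overlined?), non-increasing, positive, and where only the
-- final occurrence of a value may be overlined.

Part : Set
Part = ℕ × Bool

value : Part → ℕ
value = proj₁

overlined : Part → Bool
overlined = proj₂

isOverpartition : List Part → Bool
isOverpartition []                 = true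
isOverpartition ((a , o) ∷ [])     = 1 ≤ᵇ a
isOverpartition ((a , o) ∷ (b , o′) ∷ xs) =
  (1 ≤ᵇ a) ∧ (b ≤ᵇ a) ∧ (if a ≡ᵇ b then not o else true)
  ∧ isOverpartition ((b , o′) ∷ xs)

weight : List Part → ℕ
weight λs = sum (map value λs)

numOverlined : List Part → ℕ
numOverlined = countB overlined

differenceCond : ℕ → List Part → Bool
differenceCond k []       = true
differenceCond k (x ∷ xs) = here (drop (k ∸ 1) (x ∷ xs)) ∧ differenceCond k xs
  where
  here : List Part → Bool
  here []            = true
  here ((b , o) ∷ _) = if o then (b + 1 ≤ᵇ value x) else (b + 2 ≤ᵇ value x)

isB : (k i n j : ℕ) → List Part → Bool
isB k i n j λs =
  isOverpartition λs ∧ (weight λs ≡ᵇ n) ∧ (numOverlined λs ≡ᵇ j)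
  ∧ (countB (λ p → value p ≡ᵇ 1) λs ≤ᵇ i ∸ 1)
  ∧ differenceCond k λs

B̄ : (k i n j : ℕ) → Set
B̄ k i n j = Σ (List Part) (λ λs → T (isB k i n j λs))

-- (2) Frobenius symbols, C̄_{k,i}(n,j)
-- A Frobenius symbol is a list of columns (a_m , b_m , b_m overlined?),
-- m = 1..N.

Column : Set
Column = ℕ × ℕ × Bool

topEntry : Column → ℕ
topEntry (a , _ , _) = a

botEntry : Column → ℕ
botEntry (_ , b , _) = b

botOverlined : Column → Bool
botOverlined (_ , _ , o) = o

isFrobenius : List Column → Bool
isFrobenius []       = true
isFrobenius (c ∷ []) = true
isFrobenius ((a , b , o) ∷ (a′ , b′ , o′) ∷ cs) =
  (a′ <ᵇ a) ∧ (b′ ≤ᵇ b) ∧ (if b ≡ᵇ b′ then not o′ else true)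
  ∧ isFrobenius ((a′ , b′ , o′) ∷ cs)

frobWeight : List Column → ℕ
frobWeight cs = length cs + sum (map (λ c → topEntry c + botEntry c) cs)

numNonOverlinedBottom : List Column → ℕ
numNonOverlinedBottom = countB (λ c → not (botOverlined c))

successiveRanks : List Column → List ℤ
successiveRanks []       = []
successiveRanks (c ∷ cs) =
  ((+ topEntry c ℤ.- + botEntry c) ℤ.- + numNonOverlinedBottom cs)
  ∷ successiveRanks cs

allB : {A : Set} → (A → Bool) → List A → Bool
allB p []       = true
allB p (x ∷ xs) = p x ∧ allB p xs

isC : (k i n j : ℕ) → List Column → Bool
isC k i n j cs =
  isFrobenius cs ∧ (frobWeight cs ≡ᵇ n) ∧ (numNonOverlinedBottom cs ≡ᵇ j)
  ∧ allB (λ r → ((ℤ.- + i ℤ.+ + 2) ≤ℤ r) ∧ (r ≤ℤ ((+ (2 ℕ.* k) ℤ.- + i) ℤ.- + 1)))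
         (successiveRanks cs)
  where import Data.Nat as ℕ

C̄ : (k i n j : ℕ) → Set
C̄ k i n j = Σ (List Column) (λ cs → T (isC k i n j cs))

ρ : List Part → List ℕ
ρ λs = map value (filterB overlined λs) ++ map value (filterB (λ p → not (overlined p)) λs)

-- size of the generalized Durfee square: the largest N ≥ 0 with
-- #overlined + #{non-overlined parts ≥ N} ≥ N  (such N ≤ number of parts)
genDurfeeSize : List Part → ℕ
genDurfeeSize λs = largestUpTo ok (length λs)
  where
  ok : ℕ → Bool
  ok N = N ≤ᵇ numOverlined λs + countB (λ p → not (overlined p) ∧ (N ≤ᵇ value p)) λs

durfeeSize : List ℕ → ℕ
durfeeSize μ = largestUpTo (λ d → d ≤ᵇ entry μ d) (length μ)

durfeeSquareRem : List ℕ → List ℕ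
durfeeSquareRem μ = drop (durfeeSize μ) μ

-- Durfee rectangle: the (unique) d ≥ 0 with μ_{d+1} = d, if any;
-- returns the remainder (μ_{d+2}, …)
durfeeRectRem : List ℕ → Maybe (List ℕ)
durfeeRectRem μ = search 0 (suc (length μ))
  where
  search : ℕ → ℕ → Maybe (List ℕ)
  search d zero       = nothing
  search d (suc fuel) =
    if entry μ (suc d) ≡ᵇ d then just (drop (suc d) μ) else search (suc d) fuel

squaresRem : ℕ → List ℕ → List ℕ
squaresRem zero    μ = μ
squaresRem (suc r) μ = squaresRem r (durfeeSquareRem μ)

rectsRem : ℕ → List ℕ → Maybe (List ℕ)
rectsRem zero    μ = just μ
rectsRem (suc r) μ with durfeeRectRem μ
... | nothing = nothing
... | just μ′ = rectsRem r μ′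

isEmptyRem : Maybe (List ℕ) → Bool
isEmptyRem (just []) = true
isEmptyRem _         = false

hasDissection : (k i : ℕ) → List Part → Bool
hasDissection k i λs with k | i
... | zero  | _ = false   -- excluded by k ≥ 1
... | suc zero | _ = isEmptyRem (just (ρ λs))
... | suc (suc k′) | zero = false  -- excluded by i ≥ 1
... | suc (suc k′) | suc zero =
  let N = genDurfeeSize λs in
  if entry (ρ λs) (suc N) ≡ᵇ N
  then isEmptyRem (rectsRem k′ (drop (suc N) (ρ λs)))
  else false
... | suc (suc k′) | suc (suc i′) =
  isEmptyRem (rectsRem (suc (suc k′) ∸ suc (suc i′))
                (squaresRem i′
                  (drop (genDurfeeSize λs) (ρ λs))))

isD : (k i n j : ℕ) → List Part → Bool
isD k i n j λs =
  isOverpartition λs ∧ (weight λs ≡ᵇ n) ∧ (numOverlined λs ≡ᵇ j)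
  ∧ hasDissection k i λs

D̄ : (k i n j : ℕ) → Set
D̄ k i n j = Σ (List Part) (λ λs → T (isD k i n j λs))

-- (4) Lattice paths, Ē_{k,i}(n,j)
-- A path starting at (0, k-i) is determined by its list of steps.

data Step : Set where
  NE SE S E : Step

isNE : Step → Bool
isNE NE = true
isNE _  = false

isSouthOrSE : Step → Bool
isSouthOrSE SE = true
isSouthOrSE S  = true
isSouthOrSE _  = false

isS : Step → Bool
isS S = true
isS _ = false

validFrom : (k : ℕ) → ℕ → Maybe Step → List Step → Bool
validFrom k y prev [] = (y ≡ᵇ 0) ∧ endOk prev
  where
  endOk : Maybe Step → Bool
  endOk nothing  = true
  endOk (just s) = isSouthOrSE s
validFrom k y prev (NE ∷ ss) = (suc y <ᵇ k) ∧ validFrom k (suc y) (just NE) ss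
validFrom k zero prev (SE ∷ ss) = false
validFrom k (suc y) prev (SE ∷ ss) = validFrom k y (just SE) ss
validFrom k zero prev (S ∷ ss) = false
validFrom k (suc y) (just NE) (S ∷ ss) = validFrom k y (just S) ss
validFrom k (suc y) _ (S ∷ ss) = false
validFrom k zero prev (E ∷ ss) = validFrom k zero (just E) ss
validFrom k (suc y) prev (E ∷ ss) = false

specialPath : (k i : ℕ) → List Step → Bool
specialPath k i ss = ((k ∸ i) <ᵇ k) ∧ validFrom k (k ∸ i) nothing ss

dx : Step → ℕ
dx S = 0
dx _ = 1

-- major index: sum of x-coordinates of peaks (vertices preceded by NE and
-- followed by S or SE); x = current x-coordinate before the next step
majorFrom : ℕ → List Step → ℕ
majorFrom x []       = 0
majorFrom x (s ∷ ss) = peak s ss + majorFrom (x + dx s) ss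
  where
  peak : Step → List Step → ℕ
  peak NE (t ∷ _) = if isSouthOrSE t then x + 1 else 0
  peak _  _       = 0

majorIndex : List Step → ℕ
majorIndex = majorFrom 0

isE : (k i n j : ℕ) → List Step → Bool
isE k i n j ss =
  specialPath k i ss ∧ (majorIndex ss ≡ᵇ n) ∧ (countB isS ss ≡ᵇ j)

Ē : (k i n j : ℕ) → Set
Ē k i n j = Σ (List Step) (λ ss → T (isE k i n j ss))

{-# OPTIONS --safe #-}
-- With k = K + 1 and y = k - i, all four families are matched with the lattice paths.
--
-- B ↔ E. Record an overpartition by the numbers of non-overlined and overlined parts of each size;
-- the two conditions on it become  f(v) + f(v+1) + f̄(v+1) ≤ K  for v ≥ 0, with f(0) = y.  Reading one
-- more step of the path from its end raises some parts by one each, as in the Burge correspondence: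
-- a scan over the sizes carries at most one part at a time to the next size.  The number of parts that
-- move is the number of peaks of the path, which is how much the step adds to the major index.
--
-- C ↔ E. Unfold the path at height 0 into a path with signed heights.  The m-th peak from the right is
-- the m-th column, at abscissa a + b + 1, and its signed height is determined by the successive rank;
-- a South step at the peak means that b is not overlined.
--
-- D ↔ E. Replacing South by South-East steps splits off one bit per peak.  Deleting all N peaks of a
-- path of height at most K + 1 leaves a path of height at most K and the multiset of N abscissas of the
-- deleted peaks, which contains the M peaks of the smaller path; the weight drops by N².  This gives
-- q^(N²)/(q)_(N-M), and 1/((q)_M (q)_(N-M)) = [N choose M]/(q)_N turns it into the successive Durfee
-- blocks.  The same identity splits the generalized Durfee block into bits and a partition.
module Submission where

open import Defs
open import Data.Nat using (ℕ; _≤_)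
open import Data.Fin using (Fin)
open import Data.Product using (∃-syntax; _×_)
open import Function.Bundles using (_↔_)

open import Data.Bool using (Bool; true; false; _∧_; not; T; if_then_else_)
import Data.Bool.Properties as Bool
open import Data.Bool.Properties using (T-irrelevant; T-≡; T?)
open import Data.Empty using (⊥; ⊥-elim)
import Data.Fin as Fin
import Data.Integer as ℤ
import Data.Integer.Properties as ℤₚ
import Data.Integer.Tactic.RingSolver as ℤSolver
open import Data.List using (List; []; _∷_; _++_; length; map; drop; replicate; reverse; lookup; filter; deduplicate; cartesianProduct; cartesianProductWith; upTo)
open import Data.List.Membership.Propositional using (_∈_)
open import Data.List.Membership.Propositional.Properties using (∈-filter⁺; ∈-filter⁻; ∈-deduplicate⁺; ∈-deduplicate⁻; ∈-lookup; ∈-cartesianProduct⁺; ∈-cartesianProductWith⁺; ∈-upTo⁺)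
import Data.List.Properties as List
open import Data.List.Properties using (length-++; length-map; length-reverse; unfold-reverse; reverse-involutive; reverse-injective; ++-assoc)
open import Data.List.Relation.Unary.All using (All; []; _∷_)
import Data.List.Relation.Unary.All as All
open import Data.List.Relation.Unary.AllPairs using ([]; _∷_)
open import Data.List.Relation.Unary.Any using (here; there; index)
open import Data.List.Relation.Unary.Any.Properties using (lookup-index)
open import Data.List.Relation.Unary.Unique.DecPropositional.Properties using (deduplicate-!)
open import Data.List.Relation.Unary.Unique.Propositional using (Unique)
open import Data.Maybe using (Maybe; just; nothing)
open import Data.Nat using (zero; suc; _+_; _*_; _∸_; _<_; z≤n; s≤s; s≤s⁻¹; _≤ᵇ_; _<ᵇ_; _≡ᵇ_; _≤?_)
open import Data.Nat.ListAction using (sum)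
open import Data.Nat.ListAction.Properties using (sum-++)
import Data.Nat.Properties as ℕ
open import Data.Nat.Properties hiding (_≤?_; _≟_)
open import Data.Nat.Tactic.RingSolver using (solve-∀)
open import Data.Product using (Σ; Σ-syntax; _,_; proj₁; proj₂)
import Data.Product.Properties as Product
open import Data.Sum using (_⊎_; inj₁; inj₂)
open import Data.Unit using (⊤; tt)
open import Function.Base using (_∘_)
open import Function.Bundles using (mk↔ₛ′; Equivalence; _⇔_; mk⇔)
open import Function.Construct.Composition using (_↔-∘_)
open import Function.Construct.Symmetry using (↔-sym)
open import Relation.Binary.Definitions using (DecidableEquality)
open import Relation.Binary.PropositionalEquality
open import Relation.Nullary using (¬_; yes; no)
open import Relation.Nullary.Decidable using (isYes≗does; toWitness; fromWitness)

-- Words: lattice paths with every South step merged into the preceding North-East step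

-- Once a South step is merged into the North-East step before it, every letter has width one. The
-- abscissa of a peak is then the number of letters up to it, and the major index is the sum over
-- all suffixes of their numbers of peaks, so each comparison of weights becomes one equation per
-- letter. Gaps are measured relative to the preceding peak, so that prepending a letter adds a gap,
-- changes the first one, or reflects them all. For the dissections no direct map is attempted:
-- words and overpartitions are both parametrized by the same data, namely N differences, N bits and
-- one bit word for each later block. Multisets are stored there by their successive differences, so
-- that no order condition has to be carried along. All families are subsets cut out by
-- proof-irrelevant predicates; a correspondence amounts to a map that respects the statistics, with
-- injectivity and surjectivity. Finiteness is then established for one family and transported.

Irr : {A : Set} → (A → Set) → Set
Irr P = ∀ a (x y : P a) → x ≡ y

×-irr : {A B : Set} → ((x y : A) → x ≡ y) → ((x y : B) → x ≡ y) → (x y : A × B) → x ≡ y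
×-irr f g (a , b) (a′ , b′) = cong₂ _,_ (f a a′) (g b b′)

Σ-≡ : {A : Set} {P : A → Set} → Irr P → {x y : Σ A P} → proj₁ x ≡ proj₁ y → x ≡ y
Σ-≡ irr {a , x} {.a , y} refl = cong (a ,_) (irr a x y)

subset-↔ : {A B : Set} {P : A → Set} {Q : B → Set} → Irr P → Irr Q →
  (f : A → B) (g : B → A) →
  (∀ a → P a → Q (f a)) → (∀ b → Q b → P (g b)) →
  (∀ a → P a → g (f a) ≡ a) → (∀ b → Q b → f (g b) ≡ b) →
  Σ A P ↔ Σ B Q
subset-↔ iP iQ f g pf pg gf fg = mk↔ₛ′
  (λ (a , p) → f a , pf a p) (λ (b , q) → g b , pg b q)
  (λ (b , q) → Σ-≡ iQ (fg b q)) (λ (a , p) → Σ-≡ iP (gf a p))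

-- The inverse is read off from surjectivity, which spares an explicit inverse function where
-- decoding is easier to state as existence of a preimage.
injSurj-↔ : {A B : Set} {P : A → Set} {Q : B → Set} → Irr P → Irr Q →
  (f : A → B) → (∀ a → P a → Q (f a)) →
  (∀ a a′ → P a → P a′ → f a ≡ f a′ → a ≡ a′) →
  (∀ b → Q b → Σ[ a ∈ A ] (P a × f a ≡ b)) →
  Σ A P ↔ Σ B Q
injSurj-↔ iP iQ f pf inj surj = mk↔ₛ′
  (λ (a , p) → f a , pf a p)
  (λ (b , q) → proj₁ (surj b q) , proj₁ (proj₂ (surj b q)))
  (λ (b , q) → Σ-≡ iQ (proj₂ (proj₂ (surj b q))))
  (λ (a , p) → let (a′ , p′ , e) = surj (f a) (pf a p) in Σ-≡ iP (inj a′ a p′ p e))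

+-swapˡ : ∀ a b c → a + (b + c) ≡ b + (a + c)
+-swapˡ = solve-∀

T-∧⁻ : ∀ {a b} → T (a ∧ b) → T a × T b
T-∧⁻ {true} {true} _ = tt , tt

T-∧⁺ : ∀ {a b} → T a → T b → T (a ∧ b)
T-∧⁺ {true} {true} _ _ = tt

-- P is a North-East step followed by a South step.
data Letter : Set where
  U D H P : Letter

NonEmpty : List Letter → Set
NonEmpty []      = ⊥
NonEmpty (_ ∷ _) = ⊤

-- Here `K` is k - 1, the largest height allowed. `P` returns to its starting height but visits the
-- next one. The nonempty tail after `H` expresses that a path does not end with an East step; a
-- final `U` is excluded by its height.
Valid : ℕ → ℕ → List Letter → Set
Valid K y       []      = y ≡ 0
Valid K y       (U ∷ w) = suc y ≤ K × Valid K (suc y) w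
Valid K zero    (D ∷ w) = ⊥
Valid K (suc y) (D ∷ w) = Valid K y w
Valid K zero    (H ∷ w) = NonEmpty w × Valid K zero w
Valid K (suc y) (H ∷ w) = ⊥
Valid K y       (P ∷ w) = suc y ≤ K × Valid K y w

peakAfterU : List Letter → ℕ
peakAfterU (D ∷ _) = 1
peakAfterU _       = 0

peaks : List Letter → ℕ
peaks []      = 0
peaks (U ∷ w) = peakAfterU w + peaks w
peaks (D ∷ w) = peaks w
peaks (H ∷ w) = peaks w
peaks (P ∷ w) = suc (peaks w)

-- A peak at abscissa x is counted once by each of the x suffixes that start at or before the letter
-- leading up to it.
maj : List Letter → ℕ
maj []      = 0
maj (l ∷ w) = peaks (l ∷ w) + maj w

numP : List Letter → ℕ
numP []      = 0
numP (P ∷ w) = suc (numP w)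
numP (_ ∷ w) = numP w

Word : (K y n j : ℕ) → List Letter → Set
Word K y n j w = Valid K y w × maj w ≡ n × numP w ≡ j

NonEmpty-irr : Irr NonEmpty
NonEmpty-irr (_ ∷ _) _ _ = refl

Valid-irr : ∀ K y → Irr (Valid K y)
Valid-irr K y       []      = ≡-irrelevant
Valid-irr K y       (U ∷ w) = ×-irr ≤-irrelevant (Valid-irr K (suc y) w)
Valid-irr K (suc y) (D ∷ w) = Valid-irr K y w
Valid-irr K zero    (H ∷ w) = ×-irr (NonEmpty-irr w) (Valid-irr K zero w)
Valid-irr K y       (P ∷ w) = ×-irr ≤-irrelevant (Valid-irr K y w)

Word-irr : ∀ K y n j → Irr (Word K y n j)
Word-irr K y n j w = ×-irr (Valid-irr K y w) (×-irr ≡-irrelevant ≡-irrelevant)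

steps : List Letter → List Step
steps []      = []
steps (U ∷ w) = NE ∷ steps w
steps (D ∷ w) = SE ∷ steps w
steps (H ∷ w) = E ∷ steps w
steps (P ∷ w) = NE ∷ S ∷ steps w

EndOk : Maybe Step → List Letter → Set
EndOk nothing   w = ⊤
EndOk (just SE) w = ⊤
EndOk (just S)  w = ⊤
EndOk _         w = NonEmpty w

EndOk-∷ : ∀ prev {l w} → EndOk prev (l ∷ w)
EndOk-∷ nothing   = tt
EndOk-∷ (just NE) = tt
EndOk-∷ (just SE) = tt
EndOk-∷ (just S)  = tt
EndOk-∷ (just E)  = tt

steps-valid : ∀ K y prev w → EndOk prev w → Valid K y w → T (validFrom (suc K) y prev (steps w))
steps-valid K .0 nothing   [] e refl = tt
steps-valid K .0 (just SE) [] e refl = tt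
steps-valid K .0 (just S)  [] e refl = tt
steps-valid K y prev (U ∷ []) e (_ , ())
steps-valid K y prev (U ∷ w@(_ ∷ _)) e (b , v) = T-∧⁺ (<⇒<ᵇ b) (steps-valid K (suc y) (just NE) w tt v)
steps-valid K (suc y) prev (D ∷ w) e v = steps-valid K y (just SE) w tt v
steps-valid K zero prev (H ∷ w@(_ ∷ _)) e (_ , v) = steps-valid K 0 (just E) w tt v
steps-valid K y prev (P ∷ w) e (b , v) = T-∧⁺ (<⇒<ᵇ b) (steps-valid K y (just S) w tt v)

-- After a North-East step a South step would be the second half of a `P`, so that situation is left
-- to `steps-surjU`, which decides between `U` and `P`.
steps-surj : ∀ K y prev ss → prev ≢ just NE → T (validFrom (suc K) y prev ss) →
  Σ[ w ∈ List Letter ] (EndOk prev w × Valid K y w × steps w ≡ ss)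
steps-surjU : ∀ K y ss → T (validFrom (suc K) (suc y) (just NE) ss) →
  Σ[ w ∈ List Letter ] (Valid K (suc y) w × steps w ≡ ss) ⊎ Σ[ w ∈ List Letter ] (Valid K y w ×
      S ∷ steps w ≡ ss)

steps-surj K zero nothing [] ne v = [] , tt , refl , refl
steps-surj K zero (just NE) [] ne v = ⊥-elim (ne refl)
steps-surj K zero (just SE) [] ne v = [] , tt , refl , refl
steps-surj K zero (just S) [] ne v = [] , tt , refl , refl
steps-surj K y prev (NE ∷ ss) ne v with T-∧⁻ {y <ᵇ K} v
... | b , v′ with steps-surjU K y ss v′
...   | inj₁ (w , v″ , e) = U ∷ w , EndOk-∷ prev , (<ᵇ⇒< y K b , v″) , cong (NE ∷_) e
...   | inj₂ (w , v″ , e) = P ∷ w , EndOk-∷ prev , (<ᵇ⇒< y K b , v″) , cong (NE ∷_) e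
steps-surj K (suc y) prev (SE ∷ ss) ne v with steps-surj K y (just SE) ss (λ ()) v
... | w , _ , v′ , e = D ∷ w , EndOk-∷ prev , v′ , cong (SE ∷_) e
steps-surj K (suc y) (just NE) (S ∷ ss) ne v = ⊥-elim (ne refl)
steps-surj K zero prev (E ∷ ss) ne v with steps-surj K zero (just E) ss (λ ()) v
... | w , o , v′ , e = H ∷ w , EndOk-∷ prev , (o , v′) , cong (E ∷_) e

-- The previous step is consulted only by a South step and at the end of the path, so here it may be
-- replaced by `nothing`.
steps-surjU K y (NE ∷ ss) v with steps-surj K (suc y) nothing (NE ∷ ss) (λ ()) v
... | w , _ , v′ , e = inj₁ (w , v′ , e)
steps-surjU K y (SE ∷ ss) v with steps-surj K y (just SE) ss (λ ()) v
... | w , _ , v′ , e = inj₁ (D ∷ w , v′ , cong (SE ∷_) e)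
steps-surjU K y (S ∷ ss) v with steps-surj K y (just S) ss (λ ()) v
... | w , _ , v′ , e = inj₂ (w , v′ , cong (S ∷_) e)

∷-inj : {A : Set} {x y : A} {xs ys : List A} → _≡_ {A = List A} (x ∷ xs) (y ∷ ys) → x ≡ y × xs ≡ ys
∷-inj refl = refl , refl

-- `U` and `P` both begin with a North-East step; they are told apart because the steps of a word
-- never begin with a South step.
steps-injective : ∀ v w → steps v ≡ steps w → v ≡ w
steps-injective [] [] e = refl
steps-injective [] (U ∷ _) ()
steps-injective [] (D ∷ _) ()
steps-injective [] (H ∷ _) ()
steps-injective [] (P ∷ _) ()
steps-injective (U ∷ v) (U ∷ w) e = cong (U ∷_) (steps-injective v w (proj₂ (∷-inj e)))
steps-injective (U ∷ []) (P ∷ w) ()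
steps-injective (U ∷ U ∷ v) (P ∷ w) ()
steps-injective (U ∷ D ∷ v) (P ∷ w) ()
steps-injective (U ∷ H ∷ v) (P ∷ w) ()
steps-injective (U ∷ P ∷ v) (P ∷ w) ()
steps-injective (D ∷ v) (D ∷ w) e = cong (D ∷_) (steps-injective v w (proj₂ (∷-inj e)))
steps-injective (H ∷ v) (H ∷ w) e = cong (H ∷_) (steps-injective v w (proj₂ (∷-inj e)))
steps-injective (P ∷ v) (P ∷ w) e = cong (P ∷_) (steps-injective v w (proj₂ (∷-inj (proj₂ (∷-inj e)))))
steps-injective (P ∷ v) (U ∷ []) ()
steps-injective (P ∷ v) (U ∷ U ∷ w) ()
steps-injective (P ∷ v) (U ∷ D ∷ w) ()
steps-injective (P ∷ v) (U ∷ H ∷ w) ()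
steps-injective (P ∷ v) (U ∷ P ∷ w) ()

shift-x : ∀ x p m → (x + 1) * p + m ≡ x * p + (p + m)
shift-x = solve-∀

-- Starting at abscissa `x` moves every peak by `x`; the induction needs this general form because
-- each letter advances the start.
steps-major : ∀ x w → majorFrom x (steps w) ≡ x * peaks w + maj w
steps-major x [] = sym (trans (+-identityʳ _) (*-zeroʳ x))
steps-major x (U ∷ w) = trans (first w)
    (trans (cong ((x + 1) * peakAfterU w +_) (steps-major (x + 1) w)) (eq x (peakAfterU w) (peaks w) (maj w)))
  where
  eq : ∀ x a p m → (x + 1) * a + ((x + 1) * p + m) ≡ x * (a + p) + (a + p + m)
  eq = solve-∀
  first : ∀ w → majorFrom x (NE ∷ steps w) ≡ (x + 1) * peakAfterU w + majorFrom (x + 1) (steps w)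
  first []      = cong (_+ 0) (sym (*-zeroʳ (x + 1)))
  first (U ∷ w) = cong (_+ majorFrom (x + 1) (steps (U ∷ w))) (sym (*-zeroʳ (x + 1)))
  first (D ∷ w) = cong (_+ majorFrom (x + 1) (steps (D ∷ w))) (sym (*-identityʳ (x + 1)))
  first (H ∷ w) = cong (_+ majorFrom (x + 1) (steps (H ∷ w))) (sym (*-zeroʳ (x + 1)))
  first (P ∷ w) = cong (_+ majorFrom (x + 1) (steps (P ∷ w))) (sym (*-zeroʳ (x + 1)))
steps-major x (D ∷ w) = trans (steps-major (x + 1) w) (shift-x x (peaks w) (maj w))
steps-major x (H ∷ w) = trans (steps-major (x + 1) w) (shift-x x (peaks w) (maj w))
steps-major x (P ∷ w) = trans (cong (x + 1 +_) (steps-major (x + 1 + 0) w)) (eq x (peaks w) (maj w))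
  where
  eq : ∀ x p m → x + 1 + ((x + 1 + 0) * p + m) ≡ x * (1 + p) + (1 + p + m)
  eq = solve-∀

steps-numS : ∀ w → countB isS (steps w) ≡ numP w
steps-numS [] = refl
steps-numS (U ∷ w) = steps-numS w
steps-numS (D ∷ w) = steps-numS w
steps-numS (H ∷ w) = steps-numS w
steps-numS (P ∷ w) = cong suc (steps-numS w)

i≤k⇒[k∸i]<k : ∀ K i → 1 ≤ i → suc K ∸ i < suc K
i≤k⇒[k∸i]<k K (suc i) _ = s≤s (m∸n≤m K i)

Word↔Ē : ∀ K i n j → 1 ≤ i → Σ (List Letter) (Word K (suc K ∸ i) n j) ↔ Ē (suc K) i n j
Word↔Ē K i n j 1≤i = injSurj-↔ (Word-irr K y n j) (λ _ → T-irrelevant) steps to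
  (λ v w _ _ → steps-injective v w) from
  where
  y = suc K ∸ i
  to : ∀ w → Word K y n j w → T (isE (suc K) i n j (steps w))
  to w (v , m , s) = T-∧⁺ (T-∧⁺ (<⇒<ᵇ (i≤k⇒[k∸i]<k K i 1≤i)) (steps-valid K y nothing w tt v))
    (T-∧⁺ (≡⇒≡ᵇ _ n (trans (steps-major 0 w) m)) (≡⇒≡ᵇ _ j (trans (steps-numS w) s)))
  from : ∀ ss → T (isE (suc K) i n j ss) → Σ[ w ∈ _ ] (Word K y n j w × steps w ≡ ss)
  from ss t with T-∧⁻ {specialPath (suc K) i ss} t
  ... | sp , mj with T-∧⁻ {y <ᵇ suc K} sp | T-∧⁻ {majorIndex ss ≡ᵇ n} mj
  ... | _ , v | m , s with steps-surj K y nothing ss (λ ()) v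
  ... | w , _ , v′ , refl = w , (v′ , trans (sym (steps-major 0 w)) (≡ᵇ⇒≡ _ n m) ,
      trans (sym (steps-numS w)) (≡ᵇ⇒≡ _ j s)) , refl

-- The Burge correspondence

-- The number of non-overlined parts of a given size, and whether there is an overlined one.
Cell : Set
Cell = ℕ × Bool

bit : Bool → ℕ
bit false = 0
bit true  = 1

parts : Cell → ℕ
parts (f , o) = f + bit o

-- The part, if any, that is being carried from one size to the next: non-overlined or overlined.
data Mover : Set where
  none non over : Mover

moved : Mover → ℕ
moved none = 0
moved non  = 1
moved over = 1

movedOver : Mover → ℕ
movedOver none = 0
movedOver non  = 0
movedOver over = 1

-- The mover arrives from the next smaller size, and the one returned goes on to the next larger
-- size. An arriving non-overlined part stays and ends the carry. Otherwise the cell sends on its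
-- overlined part if it has one, else a non-overlined one, and an arriving overlined part settles;
-- no size ever holds two overlined parts.
shift : Mover → Cell → Cell × Mover
shift none (f , true)      = (f , false) , over
shift none (0 , false)     = (0 , false) , none
shift none (suc f , false) = (f , false) , non
shift over (f , true)      = (f , true) , over
shift over (0 , false)     = (0 , true) , none
shift over (suc f , false) = (f , true) , non
shift non  (f , o)         = (suc f , o) , none

raise : Mover → List Cell → List Cell
raise none []      = []
raise non  []      = (1 , false) ∷ []
raise over []      = (0 , true) ∷ []
raise m    (c ∷ l) = proj₁ (shift m c) ∷ raise (proj₂ (shift m c)) l

-- Runs `shift` backwards, against the direction of the scan: from the mover that left and the cell
-- after the move it recovers the mover that arrived and the cell before. This works because `shift`
-- is a bijection on pairs.
pull : Mover → Cell → Mover × Cell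
pull none (0 , false) = none , (0 , false)
pull none (0 , true)  = over , (0 , false)
pull none (suc f , o) = non , (f , o)
pull non  (f , false) = none , (suc f , false)
pull non  (f , true)  = over , (suc f , false)
pull over (f , false) = none , (f , true)
pull over (f , true)  = over , (f , true)

infixr 5 _◁_
-- Lowering can empty the cell of the largest size; dropping trailing empty cells keeps one list per
-- family of multiplicities.
_◁_ : Cell → List Cell → List Cell
(0 , false) ◁ [] = []
c           ◁ l  = c ∷ l

lower : List Cell → Mover × List Cell
lower []      = none , []
lower (c ∷ l) = let (m , l′) = lower l ; (m′ , c′) = pull m c in m′ , c′ ◁ l′

PosCell : Cell → Set
PosCell (0 , false) = ⊥
PosCell _           = ⊤

Normal : List Cell → Set
Normal []              = ⊤
Normal (c ∷ [])        = PosCell c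
Normal (_ ∷ l@(_ ∷ _)) = Normal l

Normal-tail : ∀ c l → Normal (c ∷ l) → Normal l
Normal-tail c []      _ = tt
Normal-tail c (_ ∷ _) n = n

pull-shift : ∀ m c → pull (proj₂ (shift m c)) (proj₁ (shift m c)) ≡ (m , c)
pull-shift none (0 , false)     = refl
pull-shift none (suc f , false) = refl
pull-shift none (f , true)      = refl
pull-shift over (0 , false)     = refl
pull-shift over (suc f , false) = refl
pull-shift over (f , true)      = refl
pull-shift non  (f , o)         = refl

shift-pull : ∀ c m → shift (proj₁ (pull m c)) (proj₂ (pull m c)) ≡ (c , m)
shift-pull (0 , false)     none = refl
shift-pull (0 , true)      none = refl
shift-pull (suc f , o)     none = refl
shift-pull (f , false)     non  = refl
shift-pull (f , true)      non  = refl
shift-pull (f , false)     over = refl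
shift-pull (f , true)      over = refl

◁-Normal : ∀ c l → Normal (c ∷ l) → c ◁ l ≡ c ∷ l
◁-Normal (suc f , o)     []      n = refl
◁-Normal (0 , true)      []      n = refl
◁-Normal (suc f , o)     (_ ∷ _) n = refl
◁-Normal (0 , false)     (_ ∷ _) n = refl
◁-Normal (0 , true)      (_ ∷ _) n = refl

Normal-◁ : ∀ c l → Normal l → Normal (c ◁ l)
Normal-◁ (0 , false)  []      n = tt
Normal-◁ (0 , true)   []      n = tt
Normal-◁ (suc _ , _)  []      n = tt
Normal-◁ (0 , false)  (_ ∷ _) n = n
Normal-◁ (0 , true)   (_ ∷ _) n = n
Normal-◁ (suc _ , _)  (_ ∷ _) n = n

NonNil : List Cell → Set
NonNil []      = ⊥
NonNil (_ ∷ _) = ⊤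

raise-∷ : ∀ m c l → raise m (c ∷ l) ≡ proj₁ (shift m c) ∷ raise (proj₂ (shift m c)) l
raise-∷ none c l = refl
raise-∷ non  c l = refl
raise-∷ over c l = refl

lower-raise : ∀ m l → Normal l → lower (raise m l) ≡ (m , l)
lower-raise none [] n = refl
lower-raise non  [] n = refl
lower-raise over [] n = refl
lower-raise m (c ∷ l) n
  rewrite raise-∷ m c l | lower-raise (proj₂ (shift m c)) l (Normal-tail c l n) | pull-shift m c
        | ◁-Normal c l n = refl

Normal-lower : ∀ l → Normal (proj₂ (lower l))
Normal-lower []      = tt
Normal-lower (c ∷ l) = Normal-◁ (proj₂ (pull (proj₁ (lower l)) c)) _ (Normal-lower l)

-- An empty cell dropped by `◁` reappears when a part arrives in it. The only failing case, where
-- nothing arrives, would leave a trailing empty cell and is excluded by normality.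
raise-◁ : ∀ m c l → Normal (proj₁ (shift m c) ∷ raise (proj₂ (shift m c)) l) →
  raise m (c ◁ l) ≡ proj₁ (shift m c) ∷ raise (proj₂ (shift m c)) l
raise-◁ non  (0 , false) []      n = refl
raise-◁ over (0 , false) []      n = refl
raise-◁ m    (0 , false) (d ∷ l) n = raise-∷ m (0 , false) (d ∷ l)
raise-◁ m    (0 , true)  l       n = raise-∷ m (0 , true) l
raise-◁ m    (suc f , o) l       n = raise-∷ m (suc f , o) l

raise-lower : ∀ l → Normal l → raise (proj₁ (lower l)) (proj₂ (lower l)) ≡ l
raise-lower []      n = refl
raise-lower (c ∷ l) n = trans (raise-◁ m′ c′ l′ (subst Normal (sym eq) n)) eq
  where
  m  = proj₁ (lower l)
  l′ = proj₂ (lower l)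
  m′ = proj₁ (pull m c)
  c′ = proj₂ (pull m c)
  eq : proj₁ (shift m′ c′) ∷ raise (proj₂ (shift m′ c′)) l′ ≡ c ∷ l
  eq rewrite shift-pull c m = cong (c ∷_) (raise-lower l (Normal-tail c l n))

Normal-raise : ∀ m l → Normal l → Normal (raise m l)
Normal-raise none [] n = tt
Normal-raise non  [] n = tt
Normal-raise over [] n = tt
Normal-raise m (c ∷ l) n rewrite raise-∷ m c l =
    go m c l n (Normal-raise (proj₂ (shift m c)) l (Normal-tail c l n))
  where
  ext : ∀ c l → (l ≡ [] → PosCell c) → Normal l → Normal (c ∷ l)
  ext c []      p n = p refl
  ext c (_ ∷ _) p n = n
  go : ∀ m c l → Normal (c ∷ l) → Normal (raise (proj₂ (shift m c)) l) →
    Normal (proj₁ (shift m c) ∷ raise (proj₂ (shift m c)) l)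
  go none (0 , false)     (d ∷ l) n n′ = n′
  go none (suc f , false) []      n n′ = tt
  go none (suc f , false) (_ ∷ _) n n′ = n′
  go none (f , true)      []      n n′ = tt
  go none (f , true)      (_ ∷ _) n n′ = n′
  go over (0 , false)     l       n n′ = ext _ (raise none l) (λ _ → tt) n′
  go over (suc f , false) []      n n′ = tt
  go over (suc f , false) (_ ∷ _) n n′ = n′
  go over (f , true)      []      n n′ = tt
  go over (f , true)      (_ ∷ _) n n′ = n′
  go non  (f , o)         l       n n′ = ext _ (raise none l) (λ _ → tt) n′

moves : Mover → List Cell → ℕ
moves m []      = 0
moves m (c ∷ l) = moved (proj₂ (shift m c)) + moves (proj₂ (shift m c)) l

moves-over : ∀ l → moves over l ≡ moves none l
moves-over []                  = refl
moves-over ((0 , false) ∷ l)     = refl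
moves-over ((suc f , false) ∷ l) = refl
moves-over ((f , true) ∷ l)      = refl

-- This compares two successive scans. If nothing enters the second, it moves as many parts as the
-- first, the part entering the first included. If a non-overlined part enters, it stops in the
-- first cell, and the rest is a scan of the tail that nothing enters. So the number of moves
-- follows the number of peaks of the path.
moves-none-raise : ∀ m l → moves none (raise m l) ≡ moved m + moves m l
moves-non-raise : ∀ m l → moves non (raise m l) ≡ moves m l
moves-over-raise : ∀ m l → moves over (raise m l) ≡ moved m + moves m l

moves-over-raise m l = trans (moves-over (raise m l)) (moves-none-raise m l)

moves-non-raise none [] = refl
moves-non-raise non  [] = refl
moves-non-raise over [] = refl
moves-non-raise m (c ∷ l) rewrite raise-∷ m c l = moves-none-raise (proj₂ (shift m c)) l

moves-none-raise none [] = refl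
moves-none-raise non  [] = refl
moves-none-raise over [] = refl
moves-none-raise none ((0 , false) ∷ l)           = moves-none-raise none l
moves-none-raise none ((1 , false) ∷ l)           = moves-none-raise non l
moves-none-raise none ((suc (suc f) , false) ∷ l) = cong suc (moves-non-raise non l)
moves-none-raise none ((0 , true) ∷ l)            = moves-none-raise over l
moves-none-raise none ((suc f , true) ∷ l)        = cong suc (moves-non-raise over l)
moves-none-raise over ((0 , false) ∷ l)           = cong suc (moves-over-raise none l)
moves-none-raise over ((suc f , false) ∷ l)       = cong suc (moves-over-raise non l)
moves-none-raise over ((f , true) ∷ l)            = cong suc (moves-over-raise over l)
moves-none-raise non  ((f , false) ∷ l)           = cong suc (moves-non-raise none l)
moves-none-raise non  ((f , true) ∷ l)            = cong suc (moves-over-raise none l)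

total : List Cell → ℕ
total []      = 0
total (c ∷ l) = parts c + total l

cellWeight : List Cell → ℕ
cellWeight []      = 0
cellWeight (c ∷ l) = total (c ∷ l) + cellWeight l

overs : List Cell → ℕ
overs []      = 0
overs (c ∷ l) = bit (proj₂ c) + overs l

shift-parts : ∀ m c → parts (proj₁ (shift m c)) + moved (proj₂ (shift m c)) ≡ parts c + moved m
shift-parts none (0 , false)     = refl
shift-parts none (suc f , false) =
    trans (cong (_+ 1) (+-identityʳ f)) (trans (+-comm f 1) (sym (trans (+-identityʳ _) (+-identityʳ _))))
shift-parts none (f , true)      = trans (cong (_+ 1) (+-identityʳ f)) (sym (+-identityʳ _))
shift-parts over (0 , false)     = refl
shift-parts over (suc f , false) =
    trans (+-assoc f 1 1) (trans (eq f) (cong (_+ 1) (sym (+-identityʳ (suc f)))))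
  where
  eq : ∀ f → f + 2 ≡ suc f + 1
  eq = solve-∀
shift-parts over (f , true)      = refl
shift-parts non  (f , o)         = trans (+-identityʳ _) (sym (+-comm (f + bit o) 1))

shift-overs : ∀ m c → bit (proj₂ (proj₁ (shift m c))) + movedOver (proj₂ (shift m c)) ≡ bit
    (proj₂ c) + movedOver m
shift-overs none (0 , false)     = refl
shift-overs none (suc f , false) = refl
shift-overs none (f , true)      = refl
shift-overs over (0 , false)     = refl
shift-overs over (suc f , false) = refl
shift-overs over (f , true)      = refl
shift-overs non  (f , o)         = refl

+-exchange : ∀ {a b c d x y} → a + b ≡ c + d → x ≡ y + b → a + x ≡ c + y + d
+-exchange {a} {b} {c} {d} {x} {y} e refl = trans (trans (cong (a +_) (+-comm y b)) (sym (+-assoc a b y)))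
  (trans (cong (_+ y) e) (trans (+-assoc c d y) (trans (cong (c +_) (+-comm d y)) (sym (+-assoc c y d)))))

raise-total : ∀ m l → total (raise m l) ≡ total l + moved m
raise-total none [] = refl
raise-total non  [] = refl
raise-total over [] = refl
raise-total m (c ∷ l) rewrite raise-∷ m c l =
  +-exchange {parts (proj₁ (shift m c))} {_} {parts c} {moved m} {_} {total l} (shift-parts m c)
      (raise-total (proj₂ (shift m c)) l)

raise-overs : ∀ m l → overs (raise m l) ≡ overs l + movedOver m
raise-overs none [] = refl
raise-overs non  [] = refl
raise-overs over [] = refl
raise-overs m (c ∷ l) rewrite raise-∷ m c l =
  +-exchange {bit (proj₂ (proj₁ (shift m c)))} {_} {bit (proj₂ c)} {movedOver m} {_} {overs l}
      (shift-overs m c) (raise-overs (proj₂ (shift m c)) l)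

-- Every moving part gains one, and the entering part counts as moving up from size 0.
raise-weight : ∀ m l → cellWeight (raise m l) ≡ moved m + moves m l + cellWeight l
raise-weight none [] = refl
raise-weight non  [] = refl
raise-weight over [] = refl
raise-weight m (c ∷ l) = trans (cong cellWeight (raise-∷ m c l))
  (trans (cong₂ _+_ (trans (sym (cong total (raise-∷ m c l))) (raise-total m (c ∷ l)))
      (raise-weight (proj₂ (shift m c)) l))
    (eq (total (c ∷ l)) (moved m) (moved (proj₂ (shift m c))) (moves (proj₂ (shift m c)) l) (cellWeight l)))
  where
  eq : ∀ t a b c w → t + a + (b + c + w) ≡ a + (b + c) + (t + w)
  eq = solve-∀

-- The height `y` acts as the number of parts of size 0: read from the end of the path, `U` turns
-- such a part into one of size 1, `D` creates one, and `P` lets an overlined part enter while their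
-- number stays the same.
Bounded : ℕ → ℕ → List Cell → Set
Bounded K y []            = y ≤ K
Bounded K y ((f , o) ∷ l) = y + (f + bit o) ≤ K × Bounded K f l

Bounded⇒≤ : ∀ K y l → Bounded K y l → y ≤ K
Bounded⇒≤ K y []      b       = b
Bounded⇒≤ K y (c ∷ l) (b , _) = ≤-trans (m≤m+n y _) b

Bounded-irr : ∀ K y → Irr (Bounded K y)
Bounded-irr K y []      = ≤-irrelevant
Bounded-irr K y (c ∷ l) = ×-irr ≤-irrelevant (Bounded-irr K _ l)

+0 : ∀ {a} → a + 0 ≡ a
+0 = +-identityʳ _

≤-by : ∀ {a b K} → a ≡ b → a ≤ K → b ≤ K
≤-by e = subst (_≤ _) e

-- For the tail, the multiplicity `f` of a cell plays the role of the height: when a mover leaves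
-- the cell, `f` changes exactly as the height does under the letter with that mover. Hence the four
-- statements, for `U`, `P`, `D` and `H`, call each other.
bounded-non : ∀ K y l → Bounded K (suc y) l → Bounded K y (raise non l)
bounded-over : ∀ K y l → suc y ≤ K → Bounded K y l → Bounded K y (raise over l)
bounded-none : ∀ K y l → suc y ≤ K → Bounded K y l → Bounded K (suc y) (raise none l)
bounded-none₀ : ∀ K l → Bounded K 0 l → Bounded K 0 (raise none l)

bounded-non K y [] b = ≤-by (+-comm 1 y) b , ≤-trans (s≤s z≤n) b
bounded-non K y ((f , o) ∷ l) (b , b′) = ≤-by (sym (+-suc y (f + bit o))) b ,
  bounded-none K f l (≤-trans (s≤s (≤-trans (m≤m+n f (bit o)) (m≤n+m _ y))) b) b′

bounded-over K y [] s b = ≤-by (+-comm 1 y) s , z≤n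
bounded-over K y ((0 , false) ∷ l) s (b , b′) = ≤-by (+-comm 1 y) s , bounded-none₀ K l b′
bounded-over K y ((suc f , false) ∷ l) s (b , b′) =
  ≤-by (cong (y +_) (trans +0 (+-comm 1 f))) b , bounded-non K f l b′
bounded-over K y ((f , true) ∷ l) s (b , b′) =
  b , bounded-over K f l (≤-trans (≤-by (+-comm f 1) (≤-refl {f + 1})) (≤-trans (m≤n+m _ y) b)) b′

bounded-none K y [] s b = s
bounded-none K y ((0 , false) ∷ l) s (b , b′) = ≤-by (sym +0) s , bounded-none₀ K l b′
bounded-none K y ((suc f , false) ∷ l) s (b , b′) =
  ≤-by (+-suc y (f + 0)) b , bounded-non K f l b′
bounded-none K y ((f , true) ∷ l) s (b , b′) =
  ≤-by (trans (cong (y +_) (trans (+-comm f 1) (cong suc (sym +0)))) (+-suc y (f + 0))) b ,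
  bounded-over K f l (≤-trans (≤-by (+-comm f 1) (≤-refl {f + 1})) (≤-trans (m≤n+m _ y) b)) b′

bounded-none₀ K [] b = b
bounded-none₀ K ((0 , false) ∷ l) (b , b′) = b , bounded-none₀ K l b′
bounded-none₀ K ((suc f , false) ∷ l) (b , b′) = ≤-trans (n≤1+n _) b , bounded-non K f l b′
bounded-none₀ K ((f , true) ∷ l) (b , b′) =
  ≤-trans (≤-by (sym +0) (m≤m+n f 1)) b ,
  bounded-over K f l (≤-by (+-comm f 1) b) b′

bounded-non⁻ : ∀ K y l → Bounded K y (raise non l) → Bounded K (suc y) l
bounded-over⁻ : ∀ K y l → Bounded K y (raise over l) → suc y ≤ K × Bounded K y l
bounded-none⁻ : ∀ K y l → Bounded K (suc y) (raise none l) → Bounded K y l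
bounded-none₀⁻ : ∀ K l → Bounded K 0 (raise none l) → Bounded K 0 l

bounded-non⁻ K y [] (b , _) = ≤-by (+-comm y 1) b
bounded-non⁻ K y ((f , o) ∷ l) (b , b′) = ≤-by (+-suc y (f + bit o)) b , bounded-none⁻ K f l b′

bounded-over⁻ K y [] (b , _) = ≤-by (+-comm y 1) b , ≤-trans (m≤m+n y 1) b
bounded-over⁻ K y ((0 , false) ∷ l) (b , b′) =
  ≤-by (+-comm y 1) b , ≤-trans (+-monoʳ-≤ y z≤n) b , bounded-none₀⁻ K l b′
bounded-over⁻ K y ((suc f , false) ∷ l) (b , b′) =
  ≤-trans (≤-by (+-comm y 1) (+-monoʳ-≤ y (m≤n+m 1 f))) b ,
  ≤-by (cong (y +_) (trans (+-comm f 1) (sym +0))) b , bounded-non⁻ K f l b′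
bounded-over⁻ K y ((f , true) ∷ l) (b , b′) =
  ≤-trans (≤-by (+-comm y 1) (+-monoʳ-≤ y (m≤n+m 1 f))) b , b , proj₂ (bounded-over⁻ K f l b′)

bounded-none⁻ K y [] b = ≤-trans (n≤1+n y) b
bounded-none⁻ K y ((0 , false) ∷ l) (b , b′) = ≤-trans (n≤1+n _) b , bounded-none₀⁻ K l b′
bounded-none⁻ K y ((suc f , false) ∷ l) (b , b′) = ≤-by (sym (+-suc y (f + 0))) b , bounded-non⁻ K f l b′
bounded-none⁻ K y ((f , true) ∷ l) (b , b′) =
  ≤-by (sym (trans (cong (y +_) (trans (+-comm f 1) (cong suc (sym +0)))) (+-suc y (f + 0)))) b ,
  proj₂ (bounded-over⁻ K f l b′)

bounded-none₀⁻ K [] b = b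
bounded-none₀⁻ K ((0 , false) ∷ l) (b , b′) = b , bounded-none₀⁻ K l b′
bounded-none₀⁻ K ((suc f , false) ∷ l) (b , b′) with bounded-non⁻ K f l b′
... | b″ = ≤-by (sym +0) (Bounded⇒≤ K (suc f) l b″) , b″
bounded-none₀⁻ K ((f , true) ∷ l) (b , b′) with bounded-over⁻ K f l b′
... | s , b″ = ≤-by (+-comm 1 f) s , b″

cells : List Letter → List Cell
cells []      = []
cells (U ∷ w) = raise non (cells w)
cells (D ∷ w) = raise none (cells w)
cells (H ∷ w) = raise none (cells w)
cells (P ∷ w) = raise over (cells w)

cells-Normal : ∀ w → Normal (cells w)
cells-Normal []      = tt
cells-Normal (U ∷ w) = Normal-raise non (cells w) (cells-Normal w)
cells-Normal (D ∷ w) = Normal-raise none (cells w) (cells-Normal w)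
cells-Normal (H ∷ w) = Normal-raise none (cells w) (cells-Normal w)
cells-Normal (P ∷ w) = Normal-raise over (cells w) (cells-Normal w)

cells-Bounded : ∀ K y w → y ≤ K → Valid K y w → Bounded K y (cells w)
cells-Bounded K y       []      b v       = b
cells-Bounded K y       (U ∷ w) b (s , v) = bounded-non K y _ (cells-Bounded K (suc y) w s v)
cells-Bounded K (suc y) (D ∷ w) b v       = bounded-none K y _ b (cells-Bounded K y w (≤-trans (n≤1+n y) b) v)
cells-Bounded K zero    (H ∷ w) b (_ , v) = bounded-none₀ K _ (cells-Bounded K zero w b v)
cells-Bounded K y       (P ∷ w) b (s , v) = bounded-over K y _ s (cells-Bounded K y w b v)

-- Whether `U` makes a peak depends on the letter after it, so the induction needs a second
-- statement about what follows a `U`.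
cells-peaks : ∀ K y w → Valid K y w → peaks w ≡ moves none (cells w)
cells-peaks-U : ∀ K y w → Valid K (suc y) w → peakAfterU w + peaks w ≡ suc (moves non (cells w))

cells-peaks K y       []      v       = refl
cells-peaks K y       (U ∷ w) (_ , v) = trans (cells-peaks-U K y w v) (sym (moves-none-raise non (cells w)))
cells-peaks K (suc y) (D ∷ w) v       = trans (cells-peaks K y w v) (sym (moves-none-raise none (cells w)))
cells-peaks K zero    (H ∷ w) (_ , v) = trans (cells-peaks K zero w v) (sym (moves-none-raise none (cells w)))
cells-peaks K y       (P ∷ w) (_ , v) =
    trans (cong suc (trans (cells-peaks K y w v) (sym (moves-over (cells w)))))
  (sym (moves-none-raise over (cells w)))

cells-peaks-U K y (U ∷ w) (_ , v) =
    trans (cells-peaks-U K (suc y) w v) (cong suc (sym (moves-non-raise non (cells w))))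
cells-peaks-U K y (D ∷ w) v = cong suc (trans (cells-peaks K y w v) (sym (moves-non-raise none (cells w))))
cells-peaks-U K y (P ∷ w) (_ , v) = cong suc (trans (cells-peaks K (suc y) w v)
  (trans (sym (moves-over (cells w))) (sym (moves-non-raise over (cells w)))))

cells-weight : ∀ K y w → Valid K y w → maj w ≡ cellWeight (cells w)
cells-weight K y       []      v       = refl
cells-weight K y       (U ∷ w) (_ , v) =
    trans (cong₂ _+_ (cells-peaks-U K y w v) (cells-weight K (suc y) w v)) (sym (raise-weight non (cells w)))
cells-weight K (suc y) (D ∷ w) v       =
    trans (cong₂ _+_ (cells-peaks K y w v) (cells-weight K y w v)) (sym (raise-weight none (cells w)))
cells-weight K zero    (H ∷ w) (_ , v) =
    trans (cong₂ _+_ (cells-peaks K zero w v) (cells-weight K zero w v)) (sym (raise-weight none (cells w)))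
cells-weight K y       (P ∷ w) (_ , v) =
    trans (cong₂ _+_ (cong suc (trans (cells-peaks K y w v) (sym (moves-over (cells w)))))
    (cells-weight K y w v))
  (sym (raise-weight over (cells w)))

cells-overs : ∀ w → numP w ≡ overs (cells w)
cells-overs []      = refl
cells-overs (U ∷ w) = trans (cells-overs w) (sym (trans (raise-overs non (cells w)) +0))
cells-overs (D ∷ w) = trans (cells-overs w) (sym (trans (raise-overs none (cells w)) +0))
cells-overs (H ∷ w) = trans (cells-overs w) (sym (trans (raise-overs none (cells w)) +0))
cells-overs (P ∷ w) = trans (cong suc (cells-overs w)) (sym (trans (raise-overs over (cells w)) (+-comm _ 1)))

moves-pos : ∀ l → Normal l → NonNil l → 0 < moves none l
moves-pos ((0 , false) ∷ d ∷ l) n _ = moves-pos (d ∷ l) n tt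
moves-pos ((suc f , false) ∷ l) n _ = s≤s z≤n
moves-pos ((f , true) ∷ l)      n _ = s≤s z≤n

raise-injective : ∀ m m′ l l′ → Normal l → Normal l′ → raise m l ≡ raise m′ l′ → m ≡ m′ × l ≡ l′
raise-injective m m′ l l′ n n′ e = cong proj₁ eq , cong proj₂ eq
  where
  eq : (m , l) ≡ (m′ , l′)
  eq = trans (sym (lower-raise m l n)) (trans (cong lower e) (lower-raise m′ l′ n′))

raise-NonNil : ∀ m l → m ≢ none → NonNil (raise m l)
raise-NonNil none l       ne = ⊥-elim (ne refl)
raise-NonNil non  []      ne = tt
raise-NonNil over []      ne = tt
raise-NonNil non  (_ ∷ _) ne = tt
raise-NonNil over (_ ∷ _) ne = tt

mover : Letter → Mover
mover U = non
mover D = none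
mover H = none
mover P = over

cells-∷ : ∀ l w → cells (l ∷ w) ≡ raise (mover l) (cells w)
cells-∷ U w = refl
cells-∷ D w = refl
cells-∷ H w = refl
cells-∷ P w = refl

-- Down-steps to the axis leave the cell list empty, but at height 0 only the empty word does; this
-- rests on the rule that `H` has a nonempty tail.
cells≢[] : ∀ K w → Valid K 0 w → NonEmpty w → NonNil (cells w)
cells≢[] K (U ∷ w) v _ = raise-NonNil non (cells w) (λ ())
cells≢[] K (H ∷ w) (ne , v) _ with cells w | cells≢[] K w v ne
... | c ∷ l | _ = tt
cells≢[] K (P ∷ w) v _ = raise-NonNil over (cells w) (λ ())

cells-injective : ∀ K y v w → Valid K y v → Valid K y w → cells v ≡ cells w → v ≡ w
cells-injective K y [] [] a b e = refl
cells-injective K .0 [] w@(_ ∷ _) refl b e = ⊥-elim (subst NonNil (sym e) (cells≢[] K w b tt))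
cells-injective K .0 v@(_ ∷ _) [] a refl e = ⊥-elim (subst NonNil e (cells≢[] K v a tt))
cells-injective K y (l ∷ v) (l′ ∷ w) a b e =
    go y l l′ a b e (raise-injective (mover l) (mover l′) _ _ (cells-Normal v) (cells-Normal w)
    (trans (sym (cells-∷ l v)) (trans e (cells-∷ l′ w))))
  where
  go : ∀ y l l′ → Valid K y (l ∷ v) → Valid K y (l′ ∷ w) → cells (l ∷ v) ≡ cells (l′ ∷ w) →
    mover l ≡ mover l′ × cells v ≡ cells w → l ∷ v ≡ l′ ∷ w
  go y       U U (_ , a) (_ , b) e (_ , e′) = cong (U ∷_) (cells-injective K (suc y) v w a b e′)
  go (suc y) D D a b e (_ , e′) = cong (D ∷_) (cells-injective K y v w a b e′)
  go zero    H H (_ , a) (_ , b) e (_ , e′) = cong (H ∷_) (cells-injective K zero v w a b e′)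
  go y       P P (_ , a) (_ , b) e (_ , e′) = cong (P ∷_) (cells-injective K y v w a b e′)
  -- `D` and `H` have the same mover; the height tells them apart.
  go zero    D H () b e _
  go zero    H D a () e _

cells-replicate-D : ∀ y → cells (replicate y D) ≡ []
cells-replicate-D zero = refl
cells-replicate-D (suc y) rewrite cells-replicate-D y = refl

Valid-replicate-D : ∀ K y → Valid K y (replicate y D)
Valid-replicate-D K zero    = refl
Valid-replicate-D K (suc y) = Valid-replicate-D K y

raise-grows : ∀ m l → Normal l → NonNil (raise m l) → 0 < moved m + moves m l
raise-grows none l@(_ ∷ _) n p = moves-pos l n tt
raise-grows non  l         n p = s≤s z≤n
raise-grows over l         n p = s≤s z≤n

-- The mover recovered by `lower`, together with the height, dictates the first letter. A nonempty
-- list has at least one moving part, so the weight drops; an empty one still needs the descent to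
-- the axis.
cells-surj : ∀ K fuel y l → cellWeight l ≤ fuel → Normal l → Bounded K y l →
  Σ[ w ∈ List Letter ] (Valid K y w × cells w ≡ l)
cells-surj-raise : ∀ K fuel y m l → cellWeight l < fuel → Normal l → NonNil (raise m l) →
    Bounded K y (raise m l) →
  Σ[ w ∈ List Letter ] (Valid K y w × cells w ≡ raise m l)

cells-surj K fuel y [] _ _ _ = replicate y D , Valid-replicate-D K y , cells-replicate-D y
cells-surj K fuel y l@(_ ∷ _) le n b =
  let (w , v , e′) = cells-surj-raise K fuel y m l′ less n′ p (subst (Bounded K y) (sym e) b)
  in w , v , trans e′ e
  where
  m : Mover
  m = proj₁ (lower l)
  l′ : List Cell
  l′ = proj₂ (lower l)
  e : raise m l′ ≡ l
  e = raise-lower l n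
  n′ : Normal l′
  n′ = Normal-lower l
  p : NonNil (raise m l′)
  p = subst NonNil (sym e) tt
  less : cellWeight l′ < fuel
  less = ≤-trans (+-monoˡ-≤ (cellWeight l′) (raise-grows m l′ n′ p))
    (≤-trans (≤-reflexive (sym (raise-weight m l′))) (subst (λ x → cellWeight x ≤ fuel) (sym e) le))

cells-surj-raise K (suc fuel) y m l (s≤s lt) n p b = go y m p b
  where
  go : ∀ y m → NonNil (raise m l) → Bounded K y (raise m l) →
      Σ[ w ∈ List Letter ] (Valid K y w × cells w ≡ raise m l)
  go y non p b with bounded-non⁻ K y l b
  ... | b′ with cells-surj K fuel (suc y) l lt n b′
  ... | w , v , e = U ∷ w , (Bounded⇒≤ K _ l b′ , v) , cong (raise non) e
  go y over p b with bounded-over⁻ K y l b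
  ... | s , b′ with cells-surj K fuel y l lt n b′
  ... | w , v , e = P ∷ w , (s , v) , cong (raise over) e
  go (suc y) none p b with cells-surj K fuel y l lt n (bounded-none⁻ K y l b)
  ... | w , v , e = D ∷ w , v , cong (raise none) e
  go zero none p b with cells-surj K fuel zero l lt n (bounded-none₀⁻ K l b)
  ... | w , v , e = H ∷ w , (ne w e , v) , cong (raise none) e
    where
    ne : ∀ w → cells w ≡ l → NonEmpty w
    ne [] refl = p
    ne (_ ∷ _) _ = tt

Freq : (K y n j : ℕ) → List Cell → Set
Freq K y n j l = (Normal l × Bounded K y l) × cellWeight l ≡ n × overs l ≡ j

PosCell-irr : Irr PosCell
PosCell-irr (0 , true)  _ _ = refl
PosCell-irr (suc _ , _) _ _ = refl

Normal-irr : Irr Normal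
Normal-irr []              _ _ = refl
Normal-irr (c ∷ [])            = PosCell-irr c
Normal-irr (_ ∷ l@(_ ∷ _))     = Normal-irr l

Freq-irr : ∀ K y n j → Irr (Freq K y n j)
Freq-irr K y n j l = ×-irr (×-irr (Normal-irr l) (Bounded-irr K y l)) (×-irr ≡-irrelevant ≡-irrelevant)

Word↔Freq : ∀ K y n j → y ≤ K → Σ (List Letter) (Word K y n j) ↔ Σ (List Cell) (Freq K y n j)
Word↔Freq K y n j y≤K = injSurj-↔ (Word-irr K y n j) (Freq-irr K y n j) cells
  (λ w (v , m , s) → (cells-Normal w , cells-Bounded K y w y≤K v) ,
    trans (sym (cells-weight K y w v)) m , trans (sym (cells-overs w)) s)
  (λ v w (a , _) (b , _) → cells-injective K y v w a b)
  surj
  where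
  surj : ∀ l → Freq K y n j l → Σ[ w ∈ _ ] (Word K y n j w × cells w ≡ l)
  surj l ((nm , b) , m , s) with cells-surj K (cellWeight l) y l ≤-refl nm b
  ... | w , v , refl = w , (v , trans (cells-weight K y w v) m , trans (cells-overs w) s) , refl

-- Overpartitions with difference conditions as cell lists

PosHead : List Cell → Set
PosHead []      = ⊤
PosHead (c ∷ _) = PosCell c

topNon : ℕ → List Cell → ℕ
topNon y []            = y
topNon y ((f , _) ∷ _) = f

BoundedR : ℕ → ℕ → List Cell → Set
BoundedR K y []      = ⊤
BoundedR K y (c ∷ r) = topNon y r + parts c ≤ K × BoundedR K y r

-- In this part the largest size comes first, as in an overpartition, so the size of a cell is its
-- distance from the end of the list.
cellWeightR : List Cell → ℕ
cellWeightR []      = 0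
cellWeightR (c ∷ r) = suc (length r) * parts c + cellWeightR r

FreqR : (K y n j : ℕ) → List Cell → Set
FreqR K y n j r = (PosHead r × BoundedR K y r) × cellWeightR r ≡ n × overs r ≡ j

PosHead-irr : Irr PosHead
PosHead-irr []      _ _ = refl
PosHead-irr (c ∷ _)     = PosCell-irr c

BoundedR-irr : ∀ K y → Irr (BoundedR K y)
BoundedR-irr K y []      _ _ = refl
BoundedR-irr K y (c ∷ r)     = ×-irr ≤-irrelevant (BoundedR-irr K y r)

FreqR-irr : ∀ K y n j → Irr (FreqR K y n j)
FreqR-irr K y n j r = ×-irr (×-irr (PosHead-irr r) (BoundedR-irr K y r)) (×-irr ≡-irrelevant ≡-irrelevant)

lastNon : ℕ → List Cell → ℕ
lastNon y []            = y
lastNon y ((f , _) ∷ l) = lastNon f l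

lastNon-∷ʳ : ∀ y l c → lastNon y (l ++ c ∷ []) ≡ proj₁ c
lastNon-∷ʳ y []            c = refl
lastNon-∷ʳ y ((f , _) ∷ l) c = lastNon-∷ʳ f l c

lastNon-reverse : ∀ y r → lastNon y (reverse r) ≡ topNon y r
lastNon-reverse y []      = refl
lastNon-reverse y (c ∷ r) = trans (cong (lastNon y) (unfold-reverse c r)) (lastNon-∷ʳ y (reverse r) c)

Bounded-∷ʳ⁺ : ∀ K y l c → Bounded K y l → lastNon y l + parts c ≤ K → Bounded K y (l ++ c ∷ [])
Bounded-∷ʳ⁺ K y []            (f , o) b s        = s , ≤-trans (≤-trans (m≤m+n f (bit o)) (m≤n+m _ y)) s
Bounded-∷ʳ⁺ K y ((f , _) ∷ l) c       (b , b′) s = b , Bounded-∷ʳ⁺ K f l c b′ s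

Bounded-∷ʳ⁻ : ∀ K y l c → Bounded K y (l ++ c ∷ []) → Bounded K y l × lastNon y l + parts c ≤ K
Bounded-∷ʳ⁻ K y []            c (b , _)  = ≤-trans (m≤m+n y _) b , b
Bounded-∷ʳ⁻ K y ((f , _) ∷ l) c (b , b′) with Bounded-∷ʳ⁻ K f l c b′
... | b″ , s = (b , b″) , s

Bounded-reverse⁺ : ∀ K y r → y ≤ K → BoundedR K y r → Bounded K y (reverse r)
Bounded-reverse⁺ K y []      y≤K b       = y≤K
Bounded-reverse⁺ K y (c ∷ r) y≤K (s , b) = subst (Bounded K y) (sym (unfold-reverse c r))
  (Bounded-∷ʳ⁺ K y (reverse r) c (Bounded-reverse⁺ K y r y≤K b)
    (subst (λ x → x + parts c ≤ K) (sym (lastNon-reverse y r)) s))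

Bounded-reverse⁻ : ∀ K y r → Bounded K y (reverse r) → BoundedR K y r
Bounded-reverse⁻ K y []      b = tt
Bounded-reverse⁻ K y (c ∷ r) b with Bounded-∷ʳ⁻ K y (reverse r) c (subst (Bounded K y) (unfold-reverse c r) b)
... | b′ , s = subst (λ x → x + parts c ≤ K) (lastNon-reverse y r) s , Bounded-reverse⁻ K y r b′

Normal-∷ʳ : ∀ l c → Normal (l ++ c ∷ []) ≡ PosCell c
Normal-∷ʳ []          c = refl
Normal-∷ʳ (_ ∷ [])    c = refl
Normal-∷ʳ (_ ∷ d ∷ l) c = Normal-∷ʳ (d ∷ l) c

Normal-reverse : ∀ r → Normal (reverse r) ≡ PosHead r
Normal-reverse []      = refl
Normal-reverse (c ∷ r) = trans (cong Normal (unfold-reverse c r)) (Normal-∷ʳ (reverse r) c)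

total-∷ʳ : ∀ l c → total (l ++ c ∷ []) ≡ total l + parts c
total-∷ʳ []      c = +-identityʳ _
total-∷ʳ (d ∷ l) c = trans (cong (parts d +_) (total-∷ʳ l c)) (sym (+-assoc (parts d) _ _))

cellWeight-∷ʳ : ∀ l c → cellWeight (l ++ c ∷ []) ≡ suc (length l) * parts c + cellWeight l
cellWeight-∷ʳ []      c = cong (_+ 0) refl
cellWeight-∷ʳ (d ∷ l) c = trans (cong₂ _+_ (total-∷ʳ (d ∷ l) c) (cellWeight-∷ʳ l c))
  (eq (total (d ∷ l)) (parts c) (length l) (cellWeight l))
  where
  eq : ∀ t p n w → t + p + (suc n * p + w) ≡ suc (suc n) * p + (t + w)
  eq = solve-∀

cellWeight-reverse : ∀ r → cellWeight (reverse r) ≡ cellWeightR r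
cellWeight-reverse []      = refl
cellWeight-reverse (c ∷ r) = trans (cong cellWeight (unfold-reverse c r)) (trans (cellWeight-∷ʳ (reverse r) c)
  (cong₂ (λ n w → suc n * parts c + w) (length-reverse r) (cellWeight-reverse r)))

overs-∷ʳ : ∀ l c → overs (l ++ c ∷ []) ≡ bit (proj₂ c) + overs l
overs-∷ʳ []      c = refl
overs-∷ʳ (d ∷ l) c = trans (cong (bit (proj₂ d) +_) (overs-∷ʳ l c))
    (+-swapˡ (bit (proj₂ d)) (bit (proj₂ c)) (overs l))

overs-reverse : ∀ r → overs (reverse r) ≡ overs r
overs-reverse []      = refl
overs-reverse (c ∷ r) = trans (cong overs (unfold-reverse c r))
    (trans (overs-∷ʳ (reverse r) c) (cong (bit (proj₂ c) +_) (overs-reverse r)))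

FreqR↔Freq : ∀ K y n j → y ≤ K → Σ (List Cell) (FreqR K y n j) ↔ Σ (List Cell) (Freq K y n j)
FreqR↔Freq K y n j y≤K = subset-↔ (FreqR-irr K y n j) (Freq-irr K y n j) reverse reverse to
  (λ l f → from (reverse l) (subst (Freq K y n j) (sym (reverse-involutive l)) f))
  (λ r _ → reverse-involutive r) (λ r _ → reverse-involutive r)
  where
  to : ∀ r → FreqR K y n j r → Freq K y n j (reverse r)
  to r ((p , b) , w , o) = (subst (λ A → A) (sym (Normal-reverse r)) p , Bounded-reverse⁺ K y r y≤K b) ,
    trans (cellWeight-reverse r) w , trans (overs-reverse r) o
  from : ∀ r → Freq K y n j (reverse r) → FreqR K y n j r
  from r ((p , b) , w , o) = (subst (λ A → A) (Normal-reverse r) p , Bounded-reverse⁻ K y r b) ,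
    trans (sym (cellWeight-reverse r)) w , trans (sym (overs-reverse r)) o

-- Writing out a cell list as an overpartition

pushOver : Bool → ℕ → List Part → List Part
pushOver false v xs = xs
pushOver true  v xs = (v , true) ∷ xs

pushNon : ℕ → ℕ → List Part → List Part
pushNon zero    v xs = xs
pushNon (suc f) v xs = (v , false) ∷ pushNon f v xs

blocks : List Cell → List Part
blocks []            = []
blocks ((f , o) ∷ r) = pushNon f (suc (length r)) (pushOver o (suc (length r)) (blocks r))

headValue : List Part → ℕ
headValue []      = 0
headValue (x ∷ _) = value x

headValue-push : ∀ f o v xs → headValue xs ≤ v → headValue (pushNon f v (pushOver o v xs)) ≤ v
headValue-push zero    false v xs h = h
headValue-push zero    true  v xs h = ≤-refl
headValue-push (suc f) o     v xs h = ≤-refl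

headValue-blocks : ∀ r → headValue (blocks r) ≤ length r
headValue-blocks []            = z≤n
headValue-blocks ((f , o) ∷ r) = headValue-push f o _ (blocks r) (≤-trans (headValue-blocks r) (n≤1+n _))

headValue-PosHead : ∀ r → PosHead r → headValue (blocks r) ≡ length r
headValue-PosHead []                _ = refl
headValue-PosHead ((0 , true) ∷ r)  _ = refl
headValue-PosHead ((suc f , o) ∷ r) _ = refl

push-injective : ∀ f f′ o o′ v xs ys → headValue xs < v → headValue ys < v →
  pushNon f v (pushOver o v xs) ≡ pushNon f′ v (pushOver o′ v ys) → (f , o) ≡ (f′ , o′) × xs ≡ ys
push-injective zero zero false false v xs ys h h′ e = refl , e
push-injective zero zero true  true  v xs ys h h′ refl = refl , refl
push-injective zero zero false true  v xs ys h h′ refl = ⊥-elim (<-irrefl refl h)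
push-injective zero zero true  false v xs ys h h′ refl = ⊥-elim (<-irrefl refl h′)
push-injective zero (suc f′) false o′ v xs ys h h′ refl = ⊥-elim (<-irrefl refl h)
push-injective zero (suc f′) true  o′ v xs ys h h′ ()
push-injective (suc f) zero o false v xs ys h h′ refl = ⊥-elim (<-irrefl refl h′)
push-injective (suc f) zero o true  v xs ys h h′ ()
push-injective (suc f) (suc f′) o o′ v xs ys h h′ e with push-injective f f′ o o′ v xs ys h h′ (proj₂ (∷-inj e))
... | refl , e′ = refl , e′

blocks-injective-length : ∀ r r′ → length r ≡ length r′ → blocks r ≡ blocks r′ → r ≡ r′
blocks-injective-length [] [] _ _ = refl
blocks-injective-length ((f , o) ∷ r) ((f′ , o′) ∷ r′) le e with suc-injective le
... | le′ with push-injective f f′ o o′ (suc (length r)) (blocks r) (blocks r′) (s≤s (headValue-blocks r))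
               (s≤s (subst (headValue (blocks r′) ≤_) (sym le′) (headValue-blocks r′)))
               (subst (λ v → _ ≡ pushNon f′ (suc v) (pushOver o′ (suc v) (blocks r′))) (sym le′) e)
... | refl , e′ = cong (_ ∷_) (blocks-injective-length r r′ le′ e′)

blocks-injective : ∀ r r′ → PosHead r → PosHead r′ → blocks r ≡ blocks r′ → r ≡ r′
blocks-injective r r′ p p′ e = blocks-injective-length r r′
  (trans (sym (headValue-PosHead r p)) (trans (cong headValue e) (headValue-PosHead r′ p′))) e

OverHead : Part → List Part → Set
OverHead (a , o) xs = 1 ≤ a × headValue xs ≤ a × (a ≡ headValue xs → o ≡ false)

over-∷⁺ : ∀ x xs → OverHead x xs → T (isOverpartition xs) → T (isOverpartition (x ∷ xs))
over-∷⁺ (a , o) []              (p , _) _ = ≤⇒≤ᵇ p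
over-∷⁺ (a , o) ((b , o′) ∷ xs) (p , h , d) t = T-∧⁺ (≤⇒≤ᵇ p) (T-∧⁺ (≤⇒≤ᵇ h) (T-∧⁺ (go (a ≡ᵇ b) refl) t))
  where
  go : ∀ q → (a ≡ᵇ b) ≡ q → T (if q then not o else true)
  go true  e rewrite d (≡ᵇ⇒≡ a b (subst T (sym e) tt)) = tt
  go false e = tt

over-∷⁻ : ∀ x xs → T (isOverpartition (x ∷ xs)) → OverHead x xs × T (isOverpartition xs)
over-∷⁻ (a , o) [] t = (≤ᵇ⇒≤ 1 a t , z≤n , λ { refl → ⊥-elim t }) , tt
over-∷⁻ (a , o) ((b , o′) ∷ xs) t with T-∧⁻ {1 ≤ᵇ a} t
... | p , t₁ with T-∧⁻ {b ≤ᵇ a} t₁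
... | h , t₂ with T-∧⁻ {if a ≡ᵇ b then not o else true} t₂
... | d , t₃ = (≤ᵇ⇒≤ 1 a p , ≤ᵇ⇒≤ b a h , λ e →
    go o (subst (λ q → T (if q then not o else true)) (≡ᵇ-true e) d)) , t₃
  where
  ≡ᵇ-true : a ≡ b → (a ≡ᵇ b) ≡ true
  ≡ᵇ-true e = Equivalence.to T-≡ (≡⇒≡ᵇ a b e)
  go : ∀ o → T (not o) → o ≡ false
  go false _ = refl

push-over : ∀ f o v xs → headValue xs ≤ v → T (isOverpartition xs) →
  T (isOverpartition (pushNon f (suc v) (pushOver o (suc v) xs)))
push-over zero    false v xs h t = t
push-over zero    true  v xs h t =
    over-∷⁺ (suc v , true) xs (s≤s z≤n , ≤-trans h (n≤1+n v) , λ e → ⊥-elim (<-irrefl (sym e) (s≤s h))) t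
push-over (suc f) o     v xs h t = over-∷⁺ (suc v , false) (pushNon f (suc v) (pushOver o (suc v) xs))
  (s≤s z≤n , headValue-push f o (suc v) xs (≤-trans h (n≤1+n v)) , λ _ → refl) (push-over f o v xs h t)

blocks-over : ∀ r → T (isOverpartition (blocks r))
blocks-over []            = tt
blocks-over ((f , o) ∷ r) = push-over f o (length r) (blocks r) (headValue-blocks r) (blocks-over r)

pad : ℕ → List Cell → List Cell
pad zero    r = r
pad (suc m) r = (0 , false) ∷ pad m r

blocks-pad : ∀ m r → blocks (pad m r) ≡ blocks r
blocks-pad zero    r = refl
blocks-pad (suc m) r = blocks-pad m r

length-pad : ∀ m r → length (pad m r) ≡ m + length r
length-pad zero    r = refl
length-pad (suc m) r = cong suc (length-pad m r)

blocks-surj : ∀ xs → T (isOverpartition xs) → Σ[ r ∈ List Cell ] (PosHead r × blocks r ≡ xs)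
blocks-surj [] t = [] , tt , refl
blocks-surj ((a , o) ∷ xs) t with over-∷⁻ (a , o) xs t
... | (p , h , d) , t′ with blocks-surj xs t′
... | r , n , refl with m≤n⇒m<n∨m≡n h
...   | inj₂ e = same r n e (d (sym e))
  where
  same : ∀ r → PosHead r → headValue (blocks r) ≡ a → o ≡ false →
      Σ[ r′ ∈ List Cell ] (PosHead r′ × blocks r′ ≡ (a , o) ∷ blocks r)
  same [] n refl _ = ⊥-elim (<-irrefl refl p)
  same ((f , o′) ∷ r) n e refl = (suc f , o′) ∷ r , tt ,
    cong (λ v → (v , false) ∷ blocks ((f , o′) ∷ r)) (trans (sym (headValue-PosHead ((f , o′) ∷ r) n)) e)
...   | inj₁ lt = new o
  where
  -- The number of sizes strictly between the previous largest part and `a`, to be filled with empty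
  -- cells.
  m = a ∸ suc (length r)
  len : suc (length (pad m r)) ≡ a
  len = trans (cong suc (length-pad m r)) (trans (sym (+-suc m (length r)))
    (m∸n+n≡m (subst (λ x → suc x ≤ a) (headValue-PosHead r n) lt)))
  new : ∀ o → Σ[ r′ ∈ List Cell ] (PosHead r′ × blocks r′ ≡ (a , o) ∷ blocks r)
  new false = (1 , false) ∷ pad m r , tt , cong₂ (λ v xs → (v , false) ∷ xs) len (blocks-pad m r)
  new true  = (0 , true) ∷ pad m r , tt , cong₂ (λ v xs → (v , true) ∷ xs) len (blocks-pad m r)

weight-push : ∀ f o v xs → weight (pushNon f v (pushOver o v xs)) ≡ v * (f + bit o) + weight xs
weight-push zero    false v xs = cong (_+ weight xs) (sym (*-zeroʳ v))
weight-push zero    true  v xs = cong (_+ weight xs) (sym (*-identityʳ v))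
weight-push (suc f) o     v xs = trans (cong (v +_) (weight-push f o v xs)) (eq v (f + bit o) (weight xs))
  where
  eq : ∀ v x w → v + (v * x + w) ≡ v * suc x + w
  eq = solve-∀

blocks-weight : ∀ r → weight (blocks r) ≡ cellWeightR r
blocks-weight []            = refl
blocks-weight ((f , o) ∷ r) = trans (weight-push f o (suc (length r)) (blocks r))
  (cong (suc (length r) * (f + bit o) +_) (blocks-weight r))

numOverlined-push : ∀ f o v xs → numOverlined (pushNon f v (pushOver o v xs)) ≡ bit o + numOverlined xs
numOverlined-push zero    false v xs = refl
numOverlined-push zero    true  v xs = refl
numOverlined-push (suc f) o     v xs = numOverlined-push f o v xs

blocks-overs : ∀ r → numOverlined (blocks r) ≡ overs r
blocks-overs []            = refl
blocks-overs ((f , o) ∷ r) = trans (numOverlined-push f o _ (blocks r)) (cong (bit o +_) (blocks-overs r))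

ones : List Part → ℕ
ones = countB (λ p → value p ≡ᵇ 1)

ones-push₁ : ∀ f o → ones (pushNon f 1 (pushOver o 1 [])) ≡ f + bit o
ones-push₁ zero    false = refl
ones-push₁ zero    true  = refl
ones-push₁ (suc f) o     = cong suc (ones-push₁ f o)

ones-push₂ : ∀ f o v xs → ones (pushNon f (suc (suc v)) (pushOver o (suc (suc v)) xs)) ≡ ones xs
ones-push₂ zero    false v xs = refl
ones-push₂ zero    true  v xs = refl
ones-push₂ (suc f) o     v xs = ones-push₂ f o v xs

check : ℕ → List Part → Bool
check v []            = true
check v ((b , o) ∷ _) = if o then (b + 1 ≤ᵇ v) else (b + 2 ≤ᵇ v)

differenceCond-∷ : ∀ K x xs → differenceCond (suc K) (x ∷ xs) ≡ check (value x)
    (drop K (x ∷ xs)) ∧ differenceCond (suc K) xs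
differenceCond-∷ K x xs with drop K (x ∷ xs)
... | []              = refl
... | (b , true) ∷ _  = refl
... | (b , false) ∷ _ = refl

-- Exactly the first `g` entries of `xs` are too close to a part of size `v`. Taken at the distance
-- `K`, this turns the difference condition into the bound `g` ≤ `K`.
Cost : ℕ → List Part → ℕ → Set
Cost v xs g = ∀ m → T (check v (drop m xs)) ⇔ (g ≤ m)

Cost-∷ : ∀ v o xs g → Cost v xs g → Cost v ((v , o) ∷ xs) (suc g)
Cost-∷ v o xs g c zero = mk⇔ (λ t → ⊥-elim (bad o t)) λ ()
  where
  bad : ∀ o → ¬ T (check v ((v , o) ∷ xs))
  bad true  t = <-irrefl refl (≤-by (+-comm v 1) (≤ᵇ⇒≤ (v + 1) v t))
  bad false t = <-irrefl refl (≤-trans (n≤1+n _) (≤-by (+-comm v 2) (≤ᵇ⇒≤ (v + 2) v t)))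
Cost-∷ v o xs g c (suc m) = mk⇔ (λ t → s≤s (Equivalence.to (c m) t)) (λ { (s≤s l) → Equivalence.from (c m) l })

Cost-push : ∀ f o v xs g → Cost v xs g → Cost v (pushNon f v (pushOver o v xs)) (f + bit o + g)
Cost-push zero    false v xs g c = c
Cost-push zero    true  v xs g c = Cost-∷ v true xs g c
Cost-push (suc f) o     v xs g c = Cost-∷ v false _ _ (Cost-push f o v xs g c)

blocks-≤ : ∀ r → All (λ p → value p ≤ length r) (blocks r)
blocks-≤ []            = []
blocks-≤ ((f , o) ∷ r) = addNon f (addOver o (All.map (λ h → ≤-trans h (n≤1+n _)) (blocks-≤ r)))
  where
  Q : Part → Set
  Q p = value p ≤ suc (length r)
  addOver : ∀ o {xs} → All Q xs → All Q (pushOver o (suc (length r)) xs)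
  addOver false a = a
  addOver true  a = ≤-refl ∷ a
  addNon : ∀ f {xs} → All Q xs → All Q (pushNon f (suc (length r)) xs)
  addNon zero    a = a
  addNon (suc f) a = ≤-refl ∷ addNon f a

check-safe : ∀ v xs → All (λ p → T (check v (p ∷ []))) xs → ∀ m → T (check v (drop m xs))
check-safe v []             a       zero    = tt
check-safe v ((b , true) ∷ _)  (t ∷ a) zero    = t
check-safe v ((b , false) ∷ _) (t ∷ a) zero    = t
check-safe v []             a       (suc m) = tt
check-safe v (_ ∷ xs)       (t ∷ a) (suc m) = check-safe v xs a m

-- Seen from the next larger size, a non-overlined part of the top size misses the required
-- difference 2, an overlined one just attains its difference 1, and smaller parts are far enough
-- away.
Cost-blocks : ∀ r → Cost (suc (length r)) (blocks r) (topNon 0 r)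
Cost-blocks [] m = mk⇔ (λ _ → z≤n) (λ _ → check-safe 1 [] [] m)
Cost-blocks ((f , o) ∷ r) = go f
  where
  v = suc (length r)
  small : ∀ p → value p ≤ length r → T (check (suc v) (p ∷ []))
  small (b , true)  h = ≤⇒≤ᵇ (≤-by (+-comm 1 b) (≤-trans (s≤s h) (n≤1+n v)))
  small (b , false) h = ≤⇒≤ᵇ (≤-by (+-comm 2 b) (s≤s (s≤s h)))
  safe : ∀ o → All (λ p → T (check (suc v) (p ∷ []))) (pushOver o v (blocks r))
  safe false = All.map (λ {p} → small p) (blocks-≤ r)
  safe true  = ≤⇒≤ᵇ (≤-reflexive (+-comm v 1)) ∷ All.map (λ {p} → small p) (blocks-≤ r)
  go : ∀ f → Cost (suc v) (pushNon f v (pushOver o v (blocks r))) f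
  go zero    m       = mk⇔ (λ _ → z≤n) (λ _ → check-safe (suc v) _ (safe o) m)
  go (suc f) zero    = mk⇔ (λ t → ⊥-elim (<-irrefl refl (≤-by (+-comm v 2) (≤ᵇ⇒≤ (v + 2) (suc v) t)))) λ ()
  go (suc f) (suc m) = mk⇔ (λ t → s≤s (Equivalence.to (go f m) t)) (λ { (s≤s l) → Equivalence.from (go f m) l })

diff-∷⁺ : ∀ K v o xs g → Cost v ((v , o) ∷ xs) g → g ≤ K → T (differenceCond (suc K) xs) →
    T (differenceCond (suc K) ((v , o) ∷ xs))
diff-∷⁺ K v o xs g c le t rewrite differenceCond-∷ K (v , o) xs = T-∧⁺ (Equivalence.from (c K) le) t

diff-∷⁻ : ∀ K v o xs g → Cost v ((v , o) ∷ xs) g → T (differenceCond (suc K) ((v , o) ∷ xs)) → g ≤ K ×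
    T (differenceCond (suc K) xs)
diff-∷⁻ K v o xs g c t rewrite differenceCond-∷ K (v , o) xs with T-∧⁻ {check v (drop K ((v , o) ∷ xs))} t
... | a , b = Equivalence.to (c K) a , b

diff-push⁺ : ∀ K f o v xs g → Cost v xs g → f + bit o + g ≤ K → T (differenceCond (suc K) xs) →
  T (differenceCond (suc K) (pushNon f v (pushOver o v xs)))
diff-push⁺ K zero    false v xs g c le t = t
diff-push⁺ K zero    true  v xs g c le t = diff-∷⁺ K v true xs (suc g) (Cost-∷ v true xs g c) le t
diff-push⁺ K (suc f) o     v xs g c le t = diff-∷⁺ K v false _ _ (Cost-push (suc f) o v xs g c) le
  (diff-push⁺ K f o v xs g c (≤-trans (n≤1+n _) le) t)

-- The bound comes from the first part of the block. An empty block imposes nothing of its own,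
-- which is why the conclusion is an implication from the bound on `g`.
diff-push⁻ : ∀ K f o v xs g → Cost v xs g → T (differenceCond (suc K) (pushNon f v (pushOver o v xs))) →
  T (differenceCond (suc K) xs) × (g ≤ K → f + bit o + g ≤ K)
diff-push⁻ K zero    false v xs g c t = t , λ l → l
diff-push⁻ K zero    true  v xs g c t with diff-∷⁻ K v true xs (suc g) (Cost-∷ v true xs g c) t
... | le , t′ = t′ , λ _ → le
diff-push⁻ K (suc f) o     v xs g c t with diff-∷⁻ K v false _ _ (Cost-push (suc f) o v xs g c) t
... | le , t′ = proj₁ (diff-push⁻ K f o v xs g c t′) , λ _ → le

module _ (K i : ℕ) (i≤K : i ≤ K) where

  private
    y : ℕ
    y = K ∸ i

  ones⇒ : ∀ F → F ≤ i → y + F ≤ K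
  ones⇒ F h = ≤-trans (+-monoʳ-≤ y h) (≤-reflexive (m∸n+n≡m i≤K))

  ones⇐ : ∀ F → y + F ≤ K → F ≤ i
  ones⇐ F h = +-cancelˡ-≤ y F i (≤-trans h (≤-reflexive (sym (m∸n+n≡m i≤K))))

  blocks-cond⁺ : ∀ r → BoundedR K y r → ones (blocks r) ≤ i × T (differenceCond (suc K) (blocks r))
  blocks-cond⁺ [] b = z≤n , tt
  blocks-cond⁺ ((f , o) ∷ []) (s , _) = ≤-by (sym (ones-push₁ f o)) (ones⇐ _ s) ,
    diff-push⁺ K f o 1 [] 0 (Cost-blocks []) (≤-by (sym +0) (≤-trans (m≤n+m _ y) s)) tt
  blocks-cond⁺ ((f , o) ∷ r@((f′ , o′) ∷ r′)) (s , b) with blocks-cond⁺ r b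
  ... | l , t = ≤-by (sym (ones-push₂ f o (length r′) (blocks r))) l ,
    diff-push⁺ K f o _ (blocks r) f′ (Cost-blocks r) (≤-by (+-comm f′ _) s) t

  blocks-cond⁻ : ∀ r → ones (blocks r) ≤ i → T (differenceCond (suc K) (blocks r)) → BoundedR K y r
  blocks-cond⁻ [] l t = tt
  blocks-cond⁻ ((f , o) ∷ []) l t = ones⇒ _ (≤-by (ones-push₁ f o) l) , tt
  blocks-cond⁻ ((f , o) ∷ r@((f′ , o′) ∷ r′)) l t =
    let (t′ , s) = diff-push⁻ K f o (suc (length r)) (blocks r) f′ (Cost-blocks r) t
        b        = blocks-cond⁻ r (≤-by (ones-push₂ f o (length r′) (blocks r)) l) t′
    in ≤-by (+-comm _ f′) (s (≤-trans (≤-trans (m≤m+n f′ (bit o′)) (m≤n+m _ (topNon y r′))) (proj₁ b))) , b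

  FreqR↔B̄ : ∀ n j → Σ (List Cell) (FreqR K y n j) ↔ B̄ (suc K) (suc i) n j
  FreqR↔B̄ n j = injSurj-↔ (FreqR-irr K y n j) (λ _ → T-irrelevant) blocks to
    (λ r r′ ((p , _) , _) ((p′ , _) , _) → blocks-injective r r′ p p′) from
    where
    to : ∀ r → FreqR K y n j r → T (isB (suc K) (suc i) n j (blocks r))
    to r ((p , b) , w , o) with blocks-cond⁺ r b
    ... | l , t = T-∧⁺ (blocks-over r) (T-∧⁺ (≡⇒≡ᵇ _ n (trans (blocks-weight r) w))
      (T-∧⁺ (≡⇒≡ᵇ _ j (trans (blocks-overs r) o)) (T-∧⁺ (≤⇒≤ᵇ l) t)))
    from : ∀ xs → T (isB (suc K) (suc i) n j xs) → Σ[ r ∈ _ ] (FreqR K y n j r × blocks r ≡ xs)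
    from xs t with T-∧⁻ {isOverpartition xs} t
    ... | ov , t₁ with T-∧⁻ {weight xs ≡ᵇ n} t₁
    ... | wt , t₂ with T-∧⁻ {numOverlined xs ≡ᵇ j} t₂
    ... | nu , t₃ with T-∧⁻ {ones xs ≤ᵇ i} t₃
    ... | on , di with blocks-surj xs ov
    ... | r , p , refl = r , ((p , blocks-cond⁻ r (≤ᵇ⇒≤ _ i on) di) ,
      trans (sym (blocks-weight r)) (≡ᵇ⇒≡ _ n wt) , trans (sym (blocks-overs r)) (≡ᵇ⇒≡ _ j nu)) , refl

-- Words and Frobenius symbols

-- How far a column exceeds the least entries that its inner neighbour allows, and whether its bottom entry is overlined.
Gap : Set
Gap = ℕ × ℕ × Bool

flip : Gap → Gap
flip (p , q , o) = q , p , o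

bumpP bumpQ cross : List Gap → List Gap
bumpP []                = []
bumpP ((p , q , o) ∷ g) = (suc p , q , o) ∷ g
bumpQ []                = []
bumpQ ((p , q , o) ∷ g) = (p , suc q , o) ∷ g
cross []                = []
cross ((p , q , o) ∷ g) = (suc q , p , o) ∷ map flip g

-- The leftmost peak comes first and belongs to the innermost column. Before a peak the path
-- descends, may run along the axis, and climbs; `p` and `q` count the down- and up-steps of its
-- unfolding, seen from the current side. An `H` is a down-step across the axis after which the
-- picture is reflected, hence `cross`.
gaps : List Letter → List Gap
gaps []          = []
gaps (D ∷ w)     = bumpP (gaps w)
gaps (H ∷ w)     = cross (gaps w)
gaps (P ∷ w)     = (0 , 0 , false) ∷ gaps w
gaps (U ∷ D ∷ w) = (0 , 0 , true) ∷ gaps w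
gaps (U ∷ w)     = bumpQ (gaps w)

-- A and B are the distances from the current height, reflected to be signed, to the two ends of the strip.
Within : ℕ → ℕ → List Gap → Set
Within A B []                = ⊤
Within A B ((p , q , o) ∷ g) = p ≤ A + q × suc q ≤ B + p × Within (A + q ∸ p) (suc (B + p ∸ suc q)) g

Within-irr : ∀ A B → Irr (Within A B)
Within-irr A B []                _ _ = refl
Within-irr A B ((p , q , o) ∷ g)     = ×-irr ≤-irrelevant (×-irr ≤-irrelevant (Within-irr _ _ g))

-- With `A` = K + h and `suc B` = K - h, the reflection sends the height h to -1 - h and not to -h:
-- the axis and its mirror image are the adjacent levels 0 and -1, joined by an `H`. This accounts
-- for the shift by one between the two ends.
flip-within : ∀ A B g → Within A (suc B) g → Within B (suc A) (map flip g)
flip-within A B []                v             = tt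
flip-within A B ((p , q , o) ∷ g) (a , b , v) = s≤s⁻¹ b , s≤s a , flip-within _ _ g v

flip-involutive : ∀ g → map flip (map flip g) ≡ g
flip-involutive []      = refl
flip-involutive (x ∷ g) = cong (x ∷_) (flip-involutive g)

bumpP-within : ∀ A B g → Within A (suc B) g → Within (suc A) B (bumpP g)
bumpP-within A B []                v           = tt
bumpP-within A B ((p , q , o) ∷ g) (a , b , v) rewrite +-suc B p = s≤s a , b , v

bumpP-within⁻ : ∀ A B p q o g → Within (suc A) B ((suc p , q , o) ∷ g) → Within A (suc B) ((p , q , o) ∷ g)
bumpP-within⁻ A B p q o g (a , b , v) rewrite +-suc B p = s≤s⁻¹ a , b , v

bumpQ-within : ∀ A B g → Within (suc A) B g → Within A (suc B) (bumpQ g)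
bumpQ-within A B []                v           = tt
bumpQ-within A B ((p , q , o) ∷ g) (a , b , v) rewrite +-suc A q = a , s≤s b , v

bumpQ-within⁻ : ∀ A B p q o g → Within A (suc B) ((p , suc q , o) ∷ g) → Within (suc A) B ((p , q , o) ∷ g)
bumpQ-within⁻ A B p q o g (a , b , v) rewrite +-suc A q = a , s≤s⁻¹ b , v

peak-within : ∀ A B o g → Within A (suc B) g → Within A (suc B) ((0 , 0 , o) ∷ g)
peak-within A B o g v rewrite +-identityʳ A | +-identityʳ B = z≤n , s≤s z≤n , v

peak-within⁻ : ∀ A B o g → Within A B ((0 , 0 , o) ∷ g) → 1 ≤ B × Within A B g
peak-within⁻ A (suc B) o g (a , b , v) rewrite +-identityʳ A | +-identityʳ B = s≤s z≤n , v
peak-within⁻ A zero    o g (a , () , v)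

cross-within : ∀ K g → Within K K g → Within K K (cross g)
cross-within K []                v           = tt
cross-within K ((p , q , o) ∷ g) (a , b , v) rewrite +-suc K q = b , s≤s a , flip-within _ _ g v

cross-within⁻ : ∀ K p q o g → Within K K ((suc p , q , o) ∷ g) → Within K K ((q , p , o) ∷ map flip g)
cross-within⁻ K p q o g (a , b , v) rewrite +-suc K p = s≤s⁻¹ b , a , flip-within _ _ g v

-- After a `U` that is not at a peak, the path climbs until the next peak, so that gap has no
-- down-steps. Counting up-steps separately from down-steps therefore loses no order.
gaps-U : ∀ K y w → Valid K (suc y) w → peakAfterU w ≡ 0 →
  Σ[ q ∈ ℕ ] Σ[ o ∈ Bool ] Σ[ g ∈ List Gap ] gaps w ≡ (0 , q , o) ∷ g
gaps-U K y (P ∷ w) v e = 0 , false , gaps w , refl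
gaps-U K y (U ∷ D ∷ w) v e = 0 , true , gaps w , refl
gaps-U K y (U ∷ U ∷ w) (_ , v) e with gaps (U ∷ w) | gaps-U K (suc y) (U ∷ w) v refl
... | .((0 , q , o) ∷ g) | q , o , g , refl = suc q , o , g , refl
gaps-U K y (U ∷ P ∷ w) (_ , v) e = 1 , false , gaps w , refl

gaps-within : ∀ K y b w → y + b ≡ K → Valid K y w → Within (K + y) b (gaps w)
gaps-within K y b [] e v = tt
gaps-within K (suc y) b (D ∷ w) e v rewrite +-suc K y =
  bumpP-within (K + y) b (gaps w) (gaps-within K y (suc b) w (trans (+-suc y b) e) v)
gaps-within K zero .K (H ∷ w) refl (_ , v) with gaps-within K zero K w refl v
... | r rewrite +-identityʳ K = cross-within K (gaps w) r
gaps-within K y zero (P ∷ w) e (s , v) = ⊥-elim (<-irrefl (trans (sym (+-identityʳ y)) e) s)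
gaps-within K y (suc b) (P ∷ w) e (s , v) = peak-within (K + y) b false (gaps w) (gaps-within K y (suc b) w e v)
gaps-within K y zero (U ∷ w) e (s , v) = ⊥-elim (<-irrefl (trans (sym (+-identityʳ y)) e) s)
gaps-within K y (suc b) (U ∷ D ∷ w) e (s , v) =
    peak-within (K + y) b true (gaps w) (gaps-within K y (suc b) w e v)
gaps-within K y (suc b) (U ∷ w@(U ∷ _)) e (s , v) = bumpQ-within (K + y) b (gaps w)
  (subst (λ A → Within A b (gaps w)) (+-suc K y) (gaps-within K (suc y) b w (trans (sym (+-suc y b)) e) v))
gaps-within K y (suc b) (U ∷ w@(P ∷ _)) e (s , v) = bumpQ-within (K + y) b (gaps w)
  (subst (λ A → Within A b (gaps w)) (+-suc K y) (gaps-within K (suc y) b w (trans (sym (+-suc y b)) e) v))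

-- A gap enlarges its own column and all columns further out; an overline enlarges only those
-- further out.
gapWeight : List Gap → ℕ
gapWeight []                = 0
gapWeight ((p , q , o) ∷ g) = suc (p + q) * suc (length g) + bit o * length g + gapWeight g

nonOver : List Gap → ℕ
nonOver []                = 0
nonOver ((_ , _ , o) ∷ g) = bit (not o) + nonOver g

flip-weight : ∀ g → gapWeight (map flip g) ≡ gapWeight g
flip-weight [] = refl
flip-weight ((p , q , o) ∷ g) rewrite length-map flip g | +-comm q p | flip-weight g = refl

flip-nonOver : ∀ g → nonOver (map flip g) ≡ nonOver g
flip-nonOver []                = refl
flip-nonOver ((p , q , o) ∷ g) = cong (bit (not o) +_) (flip-nonOver g)

bumpP-length : ∀ g → length (bumpP g) ≡ length g
bumpP-length []      = refl
bumpP-length (_ ∷ _) = refl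

bumpQ-length : ∀ g → length (bumpQ g) ≡ length g
bumpQ-length []      = refl
bumpQ-length (_ ∷ _) = refl

cross-length : ∀ g → length (cross g) ≡ length g
cross-length []      = refl
cross-length (_ ∷ g) = cong suc (length-map flip g)

bump-arith : ∀ s n b w → (suc s + 1) * suc n + b * n + w ≡ suc n + (suc s * suc n + b * n + w)
bump-arith = solve-∀

bumpP-weight : ∀ g → gapWeight (bumpP g) ≡ length g + gapWeight g
bumpP-weight []                = refl
bumpP-weight ((p , q , o) ∷ g) =
  trans (cong (λ x → suc x * suc (length g) + bit o * length g + gapWeight g) (+-comm 1 (p + q)))
      (bump-arith (p + q) (length g) (bit o) (gapWeight g))

bumpQ-weight : ∀ g → gapWeight (bumpQ g) ≡ length g + gapWeight g
bumpQ-weight []                = refl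
bumpQ-weight ((p , q , o) ∷ g) =
  trans (cong (λ x → suc x * suc (length g) + bit o * length g + gapWeight g)
      (trans (+-suc p q) (+-comm 1 (p + q)))) (bump-arith (p + q) (length g) (bit o) (gapWeight g))

cross-weight : ∀ g → gapWeight (cross g) ≡ length g + gapWeight g
cross-weight []                = refl
cross-weight ((p , q , o) ∷ g) rewrite length-map flip g | flip-weight g | +-comm q p =
  trans (cong (λ x → suc x * suc (length g) + bit o * length g + gapWeight g) (+-comm 1 (p + q)))
      (bump-arith (p + q) (length g) (bit o) (gapWeight g))

bumpP-nonOver : ∀ g → nonOver (bumpP g) ≡ nonOver g
bumpP-nonOver []      = refl
bumpP-nonOver (_ ∷ _) = refl

bumpQ-nonOver : ∀ g → nonOver (bumpQ g) ≡ nonOver g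
bumpQ-nonOver []      = refl
bumpQ-nonOver (_ ∷ _) = refl

cross-nonOver : ∀ g → nonOver (cross g) ≡ nonOver g
cross-nonOver []      = refl
cross-nonOver ((_ , _ , o) ∷ g) = cong (bit (not o) +_) (flip-nonOver g)

gaps-length : ∀ w → length (gaps w) ≡ peaks w
gaps-length []              = refl
gaps-length (D ∷ w)         = trans (bumpP-length (gaps w)) (gaps-length w)
gaps-length (H ∷ w)         = trans (cross-length (gaps w)) (gaps-length w)
gaps-length (P ∷ w)         = cong suc (gaps-length w)
gaps-length (U ∷ [])        = refl
gaps-length (U ∷ D ∷ w)     = cong suc (gaps-length w)
gaps-length (U ∷ w@(U ∷ _)) = trans (bumpQ-length (gaps w)) (gaps-length w)
gaps-length (U ∷ w@(H ∷ _)) = trans (bumpQ-length (gaps w)) (gaps-length w)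
gaps-length (U ∷ w@(P ∷ _)) = trans (bumpQ-length (gaps w)) (gaps-length w)

gaps-weight : ∀ w → gapWeight (gaps w) ≡ maj w
gaps-weight []              = refl
gaps-weight (D ∷ w)         = trans (bumpP-weight (gaps w)) (cong₂ _+_ (gaps-length w) (gaps-weight w))
gaps-weight (H ∷ w)         = trans (cross-weight (gaps w)) (cong₂ _+_ (gaps-length w) (gaps-weight w))
gaps-weight (P ∷ w) = trans (cong₂ (λ n m → 1 * suc n + 0 * n + m) (gaps-length w) (gaps-weight w))
    (eq (peaks w) (maj w))
  where
  eq : ∀ n m → 1 * suc n + 0 * n + m ≡ suc n + m
  eq = solve-∀
gaps-weight (U ∷ [])        = refl
gaps-weight (U ∷ D ∷ w) = trans (cong₂ (λ n m → 1 * suc n + 1 * n + m) (gaps-length w) (gaps-weight w))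
    (eq (peaks w) (maj w))
  where
  eq : ∀ n m → 1 * suc n + 1 * n + m ≡ suc n + (n + m)
  eq = solve-∀
gaps-weight (U ∷ w@(U ∷ _)) = trans (bumpQ-weight (gaps w)) (cong₂ _+_ (gaps-length w) (gaps-weight w))
gaps-weight (U ∷ w@(H ∷ _)) = trans (bumpQ-weight (gaps w)) (cong₂ _+_ (gaps-length w) (gaps-weight w))
gaps-weight (U ∷ w@(P ∷ _)) = trans (bumpQ-weight (gaps w)) (cong₂ _+_ (gaps-length w) (gaps-weight w))

gaps-nonOver : ∀ w → nonOver (gaps w) ≡ numP w
gaps-nonOver []              = refl
gaps-nonOver (D ∷ w)         = trans (bumpP-nonOver (gaps w)) (gaps-nonOver w)
gaps-nonOver (H ∷ w)         = trans (cross-nonOver (gaps w)) (gaps-nonOver w)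
gaps-nonOver (P ∷ w)         = cong suc (gaps-nonOver w)
gaps-nonOver (U ∷ [])        = refl
gaps-nonOver (U ∷ D ∷ w)     = gaps-nonOver w
gaps-nonOver (U ∷ w@(U ∷ _)) = trans (bumpQ-nonOver (gaps w)) (gaps-nonOver w)
gaps-nonOver (U ∷ w@(H ∷ _)) = trans (bumpQ-nonOver (gaps w)) (gaps-nonOver w)
gaps-nonOver (U ∷ w@(P ∷ _)) = trans (bumpQ-nonOver (gaps w)) (gaps-nonOver w)

-- The first gap dictates the next letter: down while its first number is positive, crossing the
-- axis by an `H` that exchanges the two numbers, then up, then the peak. Fuel is needed because `H`
-- rebuilds the gaps by a flip; the value when it runs out is a default.
path : ℕ → ℕ → List Gap → List Letter
path fuel       y       []                      = replicate y D
path zero       y       (_ ∷ _)                 = []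
path (suc fuel) (suc y) ((suc p , q , o) ∷ g)   = D ∷ path fuel y ((p , q , o) ∷ g)
path (suc fuel) zero    ((suc p , q , o) ∷ g)   = H ∷ path fuel zero ((q , p , o) ∷ map flip g)
path (suc fuel) y       ((0 , suc q , o) ∷ g)   = U ∷ path fuel (suc y) ((0 , q , o) ∷ g)
path (suc fuel) y       ((0 , 0 , true) ∷ g)    = U ∷ D ∷ path fuel y g
path (suc fuel) y       ((0 , 0 , false) ∷ g)   = P ∷ path fuel y g

path-U : ∀ fuel y w g → Σ[ q ∈ ℕ ] Σ[ o ∈ Bool ] Σ[ g′ ∈ List Gap ] g ≡ (0 , q , o) ∷ g′ →
  path fuel (suc y) g ≡ w → path (suc fuel) y (bumpQ g) ≡ U ∷ w
path-U fuel zero    w _ (q , o , g , refl) e = cong (U ∷_) e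
path-U fuel (suc y) w _ (q , o , g , refl) e = cong (U ∷_) e

path-gaps : ∀ K fuel y w → length w ≤ fuel → Valid K y w → path fuel y (gaps w) ≡ w
path-gaps K fuel .0 [] le refl = refl
path-gaps K (suc fuel) (suc y) (D ∷ w) (s≤s le) v with gaps w | path-gaps K fuel y w le v
... | []    | e = cong (D ∷_) e
... | _ ∷ _ | e = cong (D ∷_) e
path-gaps K (suc fuel) zero (H ∷ w@(_ ∷ _)) (s≤s le) (_ , v) with gaps w | path-gaps K fuel zero w le v
... | []              | ()
... | (p , q , o) ∷ g | e = cong (H ∷_)
    (trans (cong (λ g → path fuel zero ((p , q , o) ∷ g)) (flip-involutive g)) e)
path-gaps K (suc fuel) zero (P ∷ w) (s≤s le) (_ , v) = cong (P ∷_) (path-gaps K fuel zero w le v)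
path-gaps K (suc fuel) (suc y) (P ∷ w) (s≤s le) (_ , v) = cong (P ∷_) (path-gaps K fuel (suc y) w le v)
path-gaps K (suc fuel) zero (U ∷ D ∷ w) (s≤s le) (_ , v) =
    cong (λ w → U ∷ D ∷ w) (path-gaps K fuel zero w (≤-trans (n≤1+n _) le) v)
path-gaps K (suc fuel) (suc y) (U ∷ D ∷ w) (s≤s le) (_ , v) =
    cong (λ w → U ∷ D ∷ w) (path-gaps K fuel (suc y) w (≤-trans (n≤1+n _) le) v)
path-gaps K (suc fuel) y (U ∷ w@(U ∷ _)) (s≤s le) (_ , v) =
    path-U fuel y w (gaps w) (gaps-U K y w v refl) (path-gaps K fuel (suc y) w le v)
path-gaps K (suc fuel) y (U ∷ w@(P ∷ _)) (s≤s le) (_ , v) =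
    path-U fuel y w (gaps w) (gaps-U K y w v refl) (path-gaps K fuel (suc y) w le v)

gaps-injective : ∀ K y v w → Valid K y v → Valid K y w → gaps v ≡ gaps w → v ≡ w
gaps-injective K y v w a b e = trans (sym (path-gaps K fuel y v (m≤m+n _ _) a))
  (trans (cong (path fuel y) e) (path-gaps K fuel y w (m≤n+m _ _) b))
  where fuel = length v + length w

gaps-replicate-D : ∀ y → gaps (replicate y D) ≡ []
gaps-replicate-D zero = refl
gaps-replicate-D (suc y) rewrite gaps-replicate-D y = refl

gapSize : List Gap → ℕ
gapSize []                = 0
gapSize ((p , q , o) ∷ g) = suc (p + q) + gapSize g

flip-size : ∀ g → gapSize (map flip g) ≡ gapSize g
flip-size []                = refl
flip-size ((p , q , o) ∷ g) = cong₂ (λ a b → suc a + b) (+-comm q p) (flip-size g)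

gaps-U-bump : ∀ w q o g → gaps w ≡ (0 , q , o) ∷ g → gaps (U ∷ w) ≡ (0 , suc q , o) ∷ g
gaps-U-bump (U ∷ w) q o g e = cong bumpQ e
gaps-U-bump (H ∷ w) q o g e = cong bumpQ e
gaps-U-bump (P ∷ w) q o g e = cong bumpQ e
gaps-U-bump (D ∷ w) q o g e with gaps w
gaps-U-bump (D ∷ w) q o g () | []
gaps-U-bump (D ∷ w) q o g () | _ ∷ _

1≤b⇒y<K : ∀ {K} y b → y + b ≡ K → 1 ≤ b → suc y ≤ K
1≤b⇒y<K y b e l = ≤-trans (≤-by (+-comm y 1) (+-monoʳ-≤ y l)) (≤-reflexive e)

gaps-surj : ∀ K fuel y b g → y + b ≡ K → gapSize g ≤ fuel → Within (K + y) b g →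
  Σ[ w ∈ List Letter ] (Valid K y w × gaps w ≡ g)
gaps-surj K fuel y b [] e le v = replicate y D , Valid-replicate-D K y , gaps-replicate-D y
gaps-surj K (suc fuel) (suc y) b ((suc p , q , o) ∷ g) e (s≤s le) v
  with gaps-surj K fuel y (suc b) ((p , q , o) ∷ g) (trans (+-suc y b) e) le
         (bumpP-within⁻ (K + y) b p q o g (subst (λ A → Within A b ((suc p , q , o) ∷ g)) (+-suc K y) v))
... | w , va , e′ = D ∷ w , va , cong bumpP e′
gaps-surj K (suc fuel) zero .K ((suc p , q , o) ∷ g) refl (s≤s le) v
  with gaps-surj K fuel zero K ((q , p , o) ∷ map flip g) refl
         (≤-trans (≤-reflexive (cong₂ (λ a b → suc a + b) (+-comm q p) (flip-size g))) le)
         (subst (λ A → Within A K ((q , p , o) ∷ map flip g)) (sym (+-identityʳ K))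
           (cross-within⁻ K p q o g (subst (λ A → Within A K ((suc p , q , o) ∷ g)) (+-identityʳ K) v)))
... | [] , va , ()
... | w@(_ ∷ _) , va , e′ = H ∷ w , (tt , va) , trans (cong cross e′) (cong (_ ∷_) (flip-involutive g))
gaps-surj K (suc fuel) y b@(suc b′) ((0 , suc q , o) ∷ g) e (s≤s le) v
  with gaps-surj K fuel (suc y) b′ ((0 , q , o) ∷ g) (trans (sym (+-suc y b′)) e) le
         (subst (λ A → Within A b′ ((0 , q , o) ∷ g)) (sym (+-suc K y)) (bumpQ-within⁻ (K + y) b′ 0 q o g v))
... | w , va , e′ = U ∷ w , (1≤b⇒y<K y b e (s≤s z≤n) , va) , gaps-U-bump w q o g e′
gaps-surj K (suc fuel) y zero ((0 , suc q , o) ∷ g) e (s≤s le) (_ , () , _)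
gaps-surj K (suc fuel) y b ((0 , 0 , o) ∷ g) e (s≤s le) v with peak-within⁻ (K + y) b o g v
... | l , v′ with gaps-surj K fuel y b g e le v′
... | w , va , e′ = peak o
  where
  peak : ∀ o → Σ[ w ∈ List Letter ] (Valid K y w × gaps w ≡ (0 , 0 , o) ∷ g)
  peak true  = U ∷ D ∷ w , (1≤b⇒y<K y b e l , va) , cong (_ ∷_) e′
  peak false = P ∷ w , (1≤b⇒y<K y b e l , va) , cong (_ ∷_) e′

GapList : (K y n j : ℕ) → List Gap → Set
GapList K y n j g = Within (K + y) (K ∸ y) g × gapWeight g ≡ n × nonOver g ≡ j

GapList-irr : ∀ K y n j → Irr (GapList K y n j)
GapList-irr K y n j g = ×-irr (Within-irr _ _ g) (×-irr ≡-irrelevant ≡-irrelevant)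

Word↔GapList : ∀ K y n j → y ≤ K → Σ (List Letter) (Word K y n j) ↔ Σ (List Gap) (GapList K y n j)
Word↔GapList K y n j y≤K = injSurj-↔ (Word-irr K y n j) (GapList-irr K y n j) gaps
  (λ w (v , m , s) → gaps-within K y (K ∸ y) w (m+[n∸m]≡n y≤K) v ,
    trans (gaps-weight w) m , trans (gaps-nonOver w) s)
  (λ v w (a , _) (b , _) → gaps-injective K y v w a b)
  surj
  where
  surj : ∀ g → GapList K y n j g → Σ[ w ∈ _ ] (Word K y n j w × gaps w ≡ g)
  surj g (b , m , s) with gaps-surj K (gapSize g) y (K ∸ y) g (m+[n∸m]≡n y≤K) ≤-refl b
  ... | w , v , refl = w , (v , trans (sym (gaps-weight w)) m , trans (sym (gaps-nonOver w)) s) , refl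

-- From gaps to columns and successive ranks

sumP sumQ span : List Gap → ℕ
sumP []                = 0
sumP ((p , _ , _) ∷ g) = p + sumP g
sumQ []                = 0
sumQ ((_ , q , _) ∷ g) = q + sumQ g
span []                = 0
span ((p , q , o) ∷ g) = suc (p + q) + bit o + span g

-- Gaps listed from the outermost column inwards.
WithinR : ℕ → ℕ → List Gap → Set
WithinR A B []          = ⊤
WithinR A B g@(_ ∷ g′)  = sumP g ≤ A + sumQ g × suc (sumQ g) ≤ B + sumP g × WithinR A B g′

WithinR-irr : ∀ A B → Irr (WithinR A B)
WithinR-irr A B []      _ _ = refl
WithinR-irr A B (_ ∷ g)     = ×-irr ≤-irrelevant (×-irr ≤-irrelevant (WithinR-irr A B g))

gapWeightR : List Gap → ℕ
gapWeightR []                = 0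
gapWeightR ((p , q , o) ∷ g) = suc (p + q) + span g + gapWeightR g

GapListR : (K y n j : ℕ) → List Gap → Set
GapListR K y n j g = WithinR (K + y) (K ∸ y) g × gapWeightR g ≡ n × nonOver g ≡ j

GapListR-irr : ∀ K y n j → Irr (GapListR K y n j)
GapListR-irr K y n j g = ×-irr (WithinR-irr _ _ g) (×-irr ≡-irrelevant ≡-irrelevant)

-- Accumulates the sums over the gaps already passed where `Within` moves the ends of the strip.
-- With fixed ends the condition can be extended at the far end of the list, as reversal requires.
WithinC : ℕ → ℕ → ℕ → ℕ → List Gap → Set
WithinC A B p₀ q₀ []                = ⊤
WithinC A B p₀ q₀ ((p , q , o) ∷ g) =
  p + p₀ ≤ A + (q + q₀) × suc (q + q₀) ≤ B + (p + p₀) × WithinC A B (p + p₀) (q + q₀) g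

rebase : ∀ A A′ p₀ q₀ q → A′ + p₀ ≡ A + q₀ → A′ + q + p₀ ≡ A + (q + q₀)
rebase A A′ p₀ q₀ q e = trans (eq A′ q p₀) (trans (cong (_+ q) e) (eq′ A q₀ q))
  where
  eq : ∀ x y z → x + y + z ≡ x + z + y
  eq = solve-∀
  eq′ : ∀ x y z → x + y + z ≡ x + (z + y)
  eq′ = solve-∀

module _ (A B : ℕ) where

  private
    nextA : ∀ {A′} {p₀ q₀ p q} → p ≤ A′ + q → A′ + p₀ ≡ A + q₀ → (A′ + q ∸ p) + (p + p₀) ≡ A + (q + q₀)
    nextA {A′} {p₀} {q₀} {p} {q} a e =
        trans (sym (+-assoc (A′ + q ∸ p) p p₀)) (trans (cong (_+ p₀) (m∸n+n≡m a)) (rebase A A′ p₀ q₀ q e))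
    nextB : ∀ {B′} {p₀ q₀ p q} → suc q ≤ B′ + p → B′ + q₀ ≡ B + p₀ →
        suc (B′ + p ∸ suc q) + (q + q₀) ≡ B + (p + p₀)
    nextB {B′} {p₀} {q₀} {p} {q} b e = trans (sym (+-assoc (suc (B′ + p ∸ suc q)) q q₀))
      (trans (cong (_+ q₀) (trans (sym (+-suc (B′ + p ∸ suc q) q)) (m∸n+n≡m b))) (rebase B B′ q₀ p₀ p e))

  Within⇒WithinC : ∀ A′ B′ p₀ q₀ g → A′ + p₀ ≡ A + q₀ → B′ + q₀ ≡ B + p₀ → Within A′ B′ g → WithinC A B p₀ q₀ g
  Within⇒WithinC A′ B′ p₀ q₀ [] ea eb v = tt
  Within⇒WithinC A′ B′ p₀ q₀ ((p , q , o) ∷ g) ea eb (a , b , v) =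
    ≤-trans (+-monoˡ-≤ p₀ a) (≤-reflexive (rebase A A′ p₀ q₀ q ea)) ,
    ≤-trans (+-monoˡ-≤ q₀ b) (≤-reflexive (rebase B B′ q₀ p₀ p eb)) ,
    Within⇒WithinC _ _ (p + p₀) (q + q₀) g (nextA a ea) (nextB b eb) v

  WithinC⇒Within : ∀ A′ B′ p₀ q₀ g → A′ + p₀ ≡ A + q₀ → B′ + q₀ ≡ B + p₀ → WithinC A B p₀ q₀ g → Within A′ B′ g
  WithinC⇒Within A′ B′ p₀ q₀ [] ea eb v = tt
  WithinC⇒Within A′ B′ p₀ q₀ ((p , q , o) ∷ g) ea eb (a , b , v) = a′ , b′ ,
    WithinC⇒Within _ _ (p + p₀) (q + q₀) g (nextA a′ ea) (nextB b′ eb) v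
    where
    a′ : p ≤ A′ + q
    a′ = +-cancelʳ-≤ p₀ p (A′ + q) (≤-trans a (≤-reflexive (sym (rebase A A′ p₀ q₀ q ea))))
    b′ : suc q ≤ B′ + p
    b′ = +-cancelʳ-≤ q₀ (suc q) (B′ + p) (≤-trans b (≤-reflexive (sym (rebase B B′ q₀ p₀ p eb))))

+-rotˡ : ∀ x y z → x + y + z ≡ y + (x + z)
+-rotˡ = solve-∀

WithinC-∷ʳ⁺ : ∀ A B p₀ q₀ g p q o → WithinC A B p₀ q₀ g →
  p + (sumP g + p₀) ≤ A + (q + (sumQ g + q₀)) → suc (q + (sumQ g + q₀)) ≤ B + (p + (sumP g + p₀)) →
  WithinC A B p₀ q₀ (g ++ (p , q , o) ∷ [])
WithinC-∷ʳ⁺ A B p₀ q₀ [] p q o v a b = a , b , tt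
WithinC-∷ʳ⁺ A B p₀ q₀ ((p′ , q′ , o′) ∷ g) p q o (a′ , b′ , v) a b = a′ , b′ ,
  WithinC-∷ʳ⁺ A B (p′ + p₀) (q′ + q₀) g p q o v
    (subst₂ (λ x y → p + x ≤ A + (q + y)) (+-rotˡ p′ (sumP g) p₀) (+-rotˡ q′ (sumQ g) q₀) a)
    (subst₂ (λ x y → suc (q + y) ≤ B + (p + x)) (+-rotˡ p′ (sumP g) p₀) (+-rotˡ q′ (sumQ g) q₀) b)

WithinC-∷ʳ⁻ : ∀ A B p₀ q₀ g p q o → WithinC A B p₀ q₀ (g ++ (p , q , o) ∷ []) → WithinC A B p₀ q₀ g ×
  p + (sumP g + p₀) ≤ A + (q + (sumQ g + q₀)) × suc (q + (sumQ g + q₀)) ≤ B + (p + (sumP g + p₀))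
WithinC-∷ʳ⁻ A B p₀ q₀ [] p q o (a , b , _) = tt , a , b
WithinC-∷ʳ⁻ A B p₀ q₀ ((p′ , q′ , o′) ∷ g) p q o (a′ , b′ ,
    v) with WithinC-∷ʳ⁻ A B (p′ + p₀) (q′ + q₀) g p q o v
... | v′ , a , b = (a′ , b′ , v′) ,
    subst₂ (λ x y → p + x ≤ A + (q + y)) (sym (+-rotˡ p′ (sumP g) p₀)) (sym (+-rotˡ q′ (sumQ g) q₀)) a ,
    subst₂ (λ x y → suc (q + y) ≤ B + (p + x)) (sym (+-rotˡ p′ (sumP g) p₀)) (sym (+-rotˡ q′ (sumQ g) q₀)) b

additive-reverse : (s : List Gap → ℕ) (h : Gap → ℕ) → s [] ≡ 0 → (∀ x g → s (x ∷ g) ≡ h x + s g) → ∀ g →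
    s (reverse g) ≡ s g
additive-reverse s h e₀ e [] = refl
additive-reverse s h e₀ e (x ∷ g) =
    trans (cong s (unfold-reverse x g))
    (trans (snoc (reverse g)) (trans (cong (h x +_) (additive-reverse s h e₀ e g)) (sym (e x g))))
  where
  snoc : ∀ g → s (g ++ x ∷ []) ≡ h x + s g
  snoc []      = e x []
  snoc (z ∷ g) = trans (e z (g ++ x ∷ []))
      (trans (cong (h z +_) (snoc g)) (trans (+-swapˡ (h z) (h x) (s g)) (cong (h x +_) (sym (e z g)))))

sumP-reverse : ∀ g → sumP (reverse g) ≡ sumP g
sumP-reverse = additive-reverse sumP proj₁ refl (λ _ _ → refl)

sumQ-reverse : ∀ g → sumQ (reverse g) ≡ sumQ g
sumQ-reverse = additive-reverse sumQ (λ x → proj₁ (proj₂ x)) refl (λ _ _ → refl)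

span-reverse : ∀ g → span (reverse g) ≡ span g
span-reverse = additive-reverse span (λ (p , q , o) → suc (p + q) + bit o) refl (λ _ _ → refl)

nonOver-reverse : ∀ g → nonOver (reverse g) ≡ nonOver g
nonOver-reverse = additive-reverse nonOver (λ (p , q , o) → bit (not o)) refl (λ _ _ → refl)

WithinR⇒WithinC : ∀ A B g → WithinR A B g → WithinC A B 0 0 (reverse g)
WithinR⇒WithinC A B [] v = tt
WithinR⇒WithinC A B (x@(p , q , o) ∷ g) (a , b , v) = subst (WithinC A B 0 0) (sym (unfold-reverse x g))
  (WithinC-∷ʳ⁺ A B 0 0 (reverse g) p q o (WithinR⇒WithinC A B g v)
    (subst₂ (λ s t → p + s ≤ A + (q + t)) (sym (trans +0 (sumP-reverse g))) (sym (trans +0 (sumQ-reverse g))) a)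
    (subst₂ (λ s t → suc (q + t) ≤ B + (p + s)) (sym (trans +0 (sumP-reverse g)))
        (sym (trans +0 (sumQ-reverse g))) b))

WithinC⇒WithinR : ∀ A B g → WithinC A B 0 0 (reverse g) → WithinR A B g
WithinC⇒WithinR A B [] v = tt
WithinC⇒WithinR A B (x@(p , q , o) ∷ g) v
  with WithinC-∷ʳ⁻ A B 0 0 (reverse g) p q o (subst (WithinC A B 0 0) (unfold-reverse x g) v)
... | v′ , a , b =
    subst₂ (λ s t → p + s ≤ A + (q + t)) (trans +0 (sumP-reverse g)) (trans +0 (sumQ-reverse g)) a ,
    subst₂ (λ s t → suc (q + t) ≤ B + (p + s)) (trans +0 (sumP-reverse g)) (trans +0 (sumQ-reverse g)) b ,
    WithinC⇒WithinR A B g v′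

gapWeight-∷ʳ : ∀ g p q o → gapWeight (g ++ (p , q , o) ∷ []) ≡ suc (p + q) + span g + gapWeight g
gapWeight-∷ʳ [] p q o = eq (p + q) (bit o)
  where
  eq : ∀ s b → suc s * 1 + b * 0 + 0 ≡ suc s + 0 + 0
  eq = solve-∀
gapWeight-∷ʳ ((p′ , q′ , o′) ∷ g) p q o rewrite length-++ g {(p , q , o) ∷ []} | gapWeight-∷ʳ g p q o =
  eq (p′ + q′) (bit o′) (length g) (p + q) (span g) (gapWeight g)
  where
  eq : ∀ s b n t x w → suc s * suc (n + 1) + b * (n + 1) + (suc t + x + w) ≡ suc t + (suc s + b + x) +
      (suc s * suc n + b * n + w)
  eq = solve-∀

gapWeight-reverse : ∀ g → gapWeight (reverse g) ≡ gapWeightR g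
gapWeight-reverse [] = refl
gapWeight-reverse (x@(p , q , o) ∷ g) = trans (cong gapWeight (unfold-reverse x g))
  (trans (gapWeight-∷ʳ (reverse g) p q o)
    (cong₂ (λ s w → suc (p + q) + s + w) (span-reverse g) (gapWeight-reverse g)))

GapListR↔GapList : ∀ K y n j → Σ (List Gap) (GapListR K y n j) ↔ Σ (List Gap) (GapList K y n j)
GapListR↔GapList K y n j = subset-↔ (GapListR-irr K y n j) (GapList-irr K y n j) reverse reverse to
  (λ g f → from (reverse g) (subst (GapList K y n j) (sym (reverse-involutive g)) f))
  (λ g _ → reverse-involutive g) (λ g _ → reverse-involutive g)
  where
  to : ∀ g → GapListR K y n j g → GapList K y n j (reverse g)
  to g (b , w , o) = WithinC⇒Within (K + y) (K ∸ y) (K + y) (K ∸ y) 0 0 (reverse g) refl refl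
      (WithinR⇒WithinC _ _ g b) ,
    trans (gapWeight-reverse g) w , trans (nonOver-reverse g) o
  from : ∀ g → GapList K y n j (reverse g) → GapListR K y n j g
  from g (b , w , o) = WithinC⇒WithinR _ _ g
      (Within⇒WithinC (K + y) (K ∸ y) (K + y) (K ∸ y) 0 0 (reverse g) refl refl b) ,
    trans (sym (gapWeight-reverse g)) w , trans (sym (nonOver-reverse g)) o

-- Lower bounds for the next column outwards: the top row is strictly decreasing, and an overlined
-- bottom entry has to be the first of its value.
nextTop nextBot : List Column → ℕ
nextTop []                = 0
nextTop ((a , b , o) ∷ _) = suc a
nextBot []                = 0
nextBot ((a , b , o) ∷ _) = b + bit o

columns : List Gap → List Column
columns []                = []
columns ((p , q , o) ∷ g) = (p + nextTop (columns g) , q + nextBot (columns g) , o) ∷ columns g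

columns-injective : ∀ g g′ → columns g ≡ columns g′ → g ≡ g′
columns-injective [] [] e = refl
columns-injective ((p , q , o) ∷ g) ((p′ , q′ , o′) ∷ g′) e with ∷-inj e
... | h , t with columns-injective g g′ t
... | refl = cong (_∷ g) (cong₂ _,_ (+-cancelʳ-≡ _ p p′ (cong proj₁ h))
        (cong₂ _,_ (+-cancelʳ-≡ _ q q′ (cong (λ x → proj₁ (proj₂ x)) h)) (cong (λ x → proj₂ (proj₂ x)) h)))

frob-∷⁺ : ∀ a b o cs → nextTop cs ≤ a → nextBot cs ≤ b → T (isFrobenius cs) → T (isFrobenius ((a , b , o) ∷ cs))
frob-∷⁺ a b o [] _ _ _ = tt
frob-∷⁺ a b o ((a′ , b′ , o′) ∷ cs) la lb t =
    T-∧⁺ (<⇒<ᵇ la) (T-∧⁺ (≤⇒≤ᵇ (≤-trans (m≤m+n b′ _) lb)) (T-∧⁺ (go (b ≡ᵇ b′) refl o′ lb) t))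
  where
  go : ∀ e → (b ≡ᵇ b′) ≡ e → ∀ o′ → b′ + bit o′ ≤ b → T (if e then not o′ else true)
  go false _ o′    lb = tt
  go true  _ false lb = tt
  go true  e true  lb = ⊥-elim (<-irrefl (sym (≡ᵇ⇒≡ b b′ (subst T (sym e) tt))) (≤-by (+-comm b′ 1) lb))

frob-∷⁻ : ∀ a b o cs → T (isFrobenius ((a , b , o) ∷ cs)) → nextTop cs ≤ a × nextBot cs ≤ b × T (isFrobenius cs)
frob-∷⁻ a b o [] _ = z≤n , z≤n , tt
frob-∷⁻ a b o ((a′ , b′ , o′) ∷ cs) t with T-∧⁻ {a′ <ᵇ a} t
... | la , t₁ with T-∧⁻ {b′ ≤ᵇ b} t₁
... | lb , t₂ with T-∧⁻ {if b ≡ᵇ b′ then not o′ else true} t₂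
... | c , t₃ = <ᵇ⇒< a′ a la , go o′ c , t₃
  where
  go : ∀ o′ → T (if b ≡ᵇ b′ then not o′ else true) → b′ + bit o′ ≤ b
  go false _ = ≤-by (sym +0) (≤ᵇ⇒≤ b′ b lb)
  go true  c with b ≡ᵇ b′ in e
  ... | false = ≤-by (+-comm 1 b′) (≤∧≢⇒< (≤ᵇ⇒≤ b′ b lb) (λ b≡ → subst T e (≡⇒≡ᵇ b b′ (sym b≡))))

columns-frob : ∀ g → T (isFrobenius (columns g))
columns-frob []                = tt
columns-frob ((p , q , o) ∷ g) = frob-∷⁺ _ _ o (columns g) (m≤n+m _ p) (m≤n+m _ q) (columns-frob g)

columns-surj : ∀ cs → T (isFrobenius cs) → Σ[ g ∈ List Gap ] columns g ≡ cs
columns-surj [] t = [] , refl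
columns-surj ((a , b , o) ∷ cs) t with frob-∷⁻ a b o cs t
... | la , lb , t′ with columns-surj cs t′
... | g , refl = (a ∸ nextTop cs , b ∸ nextBot cs , o) ∷ g ,
    cong (_∷ cs) (cong₂ _,_ (m∸n+n≡m la) (cong (_, o) (m∸n+n≡m lb)))

columns-nonOver : ∀ g → numNonOverlinedBottom (columns g) ≡ nonOver g
columns-nonOver []                    = refl
columns-nonOver ((_ , _ , true) ∷ g)  = columns-nonOver g
columns-nonOver ((_ , _ , false) ∷ g) = cong suc (columns-nonOver g)

columns-span : ∀ g → nextTop (columns g) + nextBot (columns g) ≡ span g
columns-span []                = refl
columns-span ((p , q , o) ∷ g) =
    trans (eq p q (bit o) (nextTop (columns g)) (nextBot (columns g)))
    (cong (suc (p + q) + bit o +_) (columns-span g))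
  where
  eq : ∀ p q b s t → suc (p + s) + (q + t + b) ≡ suc (p + q) + b + (s + t)
  eq = solve-∀

columns-weight : ∀ g → frobWeight (columns g) ≡ gapWeightR g
columns-weight []                = refl
columns-weight ((p , q , o) ∷ g) = trans
  (eq p q (nextTop (columns g)) (nextBot (columns g)) (length (columns g))
      (sum (map (λ c → topEntry c + botEntry c) (columns g))))
  (cong₂ (λ s w → suc (p + q) + s + w) (columns-span g) (columns-weight g))
  where
  eq : ∀ p q s t l w → suc l + (p + s + (q + t) + w) ≡ suc (p + q) + (s + t) + (l + w)
  eq = solve-∀

suc-+-swapˡ : ∀ p l s → suc (p + (l + s)) ≡ suc l + (p + s)
suc-+-swapˡ = solve-∀

columns-top : ∀ g → nextTop (columns g) ≡ length g + sumP g
columns-top []                = refl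
columns-top ((p , q , o) ∷ g) =
    trans (cong (λ x → suc (p + x)) (columns-top g)) (suc-+-swapˡ p (length g) (sumP g))

-- Each column adds one either way: an overlined bottom entry pushes up the entries further out, a
-- non-overlined one is counted in their ranks. Together with `columns-top` this makes a successive
-- rank the difference of the `p`-sum and the `q`-sum of the gaps up to that column.
columns-bot : ∀ g → nextBot (columns g) + numNonOverlinedBottom (columns g) ≡ length g + sumQ g
columns-bot []                = refl
columns-bot ((p , q , o) ∷ g) =
    trans (go o) (trans (cong (λ x → suc (q + x)) (columns-bot g)) (suc-+-swapˡ q (length g) (sumQ g)))
  where
  N = numNonOverlinedBottom (columns g)
  B = nextBot (columns g)
  e₁ : ∀ q B N → q + B + 1 + (0 + N) ≡ suc (q + (B + N))
  e₁ = solve-∀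
  e₂ : ∀ q B N → q + B + 0 + (1 + N) ≡ suc (q + (B + N))
  e₂ = solve-∀
  go : ∀ o → nextBot (columns ((p , q , o) ∷ g)) + numNonOverlinedBottom (columns ((p , q , o) ∷ g)) ≡ suc
      (q + (B + N))
  go true  = e₁ q B N
  go false = e₂ q B N

module _ (i k a b c : ℕ) where

  open ℤ using (+_)

  private
    -- Adding i + b + c to both sides removes every negative term but the -1 of the upper end.
    t : ℤ.ℤ
    t = + i ℤ.+ (+ b ℤ.+ + c)
    l₁ : ∀ i b c → (ℤ.- i ℤ.+ + 2) ℤ.+ (i ℤ.+ (b ℤ.+ c)) ≡ + 2 ℤ.+ (b ℤ.+ c)
    l₁ = ℤSolver.solve-∀
    l₂ : ∀ a i b c → ((a ℤ.- b) ℤ.- c) ℤ.+ (i ℤ.+ (b ℤ.+ c)) ≡ a ℤ.+ i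
    l₂ = ℤSolver.solve-∀
    l₃ : ∀ n i b c → ((n ℤ.- i) ℤ.- + 1) ℤ.+ (i ℤ.+ (b ℤ.+ c)) ≡ (n ℤ.+ (b ℤ.+ c)) ℤ.- + 1
    l₃ = ℤSolver.solve-∀
    l₄ : ∀ n → (n ℤ.- + 1) ℤ.+ + 1 ≡ n
    l₄ = ℤSolver.solve-∀
    l₅ : ∀ x t → (x ℤ.+ t) ℤ.+ (ℤ.- t) ≡ x
    l₅ = ℤSolver.solve-∀
    cancel : ∀ t {x y} → x ℤ.+ t ℤ.≤ y ℤ.+ t → x ℤ.≤ y
    cancel t {x} {y} h = subst₂ ℤ._≤_ (l₅ x t) (l₅ y t) (ℤₚ.+-monoˡ-≤ (ℤ.- t) h)

  rank-lower : (ℤ.- + i ℤ.+ + 2) ℤ.≤ ((+ a ℤ.- + b) ℤ.- + c) ⇔ (2 + (b + c) ≤ a + i)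
  rank-lower = mk⇔
    (λ h → ℤₚ.drop‿+≤+ (subst₂ ℤ._≤_ (l₁ (+ i) (+ b) (+ c)) (l₂ (+ a) (+ i) (+ b) (+ c)) (ℤₚ.+-monoˡ-≤ t h)))
    (λ h → cancel t (subst₂ ℤ._≤_ (sym (l₁ (+ i) (+ b) (+ c))) (sym (l₂ (+ a) (+ i) (+ b) (+ c))) (ℤ.+≤+ h)))

  rank-upper : ((+ a ℤ.- + b) ℤ.- + c) ℤ.≤ ((+ (2 * k) ℤ.- + i) ℤ.- + 1) ⇔ (a + i + 1 ≤ 2 * k + (b + c))
  rank-upper = mk⇔
    (λ h → ℤₚ.drop‿+≤+ (subst (+ (a + i + 1) ℤ.≤_) (l₄ (+ (2 * k + (b + c)))) (ℤₚ.+-monoˡ-≤ (+ 1)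
       (subst₂ ℤ._≤_ (l₂ (+ a) (+ i) (+ b) (+ c)) (l₃ (+ (2 * k)) (+ i) (+ b) (+ c)) (ℤₚ.+-monoˡ-≤ t h)))))
    (λ h → cancel t (subst₂ ℤ._≤_ (sym (l₂ (+ a) (+ i) (+ b) (+ c))) (sym (l₃ (+ (2 * k)) (+ i) (+ b) (+ c)))
       (cancel (+ 1) (subst (+ (a + i + 1) ℤ.≤_) (sym (l₄ (+ (2 * k + (b + c))))) (ℤ.+≤+ h)))))

T-≤ℤ : ∀ {x y} → T (x ≤ℤ y) ⇔ (x ℤ.≤ y)
T-≤ℤ {x} {y} = mk⇔ (λ t → toWitness {a? = x ℤ.≤? y} (subst T (sym (isYes≗does (x ℤ.≤? y))) t))
  (λ h → subst T (isYes≗does (x ℤ.≤? y)) (fromWitness {a? = x ℤ.≤? y} h))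

module _ (K i : ℕ) (i≤K : i ≤ K) where

  private
    y : ℕ
    y = K ∸ i
    inWindow : ℤ.ℤ → Bool
    inWindow r = ((ℤ.- ℤ.+ suc i ℤ.+ ℤ.+ 2) ≤ℤ r) ∧ (r ≤ℤ ((ℤ.+ (2 * suc K) ℤ.- ℤ.+ suc i) ℤ.- ℤ.+ 1))

  lower⇔ : ∀ L R Q → 2 + (L + Q) ≤ L + R + suc i ⇔ suc Q ≤ (K ∸ y) + R
  lower⇔ L R Q = mk⇔
    (λ h → subst (λ x → suc Q ≤ x + R) (sym (m∸[m∸n]≡n i≤K))
        (+-cancelˡ-≤ (suc L) _ _ (subst₂ _≤_ (e₁ L Q) (e₂ L R i) h)))
    (λ h → subst₂ _≤_ (sym (e₁ L Q)) (sym (e₂ L R i))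
        (+-monoʳ-≤ (suc L) (subst (λ x → suc Q ≤ x + R) (m∸[m∸n]≡n i≤K) h)))
    where
    e₁ : ∀ L Q → 2 + (L + Q) ≡ suc L + suc Q
    e₁ = solve-∀
    e₂ : ∀ L R i → L + R + suc i ≡ suc L + (i + R)
    e₂ = solve-∀

  upper⇔ : ∀ L R Q → L + R + suc i + 1 ≤ 2 * suc K + (L + Q) ⇔ R ≤ (K + y) + Q
  upper⇔ L R Q = mk⇔
    (λ h → +-cancelˡ-≤ (L + i + 2) _ _ (subst₂ _≤_ (e₁ L R i) e₂ h))
    (λ h → subst₂ _≤_ (sym (e₁ L R i)) (sym e₂) (+-monoʳ-≤ (L + i + 2) h))
    where
    e₁ : ∀ L R i → L + R + suc i + 1 ≡ L + i + 2 + R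
    e₁ = solve-∀
    e₃ : ∀ K y i L Q → K + (y + i) + 2 + (L + Q) ≡ L + i + 2 + (K + y + Q)
    e₃ = solve-∀
    e₄ : ∀ K → 2 * suc K ≡ K + K + 2
    e₄ = solve-∀
    e₂ : 2 * suc K + (L + Q) ≡ L + i + 2 + (K + y + Q)
    e₂ = trans (cong (_+ (L + Q)) (trans (e₄ K) (cong (λ x → K + x + 2) (sym (m∸n+n≡m i≤K))))) (e₃ K y i L Q)

  -- The number `L` of inner columns cancels from the rank. As the theorem's i is `suc i` here, the
  -- window runs from 1 - i to 2K - i, that is from 1 - (K - y) to K + y: these are the two walls of
  -- the strip.
  rank⇔ : ∀ p q o g → let c = (p + nextTop (columns g) , q + nextBot (columns g) , o) in
    T (inWindow ((ℤ.+ topEntry c ℤ.- ℤ.+ botEntry c) ℤ.- ℤ.+ numNonOverlinedBottom (columns g))) ⇔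
    (p + sumP g ≤ (K + y) + (q + sumQ g) × suc (q + sumQ g) ≤ (K ∸ y) + (p + sumP g))
  rank⇔ p q o g = mk⇔
    (λ t → let (l , u) = T-∧⁻ {(ℤ.- ℤ.+ suc i ℤ.+ ℤ.+ 2) ≤ℤ _} t in
      Equivalence.to (upper⇔ L (p + sumP g) (q + sumQ g)) (subst₂ (λ a b → a + suc i + 1 ≤ 2 * suc K + b) ea eb
        (Equivalence.to (rank-upper (suc i) (suc K) a b c) (Equivalence.to T-≤ℤ u))) ,
      Equivalence.to (lower⇔ L (p + sumP g) (q + sumQ g)) (subst₂ (λ a b → 2 + b ≤ a + suc i) ea eb
        (Equivalence.to (rank-lower (suc i) (suc K) a b c) (Equivalence.to T-≤ℤ l))))
    (λ (u , l) → T-∧⁺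
      (Equivalence.from T-≤ℤ (Equivalence.from (rank-lower (suc i) (suc K) a b c)
        (subst₂ (λ a b → 2 + b ≤ a + suc i) (sym ea) (sym eb)
            (Equivalence.from (lower⇔ L (p + sumP g) (q + sumQ g)) l))))
      (Equivalence.from T-≤ℤ (Equivalence.from (rank-upper (suc i) (suc K) a b c)
        (subst₂ (λ a b → a + suc i + 1 ≤ 2 * suc K + b) (sym ea) (sym eb)
            (Equivalence.from (upper⇔ L (p + sumP g) (q + sumQ g)) u)))))
    where
    L = length g
    a = p + nextTop (columns g)
    b = q + nextBot (columns g)
    c = numNonOverlinedBottom (columns g)
    ea : a ≡ L + (p + sumP g)
    ea = trans (cong (p +_) (columns-top g)) (+-swapˡ p L (sumP g))
    eb : b + c ≡ L + (q + sumQ g)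
    eb = trans (+-assoc q _ c) (trans (cong (q +_) (columns-bot g)) (+-swapˡ q L (sumQ g)))

  ranks⁺ : ∀ g → WithinR (K + y) (K ∸ y) g → T (allB inWindow (successiveRanks (columns g)))
  ranks⁺ []                v           = tt
  ranks⁺ ((p , q , o) ∷ g) (a , b , v) = T-∧⁺ (Equivalence.from (rank⇔ p q o g) (a , b)) (ranks⁺ g v)

  ranks⁻ : ∀ g → T (allB inWindow (successiveRanks (columns g))) → WithinR (K + y) (K ∸ y) g
  ranks⁻ []                t = tt
  ranks⁻ ((p , q , o) ∷ g) t with T-∧⁻ {inWindow _} t
  ... | r , t′ with Equivalence.to (rank⇔ p q o g) r
  ... | a , b = a , b , ranks⁻ g t′

  GapListR↔C̄ : ∀ n j → Σ (List Gap) (GapListR K y n j) ↔ C̄ (suc K) (suc i) n j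
  GapListR↔C̄ n j = injSurj-↔ (GapListR-irr K y n j) (λ _ → T-irrelevant) columns to
    (λ g g′ _ _ → columns-injective g g′) from
    where
    to : ∀ g → GapListR K y n j g → T (isC (suc K) (suc i) n j (columns g))
    to g (v , w , o) = T-∧⁺ (columns-frob g) (T-∧⁺ (≡⇒≡ᵇ _ n (trans (columns-weight g) w))
      (T-∧⁺ (≡⇒≡ᵇ _ j (trans (columns-nonOver g) o)) (ranks⁺ g v)))
    from : ∀ cs → T (isC (suc K) (suc i) n j cs) → Σ[ g ∈ _ ] (GapListR K y n j g × columns g ≡ cs)
    from cs t with T-∧⁻ {isFrobenius cs} t
    ... | fr , t₁ with T-∧⁻ {frobWeight cs ≡ᵇ n} t₁
    ... | wt , t₂ with T-∧⁻ {numNonOverlinedBottom cs ≡ᵇ j} t₂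
    ... | nu , ra with columns-surj cs fr
    ... | g , refl = g , (ranks⁻ g ra , trans (sym (columns-weight g)) (≡ᵇ⇒≡ _ n wt) ,
      trans (sym (columns-nonOver g)) (≡ᵇ⇒≡ _ j nu)) , refl

-- Cutting the peaks of a path

Plain : List Letter → Set
Plain []      = ⊤
Plain (P ∷ _) = ⊥
Plain (_ ∷ w) = Plain w

PlainValid : ℕ → ℕ → List Letter → Set
PlainValid K y w = Valid K y w × Plain w

numTrue numFalse : List Bool → ℕ
numTrue []          = 0
numTrue (true ∷ b)  = suc (numTrue b)
numTrue (false ∷ b) = numTrue b
numFalse []          = 0
numFalse (true ∷ b)  = numFalse b
numFalse (false ∷ b) = suc (numFalse b)

-- Turning a peak `U`, `D` into `P` deletes one letter behind the peak, so each later peak moves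
-- left by one while the peak itself stays.
trueCost : List Bool → ℕ
trueCost []          = 0
trueCost (true ∷ b)  = length b + trueCost b
trueCost (false ∷ b) = trueCost b

mark : List Letter → List Bool → List Letter
mark []          bs           = []
mark (U ∷ D ∷ w) (true ∷ bs)  = P ∷ mark w bs
mark (U ∷ D ∷ w) (false ∷ bs) = U ∷ D ∷ mark w bs
mark (l ∷ w)     bs           = l ∷ mark w bs

unmark : List Letter → List Letter × List Bool
unmark []          = [] , []
unmark (P ∷ w)     = let (p , bs) = unmark w in U ∷ D ∷ p , true ∷ bs
unmark (U ∷ D ∷ w) = let (p , bs) = unmark w in U ∷ D ∷ p , false ∷ bs
unmark (l ∷ w)     = let (p , bs) = unmark w in l ∷ p , bs

unmark-mark : ∀ K y w bs → PlainValid K y w → length bs ≡ peaks w → unmark (mark w bs) ≡ (w , bs)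
unmark-mark K y [] [] v e = refl
unmark-mark K (suc y) (D ∷ w) bs (v , p) e rewrite unmark-mark K y w bs (v , p) e = refl
unmark-mark K zero (H ∷ w) bs ((_ , v) , p) e rewrite unmark-mark K zero w bs (v , p) e = refl
unmark-mark K y (U ∷ D ∷ w) (true ∷ bs) ((_ , v) , p) e rewrite unmark-mark K y w bs (v ,
    p) (suc-injective e) = refl
unmark-mark K y (U ∷ D ∷ w) (false ∷ bs) ((_ , v) , p) e rewrite unmark-mark K y w bs (v ,
    p) (suc-injective e) = refl
unmark-mark K y (U ∷ U ∷ D ∷ w) (true ∷ bs) ((_ , v) , p) e =
  cong (λ (w , bs) → U ∷ w , bs) (unmark-mark K (suc y) (U ∷ D ∷ w) (true ∷ bs) (v , p) e)
unmark-mark K y (U ∷ U ∷ D ∷ w) (false ∷ bs) ((_ , v) , p) e =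
  cong (λ (w , bs) → U ∷ w , bs) (unmark-mark K (suc y) (U ∷ D ∷ w) (false ∷ bs) (v , p) e)
unmark-mark K y (U ∷ U ∷ U ∷ w) bs ((_ , v) , p) e =
  cong (λ (w , bs) → U ∷ w , bs) (unmark-mark K (suc y) (U ∷ U ∷ w) bs (v , p) e)

mark-Valid : ∀ K y w bs → PlainValid K y w → length bs ≡ peaks w → Valid K y (mark w bs)
mark-Valid K y [] bs v e = proj₁ v
mark-Valid K (suc y) (D ∷ w) bs (v , p) e = mark-Valid K y w bs (v , p) e
mark-Valid K zero (H ∷ w) bs ((n , v) , p) e = ne w bs n e , mark-Valid K zero w bs (v , p) e
  where
  ne : ∀ w bs → NonEmpty w → length bs ≡ peaks w → NonEmpty (mark w bs)
  ne (D ∷ w) bs n e = tt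
  ne (H ∷ w) bs n e = tt
  ne (P ∷ w) bs n e = tt
  ne (U ∷ []) bs n e = tt
  ne (U ∷ U ∷ w) bs n e = tt
  ne (U ∷ H ∷ w) bs n e = tt
  ne (U ∷ P ∷ w) bs n e = tt
  ne (U ∷ D ∷ w) (true ∷ bs) n e = tt
  ne (U ∷ D ∷ w) (false ∷ bs) n e = tt
mark-Valid K y (U ∷ D ∷ w) (true ∷ bs) ((s , v) , p) e = s , mark-Valid K y w bs (v , p) (suc-injective e)
mark-Valid K y (U ∷ D ∷ w) (false ∷ bs) ((s , v) , p) e = s , mark-Valid K y w bs (v , p) (suc-injective e)
mark-Valid K y (U ∷ w@(U ∷ _)) bs ((s , v) , p) e = s , mark-Valid K (suc y) w bs (v , p) e

mark-peaks : ∀ K y w bs → PlainValid K y w → length bs ≡ peaks w → peaks (mark w bs) ≡ peaks w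
mark-peaks K y [] bs v e = refl
mark-peaks K (suc y) (D ∷ w) bs (v , p) e = mark-peaks K y w bs (v , p) e
mark-peaks K zero (H ∷ w) bs ((n , v) , p) e = mark-peaks K zero w bs (v , p) e
mark-peaks K y (U ∷ D ∷ w) (true ∷ bs) ((s , v) , p) e =
    cong suc (mark-peaks K y w bs (v , p) (suc-injective e))
mark-peaks K y (U ∷ D ∷ w) (false ∷ bs) ((s , v) , p) e =
    cong suc (mark-peaks K y w bs (v , p) (suc-injective e))
mark-peaks K y (U ∷ w@(U ∷ D ∷ _)) bs@(true ∷ _) ((s , v) , p) e = mark-peaks K (suc y) w bs (v , p) e
mark-peaks K y (U ∷ w@(U ∷ D ∷ _)) bs@(false ∷ _) ((s , v) , p) e = mark-peaks K (suc y) w bs (v , p) e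
mark-peaks K y (U ∷ w@(U ∷ U ∷ _)) bs ((s , v) , p) e = mark-peaks K (suc y) w bs (v , p) e

mark-maj : ∀ K y w bs → PlainValid K y w → length bs ≡ peaks w → trueCost bs + maj (mark w bs) ≡ maj w
mark-maj K y [] [] v e = refl
mark-maj K (suc y) (D ∷ w) bs (v , p) e =
    trans (+-swapˡ (trueCost bs) (peaks (mark w bs)) (maj (mark w bs)))
    (cong₂ _+_ (mark-peaks K y w bs (v , p) e) (mark-maj K y w bs (v , p) e))
mark-maj K zero (H ∷ w) bs ((n , v) , p) e =
    trans (+-swapˡ (trueCost bs) (peaks (mark w bs)) (maj (mark w bs)))
    (cong₂ _+_ (mark-peaks K zero w bs (v , p) e) (mark-maj K zero w bs (v , p) e))
mark-maj K y (U ∷ D ∷ w) (true ∷ bs) ((s , v) , p) e =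
  trans (eq (length bs) (trueCost bs) (peaks (mark w bs)) (maj (mark w bs)))
    (cong₂ _+_ (cong suc (mark-peaks K y w bs (v , p) e′)) (cong₂ _+_ e′ (mark-maj K y w bs (v , p) e′)))
  where
  e′ : length bs ≡ peaks w
  e′ = suc-injective e
  eq : ∀ l c n m → l + c + (suc n + m) ≡ suc n + (l + (c + m))
  eq = solve-∀
mark-maj K y (U ∷ D ∷ w) (false ∷ bs) ((s , v) , p) e =
  trans (eq (trueCost bs) (peaks (mark w bs)) (maj (mark w bs)))
    (cong₂ _+_ (cong suc (mark-peaks K y w bs (v , p) e′))
        (cong₂ _+_ (mark-peaks K y w bs (v , p) e′) (mark-maj K y w bs (v , p) e′)))
  where
  e′ : length bs ≡ peaks w
  e′ = suc-injective e
  eq : ∀ c n m → c + (suc n + (n + m)) ≡ suc n + (n + (c + m))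
  eq = solve-∀
mark-maj K y (U ∷ w@(U ∷ w′)) bs v@((s , v′) , p) e =
  trans (+-swapˡ (trueCost bs) (peaks (U ∷ mark w bs)) (maj (mark w bs)))
      (cong₂ _+_ (mark-peaks K y (U ∷ w) bs v e) (mark-maj K (suc y) w bs (v′ , p) e))

mark-numP : ∀ K y w bs → PlainValid K y w → length bs ≡ peaks w → numP (mark w bs) ≡ numTrue bs
mark-numP K y [] [] v e = refl
mark-numP K (suc y) (D ∷ w) bs (v , p) e = mark-numP K y w bs (v , p) e
mark-numP K zero (H ∷ w) bs ((n , v) , p) e = mark-numP K zero w bs (v , p) e
mark-numP K y (U ∷ D ∷ w) (true ∷ bs) ((s , v) , p) e = cong suc (mark-numP K y w bs (v , p) (suc-injective e))
mark-numP K y (U ∷ D ∷ w) (false ∷ bs) ((s , v) , p) e = mark-numP K y w bs (v , p) (suc-injective e)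
mark-numP K y (U ∷ w@(U ∷ _)) bs ((s , v) , p) e = mark-numP K (suc y) w bs (v , p) e

mark-surj : ∀ K y w → Valid K y w →
    Σ[ p ∈ List Letter ] Σ[ bs ∈ List Bool ] (PlainValid K y p × length bs ≡ peaks p × mark p bs ≡ w)
mark-surj K y [] v = [] , [] , (v , tt) , refl , refl
mark-surj K (suc y) (D ∷ w) v with mark-surj K y w v
... | p , bs , v′ , e , e′ = D ∷ p , bs , v′ , e , cong (D ∷_) e′
mark-surj K zero (H ∷ w@(_ ∷ _)) (_ , v) with mark-surj K zero w v
... | p@(_ ∷ _) , bs , (v′ , pl) , e , e′ = H ∷ p , bs , ((tt , v′) , pl) , e , cong (H ∷_) e′
mark-surj K y (P ∷ w) (s , v) with mark-surj K y w v
... | p , bs , (v′ , pl) , e , e′ = U ∷ D ∷ p , true ∷ bs , ((s , v′) , pl) , cong suc e , cong (P ∷_) e′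
mark-surj K y (U ∷ D ∷ w) (s , v) with mark-surj K y w v
... | p , bs , (v′ , pl) , e , e′ = U ∷ D ∷ p , false ∷ bs , ((s , v′) , pl) , cong suc e ,
    cong (λ w → U ∷ D ∷ w) e′
mark-surj K y (U ∷ w@(U ∷ _)) (s , v) with mark-surj K (suc y) w v
... | p@(U ∷ _) , bs , (v′ , pl) , e , e′ = U ∷ p , bs , ((s , v′) , pl) , e , cong (U ∷_) e′
mark-surj K y (U ∷ w@(P ∷ _)) (s , v) with mark-surj K (suc y) w v
... | p@(U ∷ _) , bs , (v′ , pl) , e , e′ = U ∷ p , bs , ((s , v′) , pl) , e , cong (U ∷_) e′

-- The sum of a multiset that is listed in increasing order and stored by its successive
-- differences.
ω : List ℕ → ℕ
ω []       = 0
ω (δ ∷ δs) = suc (length δs) * δ + ω δs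

put : Letter → List Letter → List Letter → List Letter
put U (D ∷ _) r = U ∷ U ∷ D ∷ r
put l _       r = l ∷ r

lift : List Letter → List Letter
lift []      = []
lift (l ∷ p) = put l p (lift p)

-- Puts a unit peak on top of every peak of `p` and inserts further unit peaks; the numbers in `δs`
-- count the letters of `p` between insertions, and past the end of `p` letters `H` are supplied.
-- Where both happen at one place, the unit peak that raises comes before the inserted ones.
weave   : List Letter → List ℕ → List Letter
weave′ : List Letter → ℕ → List ℕ → List Letter

weave p []       = lift p
weave p (δ ∷ δs) = weave′ p δ δs

weave′ p       zero    δs = U ∷ D ∷ weave p δs
weave′ []      (suc δ) δs = H ∷ weave′ [] δ δs
weave′ (l ∷ p) (suc δ) δs = put l p (weave′ p δ δs)

bump : List ℕ → List ℕ
bump []       = []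
bump (δ ∷ δs) = suc δ ∷ δs

weave-∷ : ∀ l p δs → weave (l ∷ p) (bump δs) ≡ put l p (weave p δs)
weave-∷ l p []       = refl
weave-∷ l p (δ ∷ δs) = refl

-- If `U` and `D` become adjacent by the deletion, the first unit peak removed between them is the
-- one that had raised this peak, and it leaves the list. An `H` with nothing behind it was supplied
-- by an insertion past the end.
unstep : Letter → List Letter → List ℕ → List Letter × List ℕ
unstep U (D ∷ p) (_ ∷ δs) = U ∷ D ∷ p , bump δs
unstep H []      δs       = [] , bump δs
unstep l p       δs       = l ∷ p , bump δs

unweave : List Letter → List Letter × List ℕ
unweave []          = [] , []
unweave (U ∷ D ∷ w) = let (p , δs) = unweave w in p , 0 ∷ δs
unweave (l ∷ w)     = let (p , δs) = unweave w in unstep l p δs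

StartsU : List Letter → Set
StartsU (U ∷ _) = ⊤
StartsU _       = ⊥

put-StartsU : ∀ p r → StartsU (put U p r)
put-StartsU []      r = tt
put-StartsU (U ∷ _) r = tt
put-StartsU (D ∷ _) r = tt
put-StartsU (H ∷ _) r = tt
put-StartsU (P ∷ _) r = tt

weave-StartsU : ∀ p δs → StartsU (weave (U ∷ p) δs)
weave-StartsU p []            = put-StartsU p _
weave-StartsU p (zero ∷ δs)   = tt
weave-StartsU p (suc δ ∷ δs)  = put-StartsU p _

unweave-UU : ∀ r → StartsU r → unweave (U ∷ r) ≡ unstep U (proj₁ (unweave r)) (proj₂ (unweave r))
unweave-UU (U ∷ r) _ = refl

unweave-put : ∀ K y l p δs r → PlainValid K y (l ∷ p) → (∀ q → p ≡ U ∷ q → StartsU r) →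
  unweave r ≡ (p , δs) → unweave (put l p r) ≡ (l ∷ p , bump δs)
unweave-put K y       U (D ∷ p) δs r v s e rewrite e = refl
unweave-put K y       U (U ∷ p) δs r v s e rewrite unweave-UU r (s p refl) | e = refl
unweave-put K (suc y) D p δs r v s e rewrite e = refl
unweave-put K zero    H (_ ∷ _) δs r v s e rewrite e = refl

PlainValid-tail : ∀ K y l p → PlainValid K y (l ∷ p) → Σ[ y′ ∈ ℕ ] PlainValid K y′ p
PlainValid-tail K y       U p ((_ , v) , pl) = suc y , v , pl
PlainValid-tail K (suc y) D p (v , pl)       = y , v , pl
PlainValid-tail K zero    H p ((_ , v) , pl) = zero , v , pl

unweave-weave : ∀ K y p δs → PlainValid K y p → unweave (weave p δs) ≡ (p , δs)
unweave-weave′ : ∀ K y p δ δs → PlainValid K y p → unweave (weave′ p δ δs) ≡ (p , δ ∷ δs)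

unweave-weave K y []      []       v = refl
unweave-weave K y (l ∷ p) []       v = let (y′ , v′) = PlainValid-tail K y l p v in
  unweave-put K y l p [] (lift p) v (λ { q refl → weave-StartsU q [] }) (unweave-weave K y′ p [] v′)
unweave-weave K y p       (δ ∷ δs) v = unweave-weave′ K y p δ δs v

unweave-weave′ K y p       zero    δs v rewrite unweave-weave K y p δs v = refl
unweave-weave′ K y []      (suc δ) δs v rewrite unweave-weave′ K y [] δ δs v = refl
unweave-weave′ K y (l ∷ p) (suc δ) δs v = let (y′ , v′) = PlainValid-tail K y l p v in
  unweave-put K y l p (δ ∷ δs) (weave′ p δ δs) v (λ { q refl → weave-StartsU q (δ ∷ δs) }) (unweave-weave′ K y′ p δ δs v′)

NonEmpty-put : ∀ l p r → NonEmpty (put l p r)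
NonEmpty-put U []      r = tt
NonEmpty-put U (U ∷ _) r = tt
NonEmpty-put U (D ∷ _) r = tt
NonEmpty-put U (H ∷ _) r = tt
NonEmpty-put U (P ∷ _) r = tt
NonEmpty-put D p       r = tt
NonEmpty-put H p       r = tt
NonEmpty-put P p       r = tt

NonEmpty-weave : ∀ p δs → NonEmpty p → NonEmpty (weave p δs)
NonEmpty-weave (l ∷ p) []           _ = NonEmpty-put l p _
NonEmpty-weave (l ∷ p) (zero ∷ δs)  _ = tt
NonEmpty-weave (l ∷ p) (suc δ ∷ δs) _ = NonEmpty-put l p _

weave-Valid : ∀ K y p δs → y ≤ K → PlainValid K y p → PlainValid (suc K) y (weave p δs)
weave′-Valid : ∀ K y p δ δs → y ≤ K → PlainValid K y p → PlainValid (suc K) y (weave′ p δ δs)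
put-Valid : ∀ K y l p δs → y ≤ K → PlainValid K y (l ∷ p) → PlainValid (suc K) y (put l p (weave p δs))

put-Valid K y U p@(D ∷ _) δs h ((s , v) , pl) = let (v′ , pl′) = weave-Valid K (suc y) p δs s (v , pl) in
  (s≤s h , s≤s s , v′) , pl′
put-Valid K y U p@(U ∷ _) δs h ((s , v) , pl) = let (v′ , pl′) = weave-Valid K (suc y) p δs s (v , pl) in
  (s≤s h , v′) , pl′
put-Valid K (suc y) D p δs h (v , pl) = weave-Valid K y p δs (≤-trans (n≤1+n y) h) (v , pl)
put-Valid K zero H p δs h ((n , v) , pl) = let (v′ , pl′) = weave-Valid K zero p δs h (v , pl) in
  (NonEmpty-weave p δs n , v′) , pl′

weave-Valid K y []      []       h v = v
weave-Valid K y (l ∷ p) []       h v = put-Valid K y l p [] h v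
weave-Valid K y p       (δ ∷ δs) h v = weave′-Valid K y p δ δs h v

weave′-Valid K y p zero δs h v = let (v′ , pl′) = weave-Valid K y p δs h v in (s≤s h , v′) , pl′
weave′-Valid K .0 [] (suc δ) δs h v@(refl , _) = let (v′ , pl′) = weave′-Valid K 0 [] δ δs h v in (ne δ , v′) , pl′
  where
  ne : ∀ δ → NonEmpty (weave′ [] δ δs)
  ne zero    = tt
  ne (suc δ) = tt
weave′-Valid K y (l ∷ p) (suc δ) δs h v = put-Valid K y l p (δ ∷ δs) h v

-- After the deletion the rest starts with `U`, or with `D` below a unit peak. In the second case
-- that unit peak changes its role from inserted to raising, and so its entry disappears from the
-- list.
unstep-cases : ∀ p δs w → weave p δs ≡ U ∷ w → Plain p → ∀ K y → Valid K (suc y) p →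
  Σ[ p′ ∈ List Letter ] Σ[ δs′ ∈ List ℕ ] (p′ ≡ U ∷ p × weave p′ δs′ ≡ U ∷ U ∷ w)
unstep-cases p@(U ∷ _) δs w e pl K y v = U ∷ p , bump δs , refl , trans (weave-∷ U p δs) (cong (U ∷_) e)
unstep-cases p@(D ∷ _) (zero ∷ δs) w e pl K y v = U ∷ p , bump δs , refl ,
    trans (weave-∷ U p δs) (cong (U ∷_) e)

weave-surj : ∀ K y w → y ≤ K → PlainValid (suc K) y w →
  Σ[ p ∈ List Letter ] Σ[ δs ∈ List ℕ ] (PlainValid K y p × weave p δs ≡ w)
weave-surj K y [] h (v , _) = [] , [] , (v , tt) , refl
weave-surj K y (U ∷ D ∷ w) h ((_ , v) , pl) with weave-surj K y w h (v , pl)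
... | p , δs , v′ , e = p , 0 ∷ δs , v′ , cong (λ w → U ∷ D ∷ w) e
weave-surj K y (U ∷ w@(U ∷ w′)) h ((_ , v@(s , _)) , pl) with weave-surj K (suc y) w (s≤s⁻¹ s) (v , pl)
... | p , δs , (v′ , pl′) , e with unstep-cases p δs w′ e pl′ K y v′
... | .(U ∷ p) , δs′ , refl , e′ = U ∷ p , δs′ , ((s≤s⁻¹ s , v′) , pl′) , e′
weave-surj K (suc y) (D ∷ w) h (v , pl) with weave-surj K y w (≤-trans (n≤1+n y) h) (v , pl)
... | p , δs , v′ , e = D ∷ p , bump δs , v′ , trans (weave-∷ D p δs) (cong (D ∷_) e)
weave-surj K zero (H ∷ w@(_ ∷ _)) h ((_ , v) , pl) with weave-surj K zero w h (v , pl)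
... | [] , δ ∷ δs , v′ , e = [] , suc δ ∷ δs , v′ , cong (H ∷_) e
... | p@(_ ∷ _) , δs , (v′ , pl′) , e = H ∷ p , bump δs , ((tt , v′) , pl′) ,
    trans (weave-∷ H p δs) (cong (H ∷_) e)

-- The m-th unit peak stands 2m - 1 to the right of the number of letters of `p` and supplied `H`
-- before it. The odd numbers add up to the square, and the letter counts add up to `maj p` over the
-- raised peaks and to `x` over the inserted ones.
WeaveStats : List Letter → ℕ → ℕ → List Letter → Set
WeaveStats p n x w = peaks w ≡ peaks p + n × maj w ≡ (peaks p + n) * (peaks p + n) + maj p + x

put-arith : ∀ p n m x → p + n + ((p + n) * (p + n) + m + x) ≡ (p + n) * (p + n) + (p + m) + (n + x)
put-arith = solve-∀

put-stats : ∀ K y l p n x r → PlainValid K y (l ∷ p) → (∀ q → p ≡ U ∷ q → StartsU r) →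
  WeaveStats p n x r → WeaveStats (l ∷ p) n (n + x) (put l p r)
put-stats K y U (D ∷ p) n x r v s (ep , em) = cong suc ep ,
  trans (cong₂ (λ a b → suc a + (suc a + (a + b))) ep em) (eq (peaks p) n (maj (D ∷ p)) x)
  where
  eq : ∀ p n m x → suc (p + n) + (suc (p + n) + (p + n + ((p + n) * (p + n) + m + x))) ≡
    (suc p + n) * (suc p + n) + (suc p + m) + (n + x)
  eq = solve-∀
put-stats K y U (U ∷ p) n x r v s (ep , em) with s p refl
put-stats K y U (U ∷ p) n x (U ∷ r) v s (ep , em) | _ = ep ,
  trans (cong₂ _+_ ep em) (put-arith (peaks (U ∷ p)) n (maj (U ∷ p)) x)
put-stats K (suc y) D p n x r v s (ep , em) = ep , trans (cong₂ _+_ ep em) (put-arith (peaks p) n (maj p) x)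
put-stats K zero H p n x r v s (ep , em) = ep , trans (cong₂ _+_ ep em) (put-arith (peaks p) n (maj p) x)

weave-stats : ∀ K y p δs → PlainValid K y p → WeaveStats p (length δs) (ω δs) (weave p δs)
weave′-stats : ∀ K y p δ δs → PlainValid K y p → WeaveStats p (suc (length δs)) (ω (δ ∷ δs)) (weave′ p δ δs)

weave-stats K y []      []       v = refl , refl
weave-stats K y (l ∷ p) []       v = let (y′ , v′) = PlainValid-tail K y l p v in
  put-stats K y l p 0 0 (lift p) v (λ { q refl → weave-StartsU q [] }) (weave-stats K y′ p [] v′)
weave-stats K y p       (δ ∷ δs) v = weave′-stats K y p δ δs v

weave′-stats K y p zero δs v with weave-stats K y p δs v
... | ep , em = trans (cong suc ep) (sym (+-suc (peaks p) _)) ,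
  trans (cong₂ (λ a b → suc a + (a + b)) ep em) (eq (peaks p) (length δs) (maj p) (ω δs))
  where
  eq : ∀ p n m x → suc (p + n) + (p + n + ((p + n) * (p + n) + m + x)) ≡ (p + suc n) * (p + suc n) + m +
      (suc n * 0 + x)
  eq = solve-∀
weave′-stats K y [] (suc δ) δs v with weave′-stats K y [] δ δs v
... | ep , em = ep , trans (cong₂ _+_ ep em) (eq (length δs) δ (ω δs))
  where
  eq : ∀ n d x → suc n + (suc n * suc n + 0 + (suc n * d + x)) ≡ suc n * suc n + 0 + (suc n * suc d + x)
  eq = solve-∀
weave′-stats K y (l ∷ p) (suc δ) δs v with PlainValid-tail K y l p v
... | y′ , v′ = subst (λ x → WeaveStats (l ∷ p) (suc (length δs)) x (put l p (weave′ p δ δs)))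
    (eq (length δs) δ (ω δs))
  (put-stats K y l p (suc (length δs)) (ω (δ ∷ δs)) (weave′ p δ δs) v
    (λ { q refl → weave-StartsU q (δ ∷ δs) }) (weave′-stats K y′ p δ δs v′))
  where
  eq : ∀ n d x → suc n + (suc n * d + x) ≡ suc n * suc d + x
  eq = solve-∀

-- Gaussian binomials by merging two multisets

add : ℕ → List ℕ → List ℕ
add c []       = []
add c (x ∷ xs) = c + x ∷ xs

-- Read backwards, this merges two multisets: `true` takes the next element of the first list, when
-- it is at most that of the second, and `false` the next element of the second, when it is strictly
-- smaller. Strictness is absorbed into `suc c`, so every word together with every list of
-- differences of its length encodes a pair, without a rule for ties.
unmerge : List ℕ → List Bool → List ℕ × List ℕ
unmerge (c ∷ cs) (true ∷ bs)  = let (xs , ys) = unmerge cs bs in c ∷ xs , add c ys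
unmerge (c ∷ cs) (false ∷ bs) = let (xs , ys) = unmerge cs bs in add (suc c) xs , c ∷ ys
unmerge _        _            = [] , []

inversions : List Bool → ℕ
inversions []          = 0
inversions (true ∷ b)  = inversions b
inversions (false ∷ b) = numTrue b + inversions b

length-add : ∀ c xs → length (add c xs) ≡ length xs
length-add c []      = refl
length-add c (_ ∷ _) = refl

ω-add : ∀ c xs → ω (add c xs) ≡ length xs * c + ω xs
ω-add c []       = refl
ω-add c (x ∷ xs) = eq c x (length xs) (ω xs)
  where
  eq : ∀ c x n w → suc n * (c + x) + w ≡ suc n * c + (suc n * x + w)
  eq = solve-∀

add-injective : ∀ c xs ys → add c xs ≡ add c ys → xs ≡ ys
add-injective c []       []       e = refl
add-injective c (x ∷ xs) (y ∷ ys) e = cong₂ _∷_ (+-cancelˡ-≡ c x y (proj₁ (∷-inj e))) (proj₂ (∷-inj e))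

unmerge-length : ∀ cs bs → length cs ≡ length bs →
  length (proj₁ (unmerge cs bs)) ≡ numTrue bs × length (proj₂ (unmerge cs bs)) ≡ numFalse bs
unmerge-length [] [] e = refl , refl
unmerge-length (c ∷ cs) (true ∷ bs) e with unmerge-length cs bs (suc-injective e)
... | a , b = cong suc a , trans (length-add c (proj₂ (unmerge cs bs))) b
unmerge-length (c ∷ cs) (false ∷ bs) e with unmerge-length cs bs (suc-injective e)
... | a , b = trans (length-add (suc c) (proj₁ (unmerge cs bs))) a , cong suc b

numTrue+numFalse : ∀ bs → numTrue bs + numFalse bs ≡ length bs
numTrue+numFalse []           = refl
numTrue+numFalse (true ∷ bs)  = cong suc (numTrue+numFalse bs)
numTrue+numFalse (false ∷ bs) = trans (+-suc _ _) (cong suc (numTrue+numFalse bs))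

-- The extra one in `suc c` is carried by every element of the first list still to come, that is by
-- every `true` after the given `false`; together these are the inversions.
unmerge-ω : ∀ cs bs → length cs ≡ length bs →
  ω (proj₁ (unmerge cs bs)) + ω (proj₂ (unmerge cs bs)) ≡ ω cs + inversions bs
unmerge-ω [] [] e = refl
unmerge-ω (c ∷ cs) (true ∷ bs) e
  rewrite ω-add c (proj₂ (unmerge cs bs)) | proj₁ (unmerge-length cs bs (suc-injective e))
        | proj₂ (unmerge-length cs bs (suc-injective e)) =
  trans (eq (numTrue bs) (numFalse bs) c _ _) (trans (cong₂ (λ n w → suc n * c + w)
    (trans (numTrue+numFalse bs) (sym (suc-injective e))) (unmerge-ω cs bs (suc-injective e)))
        (sym (+-assoc (suc (length cs) * c) _ _)))
  where
  eq : ∀ x y c a b → suc x * c + a + (y * c + b) ≡ suc (x + y) * c + (a + b)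
  eq = solve-∀
unmerge-ω (c ∷ cs) (false ∷ bs) e
  rewrite ω-add (suc c) (proj₁ (unmerge cs bs)) | proj₁ (unmerge-length cs bs (suc-injective e))
        | proj₂ (unmerge-length cs bs (suc-injective e)) =
  trans (eq (numTrue bs) (numFalse bs) c _ _) (trans (cong₂ (λ n w → suc n * c + (w + numTrue bs))
    (trans (numTrue+numFalse bs) (sym (suc-injective e))) (unmerge-ω cs bs (suc-injective e)))
    (eq′ (suc (length cs) * c) (ω cs) (inversions bs) (numTrue bs)))
  where
  eq : ∀ x y c a b → x * suc c + a + (suc y * c + b) ≡ suc (x + y) * c + (a + b + x)
  eq = solve-∀
  eq′ : ∀ s w i t → s + (w + i + t) ≡ s + w + (t + i)
  eq′ = solve-∀

unmerge-injective : ∀ cs bs cs′ bs′ → length cs ≡ length bs → length cs′ ≡ length bs′ →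
  unmerge cs bs ≡ unmerge cs′ bs′ → cs ≡ cs′ × bs ≡ bs′
unmerge-injective [] [] [] [] _ _ e = refl , refl
unmerge-injective [] [] (_ ∷ _) (true ∷ _) _ _ ()
unmerge-injective [] [] (_ ∷ _) (false ∷ _) _ _ ()
unmerge-injective (_ ∷ _) (true ∷ _) [] [] _ _ ()
unmerge-injective (_ ∷ _) (false ∷ _) [] [] _ _ ()
unmerge-injective (c ∷ cs) (true ∷ bs) (c′ ∷ cs′) (true ∷ bs′) l l′ e with ∷-inj (cong proj₁ e)
... | refl , ex with unmerge-injective cs bs cs′ bs′ (suc-injective l) (suc-injective l′)
                       (cong₂ _,_ ex (add-injective c _ _ (cong proj₂ e)))
... | refl , refl = refl , refl
unmerge-injective (c ∷ cs) (false ∷ bs) (c′ ∷ cs′) (false ∷ bs′) l l′ e with ∷-inj (cong proj₂ e)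
... | refl , ey with unmerge-injective cs bs cs′ bs′ (suc-injective l) (suc-injective l′)
                       (cong₂ _,_ (add-injective (suc c) _ _ (cong proj₁ e)) ey)
... | refl , refl = refl , refl
unmerge-injective (c ∷ cs) (true ∷ bs) (c′ ∷ cs′) (false ∷ bs′) l l′ e =
    ⊥-elim (clash c c′ _ _ _ _ (cong proj₁ e) (cong proj₂ e))
  where
  clash : ∀ c c′ xs ys xs′ ys′ → c ∷ xs ≡ add (suc c′) xs′ → add c ys ≡ c′ ∷ ys′ → ⊥
  clash c c′ xs (y ∷ ys) (x′ ∷ xs′) ys′ refl e₂ =
      <-irrefl (sym (proj₁ (∷-inj e₂))) (s≤s (≤-trans (m≤m+n c′ x′) (m≤m+n (c′ + x′) y)))
unmerge-injective (c ∷ cs) (false ∷ bs) (c′ ∷ cs′) (true ∷ bs′) l l′ e =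
    ⊥-elim (clash c c′ _ _ _ _ (cong proj₁ e) (cong proj₂ e))
  where
  clash : ∀ c c′ xs ys xs′ ys′ → add (suc c) xs ≡ c′ ∷ xs′ → c ∷ ys ≡ add c′ ys′ → ⊥
  clash c c′ (x ∷ xs) ys xs′ (y′ ∷ ys′) e₁ refl =
      <-irrefl (sym (proj₁ (∷-inj e₁))) (s≤s (≤-trans (m≤m+n c′ y′) (m≤m+n (c′ + y′) x)))

unmerge-surj : ∀ fuel xs ys → length xs + length ys ≤ fuel →
  Σ[ cs ∈ List ℕ ] Σ[ bs ∈ List Bool ] (length cs ≡ length bs × unmerge cs bs ≡ (xs , ys))
unmerge-surj fuel [] [] le = [] , [] , refl , refl
unmerge-surj (suc fuel) (x ∷ xs) [] (s≤s le) with unmerge-surj fuel xs [] le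
... | cs , bs , l , e = x ∷ cs , true ∷ bs , cong suc l ,
    cong₂ _,_ (cong (x ∷_) (cong proj₁ e)) (cong (add x) (cong proj₂ e))
unmerge-surj (suc fuel) [] (y ∷ ys) (s≤s le) with unmerge-surj fuel [] ys le
... | cs , bs , l , e = y ∷ cs , false ∷ bs , cong suc l ,
    cong₂ _,_ (cong (add (suc y)) (cong proj₁ e)) (cong (y ∷_) (cong proj₂ e))
unmerge-surj (suc fuel) (x ∷ xs) (y ∷ ys) (s≤s le) with x ≤? y
... | yes x≤y with unmerge-surj fuel xs (y ∸ x ∷ ys) le
...   | cs , bs , l , e = x ∷ cs , true ∷ bs , cong suc l ,
        cong₂ _,_ (cong (x ∷_) (cong proj₁ e))
            (trans (cong (add x) (cong proj₂ e)) (cong (_∷ ys) (m+[n∸m]≡n x≤y)))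
unmerge-surj (suc fuel) (x ∷ xs) (y ∷ ys) (s≤s le) | no x≰y
  with unmerge-surj fuel (x ∸ suc y ∷ xs) ys (≤-trans (≤-reflexive (sym (+-suc (length xs) (length ys)))) le)
...   | cs , bs , l , e = y ∷ cs , false ∷ bs , cong suc l ,
        cong₂ _,_ (trans (cong (add (suc y)) (cong proj₁ e)) (cong (_∷ xs) (m+[n∸m]≡n (≰⇒> x≰y))))
            (cong (y ∷_) (cong proj₂ e))

-- Iterated deletion of peaks and its code

-- One lattice word for each block after the generalized one; in the list of blocks, true stands for a rectangle.
Chain : List Bool → ℕ → List (List Bool) → Set
Chain []       N []       = ⊤
Chain (_ ∷ rs) N (b ∷ ws) = length b ≡ N × Chain rs (numFalse b) ws
Chain _        N _        = ⊥

Chain-irr : ∀ rs N → Irr (Chain rs N)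
Chain-irr []       N []       _ _ = refl
Chain-irr (_ ∷ rs) N (b ∷ ws)     = ×-irr ≡-irrelevant (Chain-irr rs _ ws)

-- Let M be `numFalse b`. For paths, the square of M is lost on deleting the next layer of peaks,
-- and `bit r * numFalse b` is the price of a leading `D`. For partitions they are the Durfee square
-- and the additional row of a rectangle.
chainCost : List Bool → List (List Bool) → ℕ
chainCost (r ∷ rs) (b ∷ ws) = inversions b + numFalse b * numFalse b + (bit r * numFalse b + chainCost rs ws)
chainCost _        _        = 0

prefix : Bool → List Letter → List Letter
prefix false p = p
prefix true  p = D ∷ p

-- Of the `length cs` peaks, those marked `false` in `b` arise by raising the peaks of the smaller
-- path, whose own differences are `ys`; the others are inserted according to `xs`.
plain : List Bool → List ℕ → List (List Bool) → List Letter
plain (r ∷ rs) cs (b ∷ ws) = let (xs , ys) = unmerge cs b in weave (prefix r (plain rs ys ws)) xs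
plain _        cs _        = weave [] cs

numTrue-∷ : ∀ r rs → numTrue (r ∷ rs) ≡ bit r + numTrue rs
numTrue-∷ false rs = refl
numTrue-∷ true  rs = refl

numTrue≤length : ∀ rs → numTrue rs ≤ length rs
numTrue≤length rs = ≤-trans (m≤m+n _ _) (≤-reflexive (numTrue+numFalse rs))

prefix-Valid : ∀ K y r p → PlainValid K y p → PlainValid K (bit r + y) (prefix r p)
prefix-Valid K y false p v = v
prefix-Valid K y true  p v = v

prefix-stats : ∀ r p → peaks (prefix r p) ≡ peaks p × maj (prefix r p) ≡ bit r * peaks p + maj p
prefix-stats false p = refl , refl
prefix-stats true  p = refl , cong (_+ maj p) (sym +0)

prefix-injective : ∀ r p p′ → prefix r p ≡ prefix r p′ → p ≡ p′
prefix-injective false p p′ e = e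
prefix-injective true  p p′ e = proj₂ (∷-inj e)

module _ (r : Bool) (rs : List Bool) (cs : List ℕ) (b : List Bool) (ws : List (List Bool))
         (l : length b ≡ length cs) (c : Chain rs (numFalse b) ws) where

  private
    ys : List ℕ
    ys = proj₂ (unmerge cs b)

  Chain-ys : Chain rs (length ys) ws
  Chain-ys = subst (λ n → Chain rs n ws) (sym (proj₂ (unmerge-length cs b (sym l)))) c

  prefix-plain-Valid : PlainValid (suc (length rs)) (numTrue rs) (plain rs ys ws) →
    PlainValid (suc (length rs)) (numTrue (r ∷ rs)) (prefix r (plain rs ys ws))
  prefix-plain-Valid v = subst (λ y →
      PlainValid (suc (length rs)) y (prefix r (plain rs ys ws))) (sym (numTrue-∷ r rs))
    (prefix-Valid (suc (length rs)) (numTrue rs) r (plain rs ys ws) v)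

plain-Valid : ∀ rs cs ws → Chain rs (length cs) ws → PlainValid (suc (length rs)) (numTrue rs) (plain rs cs ws)
plain-Valid [] cs [] c = weave-Valid 0 0 [] cs z≤n (refl , tt)
plain-Valid (r ∷ rs) cs (b ∷ ws) (l , c) =
  weave-Valid (suc (length rs)) (numTrue (r ∷ rs)) (prefix r (plain rs ys′ ws)) (proj₁ (unmerge cs b))
      (numTrue≤length (r ∷ rs))
    (prefix-plain-Valid r rs cs b ws l c (plain-Valid rs ys′ ws (Chain-ys r rs cs b ws l c)))
  where
  ys′ : List ℕ
  ys′ = proj₂ (unmerge cs b)

plain-stats : ∀ rs cs ws → Chain rs (length cs) ws → let N = length cs in
  peaks (plain rs cs ws) ≡ N × maj (plain rs cs ws) ≡ N * N + (ω cs + chainCost rs ws)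
plain-stats [] cs [] c with weave-stats 0 0 [] cs (refl , tt)
... | ep , em = ep , trans em (eq (length cs * length cs) (ω cs))
  where
  eq : ∀ n x → n + 0 + x ≡ n + (x + 0)
  eq = solve-∀
plain-stats (r ∷ rs) cs (b ∷ ws) (l , c)
  with plain-stats rs (proj₂ (unmerge cs b)) ws (Chain-ys r rs cs b ws l c)
     | weave-stats _ _ (prefix r (plain rs (proj₂ (unmerge cs b)) ws)) (proj₁ (unmerge cs b))
         (prefix-plain-Valid r rs cs b ws l c (plain-Valid rs _ ws (Chain-ys r rs cs b ws l c)))
     | prefix-stats r (plain rs (proj₂ (unmerge cs b)) ws)
     | unmerge-length cs b (sym l)
... | ep , em | wp , wm | pp , pm | lx , ly = trans wp eN , trans wm (trans
      (cong₂ (λ n m → n * n + m + ω X) eN (trans pm (trans (cong₂ (λ n m → bit r * n + m) (trans ep ly) em)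
        (cong (λ m → bit r * M + (m * m + (ω Y + chainCost rs ws))) ly))))
      (trans (eq (length cs * length cs) (bit r * M) (M * M) (ω Y) (chainCost rs ws) (ω X))
        (trans (cong (λ w → length cs * length cs + (w + (M * M + (bit r * M + chainCost rs ws))))
            (unmerge-ω cs b (sym l)))
          (eq′ (length cs * length cs) (ω cs) (inversions b) (M * M) (bit r * M + chainCost rs ws)))))
  where
  X Y : List ℕ
  X = proj₁ (unmerge cs b)
  Y = proj₂ (unmerge cs b)
  M : ℕ
  M = numFalse b
  eN : peaks (prefix r (plain rs Y ws)) + length X ≡ length cs
  eN = trans (cong₂ _+_ (trans pp (trans ep ly)) lx) (trans (+-comm M _) (trans (numTrue+numFalse b) l))
  eq : ∀ n f m a c x → n + (f + (m + (a + c))) + x ≡ n + (x + a + (m + (f + c)))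
  eq = solve-∀
  eq′ : ∀ n w i m c → n + (w + i + (m + c)) ≡ n + (w + (i + m + c))
  eq′ = solve-∀

weave-injective : ∀ K y p δs p′ δs′ → PlainValid K y p → PlainValid K y p′ → weave p δs ≡ weave p′ δs′ →
    p ≡ p′ × δs ≡ δs′
weave-injective K y p δs p′ δs′ v v′ e = cong proj₁ eq , cong proj₂ eq
  where
  eq : (p , δs) ≡ (p′ , δs′)
  eq = trans (sym (unweave-weave K y p δs v)) (trans (cong unweave e) (unweave-weave K y p′ δs′ v′))

plain-injective : ∀ rs cs ws cs′ ws′ → Chain rs (length cs) ws → Chain rs (length cs′) ws′ →
  plain rs cs ws ≡ plain rs cs′ ws′ → cs ≡ cs′ × ws ≡ ws′
plain-injective [] cs [] cs′ [] c c′ e = proj₂ (weave-injective 0 0 [] cs [] cs′ (refl , tt) (refl , tt) e) ,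
    refl
plain-injective (r ∷ rs) cs (b ∷ ws) cs′ (b′ ∷ ws′) (l , c) (l′ , c′) e
  with Chain-ys r rs cs b ws l c | Chain-ys r rs cs′ b′ ws′ l′ c′
... | d | d′ with weave-injective _ _ _ (proj₁ (unmerge cs b)) _ (proj₁ (unmerge cs′ b′))
                    (prefix-plain-Valid r rs cs b ws l c (plain-Valid rs _ ws d))
                    (prefix-plain-Valid r rs cs′ b′ ws′ l′ c′ (plain-Valid rs _ ws′ d′)) e
... | ep , ex with plain-injective rs (proj₂ (unmerge cs b)) ws (proj₂ (unmerge cs′ b′)) ws′ d d′
    (prefix-injective r _ _ ep)
... | ey , refl with unmerge-injective cs b cs′ b′ (sym l) (sym l′) (cong₂ _,_ ex ey)
... | refl , refl = refl , refl

-- A path starting at the maximal height has to descend, hence rectangles may only be followed by rectangles.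
SquaresFirst : List Bool → Set
SquaresFirst []       = ⊤
SquaresFirst (r ∷ rs) = (r ≡ true → numTrue rs ≡ length rs) × SquaresFirst rs

prefix-surj : ∀ n y r w → (r ≡ true → y ≡ n) → Valid (suc n) (bit r + y) w → Plain w →
  Σ[ p ∈ List Letter ] (PlainValid (suc n) y p × prefix r p ≡ w)
prefix-surj n y false w       f v       pl = w , (v , pl) , refl
prefix-surj n y true  (D ∷ w) f v       pl = w , (v , pl) , refl
prefix-surj n y true  (U ∷ w) f (h , _) pl = ⊥-elim (<-irrefl (cong suc (f refl)) h)

plain-surj : ∀ rs w → SquaresFirst rs → PlainValid (suc (length rs)) (numTrue rs) w →
  Σ[ cs ∈ List ℕ ] Σ[ ws ∈ List (List Bool) ] (Chain rs (length cs) ws × plain rs cs ws ≡ w)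
plain-surj [] w f v with weave-surj 0 0 w z≤n v
... | [] , δs , _ , e = δs , [] , tt , e
... | H ∷ p , δs , ((n , v′) , pl) , e = ⊥-elim (noWord p n v′ pl)
  where
  noWord : ∀ p → NonEmpty p → Valid 0 0 p → Plain p → ⊥
  noWord (H ∷ p) _ (n , v) pl = noWord p n v pl
plain-surj (r ∷ rs) w (f , fs) v with weave-surj (suc (length rs)) (numTrue (r ∷ rs)) w
    (numTrue≤length (r ∷ rs)) v
... | p , xs , (v′ , pl) , e with prefix-surj (length rs) (numTrue rs) r p f
    (subst (λ y → Valid (suc (length rs)) y p) (numTrue-∷ r rs) v′) pl
... | p′ , v″ , refl with plain-surj rs p′ fs v″
... | ys , ws , c , refl with unmerge-surj (length xs + length ys) xs ys ≤-refl
... | cs , b , l , e′ = cs , b ∷ ws ,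
    (sym l , subst (λ n → Chain rs n ws)
        (trans (sym (cong (λ z → length (proj₂ z)) e′)) (proj₂ (unmerge-length cs b l))) c) ,
    trans (cong (λ z → weave (prefix r (plain rs (proj₂ z) ws)) (proj₁ z)) e′) e

RawCode : Set
RawCode = List ℕ × List Bool × List (List Bool)

-- The saving `trueCost bs` stands on the side of `n`, so that the weight equation involves no
-- subtraction.
Code : (r : Bool) (rs : List Bool) (n j : ℕ) → RawCode → Set
Code r rs n j (cs , bs , ws) = let N = length cs in
  N ≡ length bs × Chain rs N ws × trueCost bs + n ≡ N * N + bit r * N + (ω cs + chainCost rs ws) ×
      numTrue bs ≡ j

Code-irr : ∀ r rs n j → Irr (Code r rs n j)
Code-irr r rs n j (cs , bs , ws) =
    ×-irr ≡-irrelevant (×-irr (Chain-irr rs _ ws) (×-irr ≡-irrelevant ≡-irrelevant))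

mark-injective : ∀ K y p bs p′ bs′ → PlainValid K y p → PlainValid K y p′ → length bs ≡ peaks p →
    length bs′ ≡ peaks p′ →
  mark p bs ≡ mark p′ bs′ → p ≡ p′ × bs ≡ bs′
mark-injective K y p bs p′ bs′ v v′ l l′ e = cong proj₁ eq , cong proj₂ eq
  where
  eq : (p , bs) ≡ (p′ , bs′)
  eq = trans (sym (unmark-mark K y p bs v l)) (trans (cong unmark e) (unmark-mark K y p′ bs′ v′ l′))

module _ (r : Bool) (rs : List Bool) where

  private
    K y : ℕ
    K = suc (length rs)
    y = bit r + numTrue rs

  top-word : List ℕ → List (List Bool) → List Letter
  top-word cs ws = prefix r (plain rs cs ws)

  word : RawCode → List Letter
  word (cs , bs , ws) = mark (top-word cs ws) bs

  top-Valid : ∀ cs ws → Chain rs (length cs) ws → PlainValid K y (top-word cs ws)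
  top-Valid cs ws c = prefix-Valid K (numTrue rs) r (plain rs cs ws) (plain-Valid rs cs ws c)

  top-peaks : ∀ cs ws → Chain rs (length cs) ws → peaks (top-word cs ws) ≡ length cs
  top-peaks cs ws c = trans (proj₁ (prefix-stats r (plain rs cs ws))) (proj₁ (plain-stats rs cs ws c))

  top-maj : ∀ cs ws → Chain rs (length cs) ws →
    maj (top-word cs ws) ≡ length cs * length cs + bit r * length cs + (ω cs + chainCost rs ws)
  top-maj cs ws c = trans (proj₂ (prefix-stats r (plain rs cs ws)))
    (trans (cong₂ (λ n m → bit r * n + m) (proj₁ (plain-stats rs cs ws c)) (proj₂ (plain-stats rs cs ws c)))
      (trans (sym (+-assoc (bit r * length cs) _ _))
          (cong (_+ (ω cs + chainCost rs ws)) (+-comm (bit r * length cs) (length cs * length cs)))))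

  Code↔Word : (r ≡ true → numTrue rs ≡ length rs) → SquaresFirst rs → ∀ n j →
    Σ RawCode (Code r rs n j) ↔ Σ (List Letter) (Word K y n j)
  Code↔Word f fs n j = injSurj-↔ (Code-irr r rs n j) (Word-irr K y n j) word to inj from
    where
    len : ∀ cs (bs : List Bool) ws → length cs ≡ length bs → Chain rs (length cs) ws →
        length bs ≡ peaks (top-word cs ws)
    len cs bs ws l c = trans (sym l) (sym (top-peaks cs ws c))
    to : ∀ c → Code r rs n j c → Word K y n j (word c)
    to (cs , bs , ws) (l , c , e , t) = mark-Valid K y p bs v (len cs bs ws l c) ,
      +-cancelˡ-≡ (trueCost bs) _ n (trans (mark-maj K y p bs v (len cs bs ws l c))
          (trans (top-maj cs ws c) (sym e))) ,
      trans (mark-numP K y p bs v (len cs bs ws l c)) t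
      where
      p : List Letter
      p = top-word cs ws
      v : PlainValid K y p
      v = top-Valid cs ws c
    inj : ∀ a b → Code r rs n j a → Code r rs n j b → word a ≡ word b → a ≡ b
    inj (cs , bs , ws) (cs′ , bs′ , ws′) (l , c , _) (l′ , c′ , _) e
      with mark-injective K y (top-word cs ws) bs (top-word cs′ ws′) bs′ (top-Valid cs ws c)
          (top-Valid cs′ ws′ c′)
             (len cs bs ws l c) (len cs′ bs′ ws′ l′ c′) e
    ... | ep , refl with plain-injective rs cs ws cs′ ws′ c c′ (prefix-injective r _ _ ep)
    ... | refl , refl = refl
    from : ∀ w → Word K y n j w → Σ[ c ∈ RawCode ] (Code r rs n j c × word c ≡ w)
    from w (v , m , t) with mark-surj K y w v
    ... | p , bs , (v′ , pl) , l , refl with prefix-surj (length rs) (numTrue rs) r p f v′ pl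
    ... | p′ , v″ , refl with plain-surj rs p′ fs v″
    ... | cs , ws , c , refl = (cs , bs , ws) , (trans (sym (top-peaks cs ws c)) (sym l) , c ,
      trans (cong (trueCost bs +_) (sym m))
          (trans (mark-maj K y (top-word cs ws) bs (top-Valid cs ws c) l) (top-maj cs ws c)) ,
      trans (sym (mark-numP K y (top-word cs ws) bs (top-Valid cs ws c) l)) t) , refl

-- Generalized Durfee dissections

top : List ℕ → ℕ
top []      = 0
top (x ∷ _) = x

Strict Desc : List ℕ → Set
Strict []       = ⊤
Strict (x ∷ xs) = top xs < x × Strict xs
Desc []       = ⊤
Desc (x ∷ xs) = 1 ≤ x × top xs ≤ x × Desc xs

overParts nonParts : List Part → List ℕ
overParts λs = map value (filterB overlined λs)
nonParts  λs = map value (filterB (λ p → not (overlined p)) λs)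

true≢false : true ≢ false
true≢false ()

split-ordered : ∀ xs → T (isOverpartition xs) →
  (Strict (overParts xs) × top (overParts xs) ≤ headValue xs) ×
      (Desc (nonParts xs) × top (nonParts xs) ≤ headValue xs)
split-ordered [] t = (tt , z≤n) , (tt , z≤n)
split-ordered ((a , o) ∷ xs) t with over-∷⁻ (a , o) xs t
split-ordered ((a , true) ∷ xs) t | (p , h , d) , t′ with split-ordered xs t′
... | (so , to) , (du , tu) = ((≤-trans (s≤s to) (≤∧≢⇒< h (λ e → true≢false (d (sym e)))) , so) , ≤-refl) ,
    du , ≤-trans tu h
split-ordered ((a , false) ∷ xs) t | (p , h , d) , t′ with split-ordered xs t′
... | (so , to) , (du , tu) = (so , ≤-trans to h) , (p , ≤-trans tu h , du) , ≤-refl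

split-injective : ∀ xs ys → T (isOverpartition xs) → T (isOverpartition ys) →
  overParts xs ≡ overParts ys → nonParts xs ≡ nonParts ys → xs ≡ ys
split-injective [] [] t t′ e₁ e₂ = refl
split-injective [] ((b , true) ∷ ys) t t′ () e₂
split-injective [] ((b , false) ∷ ys) t t′ e₁ ()
split-injective ((a , true) ∷ xs) [] t t′ () e₂
split-injective ((a , false) ∷ xs) [] t t′ e₁ ()
split-injective ((a , true) ∷ xs) ((b , true) ∷ ys) t t′ e₁ e₂ with ∷-inj e₁
... | refl , e = cong (_ ∷_) (split-injective xs ys (proj₂ (over-∷⁻ _ xs t)) (proj₂ (over-∷⁻ _ ys t′)) e e₂)
split-injective ((a , false) ∷ xs) ((b , false) ∷ ys) t t′ e₁ e₂ with ∷-inj e₂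
... | refl , e = cong (_ ∷_) (split-injective xs ys (proj₂ (over-∷⁻ _ xs t)) (proj₂ (over-∷⁻ _ ys t′)) e₁ e)
split-injective ((a , true) ∷ xs) ((b , false) ∷ ys) t t′ e₁ e₂ =
    ⊥-elim (<-irrefl refl (≤-trans (s≤s b≤) (≤-trans <a a≤)))
  where
  tl = over-∷⁻ (a , true) xs t
  tl′ = over-∷⁻ (b , false) ys t′
  <a : headValue xs < a
  <a = ≤∧≢⇒< (proj₁ (proj₂ (proj₁ tl))) (λ e → true≢false (proj₂ (proj₂ (proj₁ tl)) (sym e)))
  b≤ : b ≤ headValue xs
  b≤ = subst (_≤ headValue xs) (cong top e₂) (proj₂ (proj₂ (split-ordered xs (proj₂ tl))))
  a≤ : a ≤ b
  a≤ = ≤-trans (subst (_≤ headValue ys) (cong top (sym e₁)) (proj₂ (proj₁ (split-ordered ys (proj₂ tl′)))))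
      (proj₁ (proj₂ (proj₁ tl′)))
split-injective ((a , false) ∷ xs) ((b , true) ∷ ys) t t′ e₁ e₂ =
  sym (split-injective ((b , true) ∷ ys) ((a , false) ∷ xs) t′ t (sym e₁) (sym e₂))

interleave : List ℕ → List ℕ → List Part
interleave []      V       = map (_, false) V
interleave (o ∷ O) []      = (o , true) ∷ interleave O []
interleave (o ∷ O) (v ∷ V) =
  -- On equal values the non-overlined part goes first, since only the last occurrence may be
  -- overlined.
  if o ≤ᵇ v then (v , false) ∷ interleave (o ∷ O) V else (o , true) ∷ interleave O (v ∷ V)

overParts-interleave : ∀ O V → overParts (interleave O V) ≡ O
overParts-interleave []      []      = refl
overParts-interleave []      (v ∷ V) = overParts-interleave [] V
overParts-interleave (o ∷ O) []      = cong (o ∷_) (overParts-interleave O [])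
overParts-interleave (o ∷ O) (v ∷ V)
  with o ≤ᵇ v | overParts-interleave (o ∷ O) V | overParts-interleave O (v ∷ V)
... | true  | e | _ = e
... | false | _ | e = cong (o ∷_) e

nonParts-interleave : ∀ O V → nonParts (interleave O V) ≡ V
nonParts-interleave []      []      = refl
nonParts-interleave []      (v ∷ V) = cong (v ∷_) (nonParts-interleave [] V)
nonParts-interleave (o ∷ O) []      = nonParts-interleave O []
nonParts-interleave (o ∷ O) (v ∷ V)
  with o ≤ᵇ v | nonParts-interleave (o ∷ O) V | nonParts-interleave O (v ∷ V)
... | true  | e | _ = cong (v ∷_) e
... | false | _ | e = e

headValue-interleave : ∀ O V h → top O ≤ h → top V ≤ h → headValue (interleave O V) ≤ h
headValue-interleave []      []      h a b = z≤n
headValue-interleave []      (v ∷ V) h a b = b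
headValue-interleave (o ∷ O) []      h a b = a
headValue-interleave (o ∷ O) (v ∷ V) h a b with o ≤ᵇ v
... | true  = b
... | false = a

over-∷-true : ∀ o O V → top O < o → top V < o → T (isOverpartition (interleave O V)) →
  T (isOverpartition ((o , true) ∷ interleave O V))
over-∷-true (suc o) O V (s≤s a) (s≤s b) t =
  over-∷⁺ (suc o , true) (interleave O V) (s≤s z≤n , ≤-trans h (n≤1+n o) , λ e →
      ⊥-elim (<-irrefl (sym e) (s≤s h))) t
  where
  h : headValue (interleave O V) ≤ o
  h = headValue-interleave O V o a b

interleave-over : ∀ O V → Strict O → Desc V → T (isOverpartition (interleave O V))
interleave-over []      []      s       d           = tt
interleave-over []      (v ∷ V) s       (p , h , d) =
  over-∷⁺ (v , false) (interleave [] V) (p , headValue-interleave [] V v z≤n h , λ _ →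
      refl) (interleave-over [] V tt d)
interleave-over (o ∷ O) []      (l , s) d           =
  over-∷-true o O [] l (≤-trans (s≤s z≤n) l) (interleave-over O [] s tt)
interleave-over (o ∷ O) (v ∷ V) (l , s) (p , h , d)
  with o ≤ᵇ v in e | interleave-over (o ∷ O) V (l , s) d | interleave-over O (v ∷ V) s (p , h , d)
... | true  | t | _ = over-∷⁺ (v , false) (interleave (o ∷ O) V)
  (p , headValue-interleave (o ∷ O) V v (≤ᵇ⇒≤ o v (subst T (sym e) tt)) h , λ _ → refl) t
... | false | _ | t = over-∷-true o O (v ∷ V) l (≰⇒> (λ o≤v → subst T e (≤⇒≤ᵇ o≤v))) t

weight-split : ∀ xs → weight xs ≡ sum (overParts xs) + sum (nonParts xs)
weight-split [] = refl
weight-split ((a , true) ∷ xs) = trans (cong (a +_) (weight-split xs)) (sym (+-assoc a _ _))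
weight-split ((a , false) ∷ xs) =
    trans (cong (a +_) (weight-split xs)) (+-swapˡ a (sum (overParts xs)) (sum (nonParts xs)))

numOverlined-split : ∀ xs → numOverlined xs ≡ length (overParts xs)
numOverlined-split [] = refl
numOverlined-split ((a , true) ∷ xs) = cong suc (numOverlined-split xs)
numOverlined-split ((a , false) ∷ xs) = numOverlined-split xs

length-split : ∀ xs → length xs ≡ length (overParts xs) + length (nonParts xs)
length-split [] = refl
length-split ((a , true) ∷ xs) = cong suc (length-split xs)
length-split ((a , false) ∷ xs) = trans (cong suc (length-split xs)) (sym (+-suc _ _))

countNon : ∀ N xs → countB (λ p → not (overlined p) ∧ (N ≤ᵇ value p)) xs ≡ countB (N ≤ᵇ_) (nonParts xs)
countNon N [] = refl
countNon N ((a , true) ∷ xs) = countNon N xs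
countNon N ((a , false) ∷ xs) = cong (_ +_) (countNon N xs)

-- The alternative `M ≡ 0` reflects that 0 is the value returned when no test succeeds.
largestUpTo-unique : ∀ p b M → M ≤ b → (M ≡ 0 ⊎ T (p M)) → (∀ d → M < d → ¬ T (p d)) → largestUpTo p b ≡ M
largestUpTo-unique p zero .zero z≤n ok no-larger = refl
largestUpTo-unique p (suc b) M le ok no-larger with m≤n⇒m<n∨m≡n le
largestUpTo-unique p (suc b) M le ok no-larger | inj₁ (s≤s lt) with p (suc b) | no-larger (suc b) (s≤s lt)
... | true  | ¬t = ⊥-elim (¬t tt)
... | false | _  = largestUpTo-unique p b M lt ok no-larger
largestUpTo-unique p (suc b) .(suc b) le (inj₂ t) no-larger | inj₂ refl with p (suc b)
... | true = refl

countB-++ : ∀ (p : ℕ → Bool) xs ys → countB p (xs ++ ys) ≡ countB p xs + countB p ys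
countB-++ p []       ys = refl
countB-++ p (x ∷ xs) ys = trans (cong (_ +_) (countB-++ p xs ys)) (sym (+-assoc (if p x then 1 else 0) _ _))

countB-≤ : ∀ (p : ℕ → Bool) xs → countB p xs ≤ length xs
countB-≤ p []       = z≤n
countB-≤ p (x ∷ xs) with p x
... | true  = s≤s (countB-≤ p xs)
... | false = ≤-trans (countB-≤ p xs) (n≤1+n _)

count-small : ∀ d xs → Desc xs → top xs < d → countB (d ≤ᵇ_) xs ≡ 0
count-small d [] _ _ = refl
count-small d (x ∷ xs) (_ , h , ds) lt with d ≤ᵇ x in e
... | true  = ⊥-elim (<-irrefl refl (≤-trans lt (≤ᵇ⇒≤ d x (subst T (sym e) tt))))
... | false = count-small d xs ds (≤-trans (s≤s h) lt)

count-all : ∀ d xs → All (d ≤_) xs → countB (d ≤ᵇ_) xs ≡ length xs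
count-all d []       _        = refl
count-all d (x ∷ xs) (h ∷ hs) rewrite Equivalence.to T-≡ (≤⇒≤ᵇ h) = cong suc (count-all d xs hs)

genDurfeeSize-split : ∀ λs V₁ V₂ → nonParts λs ≡ V₁ ++ V₂ →
  let N = length (overParts λs) + length V₁ in
  All (N ≤_) V₁ → top V₂ ≤ N → Desc V₂ → genDurfeeSize λs ≡ N
genDurfeeSize-split λs V₁ V₂ eV all tp ds = largestUpTo-unique _ (length λs) N
  (≤-trans (+-monoʳ-≤ c (≤-trans (m≤m+n (length V₁) (length V₂))
      (≤-reflexive (sym (trans (cong length eV) (length-++ V₁))))))
    (≤-reflexive (sym (length-split λs))))
  (inj₂ (≤⇒≤ᵇ (≤-trans (+-monoʳ-≤ c
      (≤-trans (≤-reflexive (sym (count-all N V₁ all))) (m≤m+n _ (countB (N ≤ᵇ_) V₂))))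
    (≤-reflexive (sym (count N))))))
  (λ d lt t → <-irrefl refl (≤-trans lt (≤-trans (≤ᵇ⇒≤ d _ t) (≤-trans (≤-reflexive (count d)) (+-monoʳ-≤ c
    (≤-trans (≤-reflexive (trans (cong (countB (d ≤ᵇ_) V₁ +_) (count-small d V₂ ds (≤-trans (s≤s tp) lt))) +0))
        (countB-≤ (d ≤ᵇ_) V₁)))))))
  where
  c = length (overParts λs)
  N = c + length V₁
  count : ∀ d → numOverlined λs + countB (λ p →
      not (overlined p) ∧ (d ≤ᵇ value p)) λs ≡ c + (countB (d ≤ᵇ_) V₁ + countB (d ≤ᵇ_) V₂)
  count d = cong₂ _+_ (numOverlined-split λs)
      (trans (countNon d λs) (trans (cong (countB (d ≤ᵇ_)) eV) (countB-++ (d ≤ᵇ_) V₁ V₂)))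

entry-++ : ∀ xs ys m → entry (xs ++ ys) (suc (length xs + m)) ≡ entry ys (suc m)
entry-++ []       ys m = refl
entry-++ (x ∷ xs) ys m = entry-++ xs ys m

entry-++ˡ : ∀ M xs ys m → All (M ≤_) xs → m < length xs → M ≤ entry (xs ++ ys) (suc m)
entry-++ˡ M (x ∷ xs) ys zero    (h ∷ _)  _        = h
entry-++ˡ M (x ∷ xs) ys (suc m) (_ ∷ hs) (s≤s lt) = entry-++ˡ M xs ys m hs lt

entry-≤-top : ∀ xs m → Desc xs → entry xs m ≤ top xs
entry-≤-top []       m             _            = z≤n
entry-≤-top (x ∷ xs) zero          _            = z≤n
entry-≤-top (x ∷ xs) (suc zero)    _            = ≤-refl
entry-≤-top (x ∷ xs) (suc (suc m)) (_ , h , ds) = ≤-trans (entry-≤-top xs (suc m) ds) h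

drop-length-++ : ∀ {A : Set} m (xs ys : List A) → drop (m + length xs) (xs ++ ys) ≡ drop m ys
drop-length-++ m []       ys = cong (λ n → drop n ys) (+-identityʳ m)
drop-length-++ m (x ∷ xs) ys =
    trans (cong (λ n → drop n (x ∷ xs ++ ys)) (+-suc m (length xs))) (drop-length-++ m xs ys)

module _ (V₁ V₂ : List ℕ) (all : All (length V₁ ≤_) V₁) (tp : top V₂ ≤ length V₁) (ds : Desc V₂) where

  private
    M : ℕ
    M = length V₁
    μ : List ℕ
    μ = V₁ ++ V₂

  entry-beyond : ∀ d → M < d → entry μ d ≤ M
  entry-beyond (suc d) (s≤s le) =
      ≤-trans (≤-reflexive (trans (cong (λ n → entry μ (suc n)) (sym (m+[n∸m]≡n le))) (entry-++ V₁ V₂ (d ∸ M))))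
    (≤-trans (entry-≤-top V₂ (suc (d ∸ M)) ds) tp)

  durfeeSize-++ : durfeeSize μ ≡ M
  durfeeSize-++ = largestUpTo-unique _ (length μ) M
      (≤-trans (m≤m+n M (length V₂)) (≤-reflexive (sym (length-++ V₁))))
    (at M refl) (λ d lt t → <-irrefl refl (≤-trans lt (≤-trans (≤ᵇ⇒≤ d _ t) (entry-beyond d lt))))
    where
    at : ∀ m → m ≡ M → m ≡ 0 ⊎ T (m ≤ᵇ entry μ m)
    at zero    e = inj₁ refl
    at (suc m) e = inj₂ (≤⇒≤ᵇ (subst (_≤ entry μ (suc m)) (sym e) (entry-++ˡ M V₁ V₂ m all (≤-reflexive e))))

  durfeeSquareRem-++ : durfeeSquareRem μ ≡ V₂
  durfeeSquareRem-++ = trans (cong (λ n → drop n μ) durfeeSize-++) (drop-length-++ 0 V₁ V₂)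

search : List ℕ → ℕ → ℕ → Maybe (List ℕ)
search μ d zero       = nothing
search μ d (suc fuel) = if entry μ (suc d) ≡ᵇ d then just (drop (suc d) μ) else search μ (suc d) fuel

-- The two recursion equations determine the function, so they can stand in for a definition that is
-- out of reach.
search-unique : ∀ μ (f : ℕ → ℕ → Maybe (List ℕ)) → (∀ d → f d 0 ≡ nothing) →
  (∀ d n → f d (suc n) ≡ (if entry μ (suc d) ≡ᵇ d then just (drop (suc d) μ) else f (suc d) n)) →
  ∀ d n → f d n ≡ search μ d n
search-unique μ f e₀ e d zero = e₀ d
search-unique μ f e₀ e d (suc n) with entry μ (suc d) ≡ᵇ d | e d n
... | true  | eq = eq
... | false | eq = trans eq (search-unique μ f e₀ e (suc d) n)

-- The search inside durfeeRectRem is local to its definition; unification recovers it as rectSearch.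
mutual
  rectSearch : List ℕ → ℕ → ℕ → Maybe (List ℕ)
  rectSearch = _

  rectSearch≡search : ∀ μ d n → rectSearch μ d n ≡ search μ d n
  rectSearch≡search μ = search-unique μ (rectSearch μ) (λ _ → refl) (λ _ _ → refl)

  durfeeRectRem≡search : ∀ μ → durfeeRectRem μ ≡ search μ 0 (suc (length μ))
  durfeeRectRem≡search μ with entry μ 1 ≡ᵇ 0
  ... | true = refl
  -- With both arguments generalized to variables, the goal is an equation between functions of
  -- them, and this is what determines `rectSearch`.
  ... | false with length μ | 1
  ...   | n | d = rectSearch≡search μ d n

≢⇒≡ᵇ-false : ∀ m n → m ≢ n → (m ≡ᵇ n) ≡ false
≢⇒≡ᵇ-false m n ne with m ≡ᵇ n in e
... | true  = ⊥-elim (ne (≡ᵇ⇒≡ m n (subst T (sym e) tt)))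
... | false = refl

module _ (V₁ V₂ : List ℕ) (all : All (length V₁ ≤_) V₁) (tp : top V₂ ≤ length V₁) (ds : Desc V₂) where

  private
    M : ℕ
    M = length V₁
    μ : List ℕ
    μ = V₁ ++ V₂

  search-beyond : ∀ d n → M < d → search μ d n ≡ nothing
  search-beyond d zero    lt = refl
  search-beyond d (suc n) lt
    rewrite ≢⇒≡ᵇ-false (entry μ (suc d)) d
      (λ e → <-irrefl e (≤-trans (s≤s (entry-beyond V₁ V₂ all tp ds (suc d) (≤-trans lt (n≤1+n d)))) lt)) =
    search-beyond (suc d) n (≤-trans lt (n≤1+n d))

  private
    miss : ∀ d → d < M → (entry μ (suc d) ≡ᵇ d) ≡ false
    miss d d<M = ≢⇒≡ᵇ-false (entry μ (suc d)) d (λ e →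
        <-irrefl (sym e) (≤-trans d<M (entry-++ˡ M V₁ V₂ d all d<M)))

  -- Up to row M the entries are at least M and hence exceed every smaller `d`; later entries are at
  -- most M and hence below every larger `d`. So the search can succeed at M only.
  search-from : ∀ d m n → m + d ≡ M →
      search μ d (suc (m + n)) ≡ (if entry V₂ 1 ≡ᵇ M then just (drop 1 V₂) else nothing)
  search-from d zero n refl
    rewrite trans (cong (λ x → entry μ (suc x)) (sym (+-identityʳ M)))
        (entry-++ V₁ V₂ 0) | drop-length-++ 1 V₁ V₂ with entry V₂ 1 ≡ᵇ M
  ... | true  = refl
  ... | false = search-beyond (suc M) n ≤-refl
  search-from d (suc m) n e rewrite miss d (≤-trans (s≤s (m≤n+m d m)) (≤-reflexive e)) =
    search-from (suc d) m n (trans (+-suc m d) e)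

  durfeeRectRem-++ : durfeeRectRem μ ≡ (if entry V₂ 1 ≡ᵇ M then just (drop 1 V₂) else nothing)
  durfeeRectRem-++ = trans (durfeeRectRem≡search μ)
      (trans (cong (λ n → search μ 0 (suc n)) (length-++ V₁)) (search-from 0 M (length V₂) (+-identityʳ M)))

-- Durfee blocks and lattice words

-- Cuts off the Durfee square when c rows of it are already present.
durfeeCut : ∀ c V → Desc V → Σ[ V₁ ∈ List ℕ ] Σ[ V₂ ∈ List ℕ ]
  (V ≡ V₁ ++ V₂ × All (c + length V₁ ≤_) V₁ × top V₂ ≤ c + length V₁ × Desc V₂)
durfeeCut c [] d = [] , [] , refl , [] , z≤n , tt
durfeeCut c (x ∷ V) (p , h , d) with suc c ≤? x
... | no  c≮x = [] , x ∷ V , refl , [] , ≤-trans (s≤s⁻¹ (≰⇒> c≮x)) (≤-reflexive (sym +0)) , (p , h , d)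
... | yes c<x with durfeeCut (suc c) V d
...   | V₁ , V₂ , refl , a , t , d′ = x ∷ V₁ , V₂ , refl ,
        subst (λ m → All (m ≤_) (x ∷ V₁)) (sym (+-suc c (length V₁))) (first V₁ a h ∷ a) ,
        subst (top V₂ ≤_) (sym (+-suc c (length V₁))) t , d′
  where
  first : ∀ V₁ → All (suc c + length V₁ ≤_) V₁ → top (V₁ ++ V₂) ≤ x → suc c + length V₁ ≤ x
  first []       _       _ = ≤-trans (≤-reflexive +0) c<x
  first (v ∷ V₁) (b ∷ _) h = ≤-trans b h

-- A square, widened to the right by the partition whose boundary is the lattice word: each `false`
-- is a row, and the `true` letters after it are its cells beyond the square. Leading `true` letters
-- show in no row, so the word is recovered only when its length is known.
rows : ℕ → List Bool → List ℕ
rows M []          = []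
rows M (false ∷ b) = M + numTrue b ∷ rows M b
rows M (true ∷ b)  = rows M b

rows-length : ∀ M b → length (rows M b) ≡ numFalse b
rows-length M []          = refl
rows-length M (false ∷ b) = cong suc (rows-length M b)
rows-length M (true ∷ b)  = rows-length M b

rows-≥ : ∀ M b → All (M ≤_) (rows M b)
rows-≥ M []          = []
rows-≥ M (false ∷ b) = m≤m+n M _ ∷ rows-≥ M b
rows-≥ M (true ∷ b)  = rows-≥ M b

rows-sum : ∀ M b → sum (rows M b) ≡ inversions b + numFalse b * M
rows-sum M []          = refl
rows-sum M (false ∷ b) = trans (cong (M + numTrue b +_) (rows-sum M b))
    (eq M (numTrue b) (inversions b) (numFalse b * M))
  where
  eq : ∀ m t i x → m + t + (i + x) ≡ t + i + (m + x)
  eq = solve-∀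
rows-sum M (true ∷ b)  = rows-sum M b

rows-Desc : ∀ M b r → numFalse b ≤ M → top r ≤ M → Desc r → Desc (rows M b ++ r) ×
    top (rows M b ++ r) ≤ M + numTrue b
rows-Desc M [] r h t d = d , ≤-trans t (m≤m+n M 0)
rows-Desc M (false ∷ b) r h t d with rows-Desc M b r (≤-trans (n≤1+n _) h) t d
... | d′ , t′ = (≤-trans (≤-trans (s≤s z≤n) h) (m≤m+n M _) , t′ , d′) , ≤-refl
rows-Desc M (true ∷ b) r h t d with rows-Desc M b r h t d
... | d′ , t′ = d′ , ≤-trans t′ (+-monoʳ-≤ M (n≤1+n _))

top-rows : ∀ M b → top (rows M b) ≤ M + numTrue b
top-rows M []          = z≤n
top-rows M (false ∷ b) = ≤-refl
top-rows M (true ∷ b)  = ≤-trans (top-rows M b) (+-monoʳ-≤ M (n≤1+n _))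

rows-injective : ∀ M b b′ → length b ≡ length b′ → numFalse b ≡ numFalse b′ → rows M b ≡ rows M b′ → b ≡ b′
rows-injective M [] [] l f e = refl
rows-injective M (true ∷ b) (true ∷ b′) l f e = cong (true ∷_) (rows-injective M b b′ (suc-injective l) f e)
rows-injective M (false ∷ b) (false ∷ b′) l f e =
    cong (false ∷_) (rows-injective M b b′ (suc-injective l) (suc-injective f) (proj₂ (∷-inj e)))
rows-injective M (true ∷ b) (false ∷ b′) l f e = ⊥-elim (clash b b′ (suc-injective l) f e)
  where
  clash : ∀ b b′ → length b ≡ length b′ → numFalse b ≡ suc (numFalse b′) →
      rows M b ≡ M + numTrue b′ ∷ rows M b′ → ⊥
  clash b b′ l f e = <-irrefl refl
      (≤-trans (+-monoʳ-< M lt) (≤-trans (≤-reflexive (sym (cong top e))) (top-rows M b)))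
    where
    lt : numTrue b < numTrue b′
    lt = ≤-reflexive (+-cancelʳ-≡ (numFalse b′) _ _ (trans (sym (+-suc (numTrue b) (numFalse b′)))
      (trans (cong (numTrue b +_) (sym f)) (trans (numTrue+numFalse b) (trans l (sym (numTrue+numFalse b′)))))))
rows-injective M (false ∷ b) (true ∷ b′) l f e =
    sym (rows-injective M (true ∷ b′) (false ∷ b) (sym l) (sym f) (sym e))

rows-trues : ∀ M n b → let b′ = replicate n true ++ b in
  rows M b′ ≡ rows M b × numTrue b′ ≡ n + numTrue b × numFalse b′ ≡ numFalse b
rows-trues M zero    b = refl , refl , refl
rows-trues M (suc n) b with rows-trues M n b
... | r , t , f = r , cong suc t , f

top-++ : ∀ xs ys → top xs ≤ top (xs ++ ys)
top-++ []      ys = z≤n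
top-++ (x ∷ _) ys = ≤-refl

rows-surj : ∀ M L V r → All (M ≤_) V → Desc (V ++ r) → top V ≤ M + L →
  Σ[ b ∈ List Bool ] (rows M b ≡ V × numTrue b ≡ L × numFalse b ≡ length V)
rows-surj M L [] r a d t with rows-trues M L []
... | e , et , ef = replicate L true ++ [] , e , trans et +0 , ef
rows-surj M L (x ∷ V) r (h ∷ a) (_ , h′ , d) t
  with rows-surj M (x ∸ M) V r a d (≤-trans (top-++ V r) (≤-trans h′ (≤-reflexive (sym (m+[n∸m]≡n h)))))
... | b , e , et , ef with rows-trues M (L ∸ (x ∸ M)) (false ∷ b)
-- The leading `true` letters fill up the width from that of the longest row, x - M, to the width L
-- of the box.
... | e′ , et′ , ef′ = replicate (L ∸ (x ∸ M)) true ++ false ∷ b ,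
    trans e′ (cong₂ _∷_ (trans (cong (M +_) et) (m+[n∸m]≡n h)) e) ,
    trans et′ (trans (cong (L ∸ (x ∸ M) +_) et) (m∸n+n≡m (m≤n+o⇒m∸n≤o x M t))) ,
    trans ef′ (cong suc ef)

infixr 5 _◂_
-- A row of length 0 is not written in a partition, so a rectangle of size 0 has no visible
-- additional row.
_◂_ : ℕ → List ℕ → List ℕ
zero  ◂ μ = μ
suc m ◂ μ = suc m ∷ μ

◂-Desc : ∀ M μ → Desc μ → top μ ≤ M → Desc (M ◂ μ) × top (M ◂ μ) ≤ M
◂-Desc zero    μ d t = d , t
◂-Desc (suc M) μ d t = (s≤s z≤n , t , d) , ≤-refl

◂-sum : ∀ M μ → sum (M ◂ μ) ≡ M + sum μ
◂-sum zero    μ = refl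
◂-sum (suc M) μ = refl

Desc-≤0 : ∀ μ → Desc μ → top μ ≤ 0 → μ ≡ []
Desc-≤0 []      d       t = refl
Desc-≤0 (x ∷ μ) (p , _) t = ⊥-elim (<-irrefl refl (≤-trans p t))

-- For M = 0 the remainder is empty, and the values agree because `entry` is 0 beyond the end of a
-- list.
◂-entry : ∀ M μ → Desc μ → top μ ≤ M → entry (M ◂ μ) 1 ≡ M × drop 1 (M ◂ μ) ≡ μ
◂-entry zero    μ d t rewrite Desc-≤0 μ d t = refl , refl
◂-entry (suc M) μ d t = refl , refl

◂-injective : ∀ M μ ν → M ◂ μ ≡ M ◂ ν → μ ≡ ν
◂-injective zero    μ ν e = e
◂-injective (suc M) μ ν e = proj₂ (∷-inj e)

◂-surj : ∀ M V → Desc V → top V ≤ M → entry V 1 ≡ M →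
    Σ[ μ ∈ List ℕ ] (V ≡ M ◂ μ × drop 1 V ≡ μ × Desc μ × top μ ≤ M)
◂-surj M []          d           t refl = [] , refl , refl , tt , z≤n
◂-surj M (suc x ∷ V) (p , h , d) t refl = V , refl , refl , d , h

withRect : Bool → ℕ → List ℕ → List ℕ
withRect false N μ = μ
withRect true  N μ = N ◂ μ

withRect-Desc : ∀ r N μ → Desc μ → top μ ≤ N → Desc (withRect r N μ) × top (withRect r N μ) ≤ N
withRect-Desc false N μ d t = d , t
withRect-Desc true  N μ d t = ◂-Desc N μ d t

withRect-sum : ∀ r N μ → sum (withRect r N μ) ≡ bit r * N + sum μ
withRect-sum false N μ = refl
withRect-sum true  N μ = trans (◂-sum N μ) (cong (_+ sum μ) (sym (+0 {N})))

withRect-injective : ∀ r N μ ν → withRect r N μ ≡ withRect r N ν → μ ≡ ν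
withRect-injective false N μ ν e = e
withRect-injective true  N μ ν e = ◂-injective N μ ν e

withRect-surj : ∀ r M V → Desc V → top V ≤ M → (r ≡ true → entry V 1 ≡ M) →
  Σ[ μ ∈ List ℕ ] (V ≡ withRect r M μ × Desc μ × top μ ≤ M)
withRect-surj false M V d t e = V , refl , d , t
withRect-surj true  M V d t e with ◂-surj M V d t (e refl)
... | μ , eV , _ , d′ , t′ = μ , eV , d′ , t′

dissected : List Bool → List (List Bool) → List ℕ
dissected (r ∷ rs) (b ∷ ws) = rows (numFalse b) b ++ withRect r (numFalse b) (dissected rs ws)
dissected _        _        = []

dissected-Desc : ∀ rs N ws → Chain rs N ws → Desc (dissected rs ws) × top (dissected rs ws) ≤ N
withRect-dissected-Desc : ∀ r rs N ws → Chain rs N ws → let V = withRect r N (dissected rs ws) in Desc V × top V ≤ N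

dissected-Desc [] N [] c = tt , z≤n
dissected-Desc (r ∷ rs) N (b ∷ ws) (l , c) with withRect-dissected-Desc r rs (numFalse b) ws c
... | d , h with rows-Desc (numFalse b) b _ ≤-refl h d
... | d′ , h′ = d′ , ≤-trans h′ (≤-reflexive (trans (+-comm (numFalse b) _) (trans (numTrue+numFalse b) l)))

withRect-dissected-Desc r rs N ws c = let (d , h) = dissected-Desc rs N ws c in withRect-Desc r N (dissected rs ws) d h

dissected-sum : ∀ rs N ws → Chain rs N ws → sum (dissected rs ws) ≡ chainCost rs ws
dissected-sum [] N [] c = refl
dissected-sum (r ∷ rs) N (b ∷ ws) (l , c) = trans (sum-++ (rows (numFalse b) b) _)
  (cong₂ _+_ (rows-sum (numFalse b) b)
    (trans (withRect-sum r (numFalse b) _) (cong (bit r * numFalse b +_) (dissected-sum rs _ ws c))))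

module _ (b : List Bool) (r : List ℕ) (d : Desc r) (t : top r ≤ numFalse b) where

  private
    M : ℕ
    M = numFalse b
    l : length (rows M b) ≡ M
    l = rows-length M b
    a : All (length (rows M b) ≤_) (rows M b)
    a = subst (λ n → All (n ≤_) (rows M b)) (sym l) (rows-≥ M b)
    t′ : top r ≤ length (rows M b)
    t′ = subst (top r ≤_) (sym l) t

  durfeeSize-rows : durfeeSize (rows M b ++ r) ≡ M
  durfeeSize-rows = trans (durfeeSize-++ (rows M b) r a t′ d) l

  square-rows : durfeeSquareRem (rows M b ++ r) ≡ r
  square-rows = durfeeSquareRem-++ (rows M b) r a t′ d

  rect-rows : durfeeRectRem (rows M b ++ r) ≡ (if entry r 1 ≡ᵇ M then just (drop 1 r) else nothing)
  rect-rows = trans (durfeeRectRem-++ (rows M b) r a t′ d)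
    (cong (λ n → if entry r 1 ≡ᵇ n then just (drop 1 r) else nothing) l)

≡ᵇ-true : ∀ {m n} → m ≡ n → (m ≡ᵇ n) ≡ true
≡ᵇ-true {m} {n} e = Equivalence.to T-≡ (≡⇒≡ᵇ m n e)

rect-◂ : ∀ M μ → Desc μ → top μ ≤ M → (if entry (M ◂ μ) 1 ≡ᵇ M then just (drop 1 (M ◂ μ)) else nothing) ≡ just μ
rect-◂ M μ d t rewrite ≡ᵇ-true (proj₁ (◂-entry M μ d t)) = cong just (proj₂ (◂-entry M μ d t))

blockRem : Bool → List ℕ → Maybe (List ℕ)
blockRem false μ = just (durfeeSquareRem μ)
blockRem true  μ = durfeeRectRem μ

blocksRem : List Bool → List ℕ → Maybe (List ℕ)
blocksRem []       μ = just μ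
blocksRem (r ∷ rs) μ with blockRem r μ
... | nothing = nothing
... | just ν  = blocksRem rs ν

blocksRem-just : ∀ r rs μ ν → blockRem r μ ≡ just ν → blocksRem (r ∷ rs) μ ≡ blocksRem rs ν
blocksRem-just r rs μ ν e rewrite e = refl

blocksRem-rects : ∀ t μ → blocksRem (replicate t true) μ ≡ rectsRem t μ
blocksRem-rects zero    μ = refl
blocksRem-rects (suc t) μ with durfeeRectRem μ
... | nothing = refl
... | just ν  = blocksRem-rects t ν

blocksRem≡ : ∀ s t μ → blocksRem (replicate s false ++ replicate t true) μ ≡ rectsRem t (squaresRem s μ)
blocksRem≡ zero    t μ = blocksRem-rects t μ
blocksRem≡ (suc s) t μ = blocksRem≡ s t (durfeeSquareRem μ)

blockRem-rows : ∀ r b μ → Desc μ → top μ ≤ numFalse b →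
  blockRem r (rows (numFalse b) b ++ withRect r (numFalse b) μ) ≡ just μ
blockRem-rows false b μ d h = cong just (square-rows b μ d h)
blockRem-rows true  b μ d h = let (d′ , h′) = ◂-Desc (numFalse b) μ d h in
  trans (rect-rows b _ d′ h′) (rect-◂ (numFalse b) μ d h)

dissected-rem : ∀ rs N ws → Chain rs N ws → blocksRem rs (dissected rs ws) ≡ just []
dissected-rem [] N [] c = refl
dissected-rem (r ∷ rs) N (b ∷ ws) (l , c) = let (d , h) = dissected-Desc rs _ ws c in
  trans (blocksRem-just r rs (dissected (r ∷ rs) (b ∷ ws)) _ (blockRem-rows r b _ d h))
      (dissected-rem rs _ ws c)

++-length-injective : ∀ {A : Set} (xs ys : List A) {us vs} → length xs ≡ length ys → xs ++ us ≡ ys ++ vs →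
    xs ≡ ys × us ≡ vs
++-length-injective []       []       l e = refl , e
++-length-injective (x ∷ xs) (y ∷ ys) l e with ∷-inj e
... | refl , e′ with ++-length-injective xs ys (suc-injective l) e′
... | refl , e″ = refl , e″

-- The size of the Durfee square recovers `numFalse b`; this number of rows then separates the block
-- from its remainder.
block-injective : ∀ b b′ r r′ → Desc r → Desc r′ → top r ≤ numFalse b → top r′ ≤ numFalse b′ →
    length b ≡ length b′ →
  rows (numFalse b) b ++ r ≡ rows (numFalse b′) b′ ++ r′ → b ≡ b′ × r ≡ r′
block-injective b b′ r r′ d d′ t t′ l e with trans (sym (durfeeSize-rows b r d t))
    (trans (cong durfeeSize e) (durfeeSize-rows b′ r′ d′ t′))
... | m with ++-length-injective (rows (numFalse b) b) (rows (numFalse b′) b′)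
               (trans (rows-length _ b) (trans m (sym (rows-length _ b′)))) e
... | er , e′ = rows-injective (numFalse b) b b′ l m (trans er (cong (λ n → rows n b′) (sym m))) , e′

dissected-injective : ∀ rs N ws ws′ → Chain rs N ws → Chain rs N ws′ → dissected rs ws ≡ dissected rs ws′ →
    ws ≡ ws′
dissected-injective [] N [] [] c c′ e = refl
dissected-injective (r ∷ rs) N (b ∷ ws) (b′ ∷ ws′) (l , c) (l′ , c′) e
  with withRect-dissected-Desc r rs _ ws c | withRect-dissected-Desc r rs _ ws′ c′
... | d , h | d′ , h′ with block-injective b b′ _ _ d d′ h h′ (trans l (sym l′)) e
... | refl , e′ = cong (b ∷_) (dissected-injective rs _ ws ws′ c c′ (withRect-injective r (numFalse b) _ _ e′))

record Cut (N : ℕ) (μ : List ℕ) : Set where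
  constructor cut
  field
    b    : List Bool
    r    : List ℕ
    len  : length b ≡ N
    eq   : rows (numFalse b) b ++ r ≡ μ
    desc : Desc r
    top≤ : top r ≤ numFalse b

length≤top : ∀ V → All (length V ≤_) V → length V ≤ top V
length≤top []      _       = z≤n
length≤top (_ ∷ _) (h ∷ _) = h

-- The side of the Durfee square is at most the largest part and hence at most `N`; what is left of
-- the width is the box for the cells to its right.
cutBox : ∀ N μ → Desc μ → top μ ≤ N → Cut N μ
cutBox N μ d h with durfeeCut 0 μ d
... | V₁ , V₂ , refl , a , t , d′ with rows-surj (length V₁) (N ∸ length V₁) V₁ V₂ a d
                                     (≤-trans (top-++ V₁ V₂) (≤-trans h
                                         (≤-reflexive (sym (m+[n∸m]≡n (≤-trans (length≤top V₁ a)
                                         (≤-trans (top-++ V₁ V₂) h)))))))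
... | b , e , et , ef = cut b V₂
    (trans (sym (numTrue+numFalse b))
    (trans (cong₂ _+_ et ef) (m∸n+n≡m (≤-trans (length≤top V₁ a) (≤-trans (top-++ V₁ V₂) h)))))
    (cong (_++ V₂) (trans (cong (λ n → rows n b) ef) e)) d′ (subst (top V₂ ≤_) (sym ef) t)

isEmptyRem⇒[] : ∀ μ → T (isEmptyRem (just μ)) → μ ≡ []
isEmptyRem⇒[] [] t = refl

rectRem-just : ∀ b V → Desc V → top V ≤ numFalse b → ∀ ν → durfeeRectRem (rows (numFalse b) b ++ V) ≡ just ν →
    entry V 1 ≡ numFalse b
rectRem-just b V d h ν e with entry V 1 ≡ᵇ numFalse b in q | trans (sym (rect-rows b V d h)) e
... | true  | _ = ≡ᵇ⇒≡ _ _ (subst T (sym q) tt)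
... | false | ()

dissected-surj : ∀ rs N μ → Desc μ → top μ ≤ N → T (isEmptyRem (blocksRem rs μ)) →
  Σ[ ws ∈ List (List Bool) ] (Chain rs N ws × dissected rs ws ≡ μ)
dissected-surj [] N μ d h e = [] , tt , sym (isEmptyRem⇒[] μ e)
dissected-surj (r ∷ rs) N μ d h e with cutBox N μ d h
... | cut b V l refl d′ h′ with blockRem r (rows (numFalse b) b ++ V) in q
... | just ν with withRect-surj r (numFalse b) V d′ h′ (λ { refl → rectRem-just b V d′ h′ ν q })
... | μ′ , refl , d″ , h″ with trans (sym q) (blockRem-rows r b μ′ d″ h″)
... | refl with dissected-surj rs (numFalse b) μ′ d″ h″ e
... | ws , c , refl = b ∷ ws , (l , c) , refl

-- The generalized Durfee block

ωR : List ℕ → ℕ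
ωR []       = 0
ωR (x ∷ xs) = x + sum xs + ωR xs

ω-∷ʳ : ∀ xs x → ω (xs ++ x ∷ []) ≡ x + sum xs + ω xs
ω-∷ʳ [] x = eq x
  where
  eq : ∀ x → 1 * x + 0 ≡ x + 0 + 0
  eq = solve-∀
ω-∷ʳ (z ∷ xs) x rewrite length-++ xs {x ∷ []} | ω-∷ʳ xs x = eq (length xs) z x (sum xs) (ω xs)
  where
  eq : ∀ n z x s w → suc (n + 1) * z + (x + s + w) ≡ x + (z + s) + (suc n * z + w)
  eq = solve-∀

sum-∷ʳ : ∀ xs x → sum (xs ++ x ∷ []) ≡ x + sum xs
sum-∷ʳ xs x = trans (sum-++ xs (x ∷ [])) (trans (cong (sum xs +_) (+-identityʳ x)) (+-comm (sum xs) x))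

sum-reverse : ∀ xs → sum (reverse xs) ≡ sum xs
sum-reverse []       = refl
sum-reverse (x ∷ xs) = trans (cong sum (unfold-reverse x xs))
    (trans (sum-∷ʳ (reverse xs) x) (cong (x +_) (sum-reverse xs)))

ω-reverse : ∀ xs → ω (reverse xs) ≡ ωR xs
ω-reverse []       = refl
ω-reverse (x ∷ xs) = trans (cong ω (unfold-reverse x xs)) (trans (ω-∷ʳ (reverse xs) x)
  (cong₂ (λ s w → x + s + w) (sum-reverse xs) (ω-reverse xs)))

-- Adds the staircase 1, 2, 3, ... to the partial sums of the differences, which makes the parts
-- positive and distinct. Unlike in `ω`, the differences start from the largest part, as overlined
-- parts are listed.
strictParts : List ℕ → List ℕ
strictParts []       = []
strictParts (x ∷ xs) = suc (x + top (strictParts xs)) ∷ strictParts xs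

weakParts : ℕ → List ℕ → List ℕ
weakParts v []       = []
weakParts v (x ∷ xs) = x + (v + sum xs) ∷ weakParts v xs

triangle : ℕ → ℕ
triangle zero    = 0
triangle (suc n) = suc n + triangle n

strictParts-Strict : ∀ xs → Strict (strictParts xs)
strictParts-Strict []       = tt
strictParts-Strict (x ∷ xs) = s≤s (m≤n+m _ x) , strictParts-Strict xs

strictParts-length : ∀ xs → length (strictParts xs) ≡ length xs
strictParts-length []       = refl
strictParts-length (x ∷ xs) = cong suc (strictParts-length xs)

strictParts-top : ∀ xs → top (strictParts xs) ≡ length xs + sum xs
strictParts-top []       = refl
strictParts-top (x ∷ xs) = cong suc (trans (cong (x +_) (strictParts-top xs)) (+-swapˡ x (length xs) (sum xs)))

strictParts-sum : ∀ xs → sum (strictParts xs) ≡ triangle (length xs) + ωR xs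
strictParts-sum []       = refl
strictParts-sum (x ∷ xs) = trans (cong₂ (λ a b → suc (x + a) + b) (strictParts-top xs) (strictParts-sum xs))
  (eq x (length xs) (sum xs) (triangle (length xs)) (ωR xs))
  where
  eq : ∀ x n s t w → suc (x + (n + s)) + (t + w) ≡ suc n + t + (x + s + w)
  eq = solve-∀

strictParts-injective : ∀ xs ys → strictParts xs ≡ strictParts ys → xs ≡ ys
strictParts-injective [] [] e = refl
strictParts-injective (x ∷ xs) (y ∷ ys) e with ∷-inj e
... | h , t with strictParts-injective xs ys t
... | refl = cong (_∷ xs) (+-cancelʳ-≡ _ x y (suc-injective h))

strictParts-surj : ∀ O → Strict O → Σ[ xs ∈ List ℕ ] strictParts xs ≡ O
strictParts-surj [] s = [] , refl
strictParts-surj (suc o ∷ O) (s≤s h , s) with strictParts-surj O s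
... | xs , refl = o ∸ top O ∷ xs , cong (λ n → suc n ∷ O) (m∸n+n≡m h)

weakParts-length : ∀ v xs → length (weakParts v xs) ≡ length xs
weakParts-length v []       = refl
weakParts-length v (x ∷ xs) = cong suc (weakParts-length v xs)

weakParts-≥ : ∀ v xs → All (v ≤_) (weakParts v xs)
weakParts-≥ v []       = []
weakParts-≥ v (x ∷ xs) = ≤-trans (m≤m+n v _) (m≤n+m _ x) ∷ weakParts-≥ v xs

weakParts-sum : ∀ v xs → sum (weakParts v xs) ≡ v * length xs + ωR xs
weakParts-sum v []       = sym (trans +0 (*-zeroʳ v))
weakParts-sum v (x ∷ xs) = trans (cong (x + (v + sum xs) +_) (weakParts-sum v xs))
    (eq v x (sum xs) (length xs) (ωR xs))
  where
  eq : ∀ v x s n w → x + (v + s) + (v * n + w) ≡ v * suc n + (x + s + w)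
  eq = solve-∀

weakParts-Desc : ∀ v xs r → length xs ≤ v → Desc r → top r ≤ v → Desc (weakParts v xs ++ r) ×
    top (weakParts v xs ++ r) ≤ v + sum xs
weakParts-Desc v [] r h d t = d , ≤-trans t (m≤m+n v 0)
weakParts-Desc v (x ∷ xs) r h d t with weakParts-Desc v xs r (≤-trans (n≤1+n _) h) d t
... | d′ , t′ = (≤-trans (≤-trans (s≤s z≤n) h) (≤-trans (m≤m+n v _) (m≤n+m _ x)) , ≤-trans t′ (m≤n+m _ x) ,
    d′) ,
    ≤-reflexive (+-swapˡ x v (sum xs))

weakParts-injective : ∀ v xs ys → weakParts v xs ≡ weakParts v ys → xs ≡ ys
weakParts-injective v [] [] e = refl
weakParts-injective v (x ∷ xs) (y ∷ ys) e with ∷-inj e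
... | h , t with weakParts-injective v xs ys t
... | refl = cong (_∷ xs) (+-cancelʳ-≡ _ x y h)

weakParts-surj : ∀ v V r → All (v ≤_) V → Desc (V ++ r) → Σ[ xs ∈ List ℕ ] weakParts v xs ≡ V
weakParts-surj v [] r a d = [] , refl
weakParts-surj v (x ∷ V) r (h ∷ a) (_ , t , d) with weakParts-surj v V r a d
... | xs , refl = x ∸ (v + sum xs) ∷ xs , cong (_∷ V) (m∸n+n≡m (le xs (≤-trans (top-++ V r) t)))
  where
  le : ∀ xs → top (weakParts v xs) ≤ x → v + sum xs ≤ x
  le []       _ = ≤-trans (≤-reflexive +0) h
  le (y ∷ xs) q = ≤-trans (≤-reflexive (+-swapˡ v y (sum xs))) q

suc-square : ∀ l → l * l + (l + suc l) ≡ suc l * suc l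
suc-square = solve-∀

-- Let t and f count `true` and `false`. Pairs of positions starting with `true` and pairs `false`,
-- `true` number t(t-1)/2 + tf together; the staircase adds t(t+1)/2, and the f rows of length t + f
-- add tf + ff. The total is the square of t + f.
gen-weight : ∀ bs → trueCost bs +
    (triangle (numTrue bs) + length bs * numFalse bs + inversions bs) ≡ length bs * length bs
gen-weight [] = refl
gen-weight (true ∷ bs) = trans
    (eq (length bs) (trueCost bs) (numTrue bs) (triangle (numTrue bs)) (numFalse bs) (inversions bs))
  (trans (cong₂ (λ a b → a + (length bs + suc b)) (gen-weight bs) (numTrue+numFalse bs))
      (suc-square (length bs)))
  where
  eq : ∀ l c t r f i → l + c + (suc t + r + suc l * f + i) ≡ c + (r + l * f + i) + (l + suc (t + f))
  eq = solve-∀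
gen-weight (false ∷ bs) = trans
    (eq (length bs) (trueCost bs) (numTrue bs) (triangle (numTrue bs)) (numFalse bs) (inversions bs))
  (trans (cong₂ (λ a b → a + (length bs + suc b)) (gen-weight bs) (numTrue+numFalse bs))
      (suc-square (length bs)))
  where
  eq : ∀ l c t r f i → c + (r + suc l * suc f + (t + i)) ≡ c + (r + l * f + i) + (l + suc (t + f))
  eq = solve-∀

-- The flag tells whether the generalized block is a rectangle, and the list describes the later
-- blocks, so one recursion treats squares and rectangles alike.
dissects : Bool → List Bool → List Part → Bool
dissects false rs λs = isEmptyRem (blocksRem rs (drop (genDurfeeSize λs) (ρ λs)))
dissects true  rs λs = if entry (ρ λs) (suc (genDurfeeSize λs)) ≡ᵇ genDurfeeSize λs
  then isEmptyRem (blocksRem rs (drop (suc (genDurfeeSize λs)) (ρ λs))) else false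

isDissected : Bool → List Bool → (n j : ℕ) → List Part → Bool
isDissected r rs n j λs =
  isOverpartition λs ∧ (weight λs ≡ᵇ n) ∧ (numOverlined λs ≡ᵇ j) ∧ dissects r rs λs

-- Describes the generalized Durfee square without its search: its rows are all the overlined parts
-- and the non-overlined parts in `V₁`.
record GenCut (λs : List Part) (V₁ V₂ : List ℕ) (N : ℕ) : Set where
  field
    nonParts≡ : nonParts λs ≡ V₁ ++ V₂
    size      : length (overParts λs) + length V₁ ≡ N
    large     : All (N ≤_) V₁
    small     : top V₂ ≤ N
    desc      : Desc V₂

module _ {λs V₁ V₂ N} (g : GenCut λs V₁ V₂ N) where
  open GenCut g

  genSize : genDurfeeSize λs ≡ N
  genSize = trans (genDurfeeSize-split λs V₁ V₂ nonParts≡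
    (subst (λ n → All (n ≤_) V₁) (sym size) large) (subst (top V₂ ≤_) (sym size) small) desc) size

  private
    O : List ℕ
    O = overParts λs
    ρ≡ : ρ λs ≡ (O ++ V₁) ++ V₂
    ρ≡ = trans (cong (O ++_) nonParts≡) (sym (++-assoc O V₁ V₂))
    len : length (O ++ V₁) ≡ N
    len = trans (length-++ O) size

  genRem : ∀ m → drop (m + genDurfeeSize λs) (ρ λs) ≡ drop m V₂
  genRem m = trans (cong₂ drop (cong (m +_) (trans genSize (sym len))) ρ≡) (drop-length-++ m (O ++ V₁) V₂)

  genEntry : entry (ρ λs) (suc (genDurfeeSize λs)) ≡ entry V₂ 1
  genEntry = trans (cong₂ (λ xs n → entry xs (suc n)) ρ≡ (trans genSize (trans (sym len) (sym +0))))
      (entry-++ (O ++ V₁) V₂ 0)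

  dissects⁺ : ∀ r rs μ → V₂ ≡ withRect r N μ → Desc μ → top μ ≤ N → T (isEmptyRem (blocksRem rs μ)) →
      T (dissects r rs λs)
  dissects⁺ false rs μ refl d h e = subst (λ ν → T (isEmptyRem (blocksRem rs ν))) (sym (genRem 0)) e
  dissects⁺ true  rs μ eV d h e
    rewrite ≡ᵇ-true (trans genEntry
        (trans (cong (λ V → entry V 1) eV) (trans (proj₁ (◂-entry N μ d h)) (sym genSize)))) =
    subst (λ ν → T (isEmptyRem (blocksRem rs ν)))
        (sym (trans (genRem 1) (trans (cong (drop 1) eV) (proj₂ (◂-entry N μ d h))))) e

  dissects⁻ : ∀ r rs → T (dissects r rs λs) →
    Σ[ μ ∈ List ℕ ] (V₂ ≡ withRect r N μ × Desc μ × top μ ≤ N × T (isEmptyRem (blocksRem rs μ)))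
  dissects⁻ false rs e = V₂ , refl , desc , small , subst (λ ν → T (isEmptyRem (blocksRem rs ν))) (genRem 0) e
  dissects⁻ true  rs e with entry (ρ λs) (suc (genDurfeeSize λs)) ≡ᵇ genDurfeeSize λs in q
  ... | true with ◂-surj N V₂ desc small (trans (sym genEntry) (trans (≡ᵇ⇒≡ _ _ (subst T (sym q) tt)) genSize))
  ...   | μ , eV , eμ , d , h = μ , eV , d , h ,
      subst (λ ν → T (isEmptyRem (blocksRem rs ν))) (trans (genRem 1) eμ) e

module _ (r : Bool) (rs : List Bool) where

  -- The bits that mark the South steps of the path now tell which rows of the generalized block are
  -- overlined: `unmerge` turns the same differences into the distinct overlined parts and the
  -- non-overlined parts of size at least N. Differences run upwards and parts downwards, hence
  -- `reverse`.
  overValues largeParts smallParts : RawCode → List ℕ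
  overValues (cs , bs , ws) = strictParts (reverse (proj₁ (unmerge cs bs)))
  largeParts  (cs , bs , ws) = weakParts (length cs) (reverse (proj₂ (unmerge cs bs)))
  smallParts  (cs , bs , ws) = withRect r (length cs) (dissected rs ws)

  overpartition : RawCode → List Part
  overpartition c = interleave (overValues c) (largeParts c ++ smallParts c)

  module _ (cs : List ℕ) (bs : List Bool) (ws : List (List Bool)) (l : length cs ≡ length bs)
      (c : Chain rs (length cs) ws) where

    private
      code : RawCode
      code = cs , bs , ws
      N : ℕ
      N = length cs
      xs ys : List ℕ
      xs = proj₁ (unmerge cs bs)
      ys = proj₂ (unmerge cs bs)
      lx : length xs ≡ numTrue bs
      lx = proj₁ (unmerge-length cs bs l)
      ly : length ys ≡ numFalse bs
      ly = proj₂ (unmerge-length cs bs l)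
      lxy : numTrue bs + numFalse bs ≡ N
      lxy = trans (numTrue+numFalse bs) (sym l)
      ly′ : length (reverse ys) ≤ N
      ly′ = ≤-trans (≤-reflexive (trans (length-reverse ys) ly))
          (≤-trans (m≤n+m _ (numTrue bs)) (≤-reflexive lxy))
      rest : Desc (smallParts code) × top (smallParts code) ≤ N
      rest = withRect-dissected-Desc r rs N ws c

    overValues-length : length (overValues code) ≡ numTrue bs
    overValues-length = trans (strictParts-length (reverse xs)) (trans (length-reverse xs) lx)

    overpartition-valid : T (isOverpartition (overpartition code))
    overpartition-valid = interleave-over (overValues code) (largeParts code ++ smallParts code)
        (strictParts-Strict (reverse xs))
      (proj₁ (weakParts-Desc N (reverse ys) (smallParts code) ly′ (proj₁ rest) (proj₂ rest)))

    overpartition-cut : GenCut (overpartition code) (largeParts code) (smallParts code) N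
    overpartition-cut = record
      { nonParts≡ = nonParts-interleave (overValues code) _
      ; size      = trans (cong₂ _+_
          (trans (cong length (overParts-interleave (overValues code)
          (largeParts code ++ smallParts code))) overValues-length)
                      (trans (weakParts-length N (reverse ys)) (trans (length-reverse ys) ly))) lxy
      ; large     = weakParts-≥ N (reverse ys)
      ; small     = proj₂ rest
      ; desc      = proj₁ rest
      }

    overpartition-numOverlined : numOverlined (overpartition code) ≡ numTrue bs
    overpartition-numOverlined = trans (numOverlined-split (overpartition code))
      (trans (cong length (overParts-interleave (overValues code)
          (largeParts code ++ smallParts code))) overValues-length)

    overpartition-weight : trueCost bs + weight (overpartition code) ≡ N * N + bit r * N +
        (ω cs + chainCost rs ws)
    overpartition-weight = trans (cong (trueCost bs +_) total≡)
      (trans (eq₁ (trueCost bs) (triangle (numTrue bs)) (ω xs) (N * numFalse bs) (ω ys) (bit r * N)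
          (chainCost rs ws))
        (trans (cong (λ z → trueCost bs + (triangle (numTrue bs) + N * numFalse bs) + z +
            (bit r * N + chainCost rs ws)) (unmerge-ω cs bs l))
          (trans (eq₂ (trueCost bs) (triangle (numTrue bs)) (N * numFalse bs) (ω cs) (inversions bs)
              (bit r * N) (chainCost rs ws))
            (cong (λ z → z + bit r * N + (ω cs + chainCost rs ws))
              (trans (cong (λ n → trueCost bs + (triangle (numTrue bs) + n * numFalse bs + inversions bs)) l)
                (trans (gen-weight bs) (cong (λ n → n * n) (sym l))))))))
      where
      total≡ : weight (overpartition code) ≡ (triangle (numTrue bs) + ω xs) +
          ((N * numFalse bs + ω ys) + (bit r * N + chainCost rs ws))
      total≡ = trans (weight-split (overpartition code)) (cong₂ _+_
        (trans (cong sum (overParts-interleave (overValues code) (largeParts code ++ smallParts code)))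
          (trans (strictParts-sum (reverse xs))
              (cong₂ (λ n w → triangle n + w) (trans (length-reverse xs) lx)
              (trans (sym (ω-reverse (reverse xs))) (cong ω (reverse-involutive xs))))))
        (trans (cong sum (nonParts-interleave (overValues code) (largeParts code ++ smallParts code)))
          (trans (sum-++ (largeParts code) (smallParts code)) (cong₂ _+_
            (trans (weakParts-sum N (reverse ys))
                (cong₂ (λ n w → N * n + w) (trans (length-reverse ys) ly)
                (trans (sym (ω-reverse (reverse ys))) (cong ω (reverse-involutive ys)))))
            (trans (withRect-sum r N _) (cong (bit r * N +_) (dissected-sum rs N ws c)))))))
      eq₁ : ∀ c t x n y r d → c + (t + x + (n + y + (r + d))) ≡ c + (t + n) + (x + y) + (r + d)
      eq₁ = solve-∀
      eq₂ : ∀ c t n w i r d → c + (t + n) + (w + i) + (r + d) ≡ c + (t + n + i) + r + (w + d)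
      eq₂ = solve-∀

    overpartition-dissects : T (dissects r rs (overpartition code))
    overpartition-dissects = let (d , h) = dissected-Desc rs N ws c in
      dissects⁺ overpartition-cut r rs (dissected rs ws) refl d h
        (subst (λ m → T (isEmptyRem m)) (sym (dissected-rem rs N ws c)) tt)

  overpartition-injective : ∀ cs bs ws cs′ bs′ ws′ → length cs ≡ length bs → Chain rs (length cs) ws →
    length cs′ ≡ length bs′ → Chain rs (length cs′) ws′ →
    overpartition (cs , bs , ws) ≡ overpartition (cs′ , bs′ , ws′) → (cs , bs , ws) ≡ (cs′ , bs′ , ws′)
  overpartition-injective cs bs ws cs′ bs′ ws′ l c l′ c′ e = done
    where
    code code′ : RawCode
    code  = cs , bs , ws
    code′ = cs′ , bs′ , ws′
    eN : length cs ≡ length cs′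
    eN = trans (sym (genSize (overpartition-cut cs bs ws l c)))
        (trans (cong genDurfeeSize e) (genSize (overpartition-cut cs′ bs′ ws′ l′ c′)))
    eO : overValues code ≡ overValues code′
    eO = trans (sym (overParts-interleave (overValues code) (largeParts code ++ smallParts code)))
      (trans (cong overParts e) (overParts-interleave (overValues code′)
          (largeParts code′ ++ smallParts code′)))
    eV : largeParts code ++ smallParts code ≡ largeParts code′ ++ smallParts code′
    eV = trans (sym (nonParts-interleave (overValues code) (largeParts code ++ smallParts code)))
      (trans (cong nonParts e) (nonParts-interleave (overValues code′) (largeParts code′ ++ smallParts code′)))
    len₁ : length (largeParts code) ≡ length (largeParts code′)
    len₁ = +-cancelˡ-≡ (length (overParts (overpartition code))) _ _
      (trans (GenCut.size (overpartition-cut cs bs ws l c)) (trans eN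
        (trans (sym (GenCut.size (overpartition-cut cs′ bs′ ws′ l′ c′)))
            (cong (λ z → length (overParts z) + length (largeParts code′)) (sym e)))))
    parts≡ : largeParts code ≡ largeParts code′ × smallParts code ≡ smallParts code′
    parts≡ = ++-length-injective (largeParts code) (largeParts code′) len₁ eV
    ex : proj₁ (unmerge cs bs) ≡ proj₁ (unmerge cs′ bs′)
    ex = reverse-injective (strictParts-injective _ _ eO)
    ey : proj₂ (unmerge cs bs) ≡ proj₂ (unmerge cs′ bs′)
    ey = reverse-injective (weakParts-injective (length cs) _ _
      (trans (proj₁ parts≡) (cong (λ n → weakParts n (reverse (proj₂ (unmerge cs′ bs′)))) (sym eN))))
    ew : ws ≡ ws′
    ew = dissected-injective rs (length cs) ws ws′ c (subst (λ n → Chain rs n ws′) (sym eN) c′)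
      (withRect-injective r (length cs) _ _
          (trans (proj₂ parts≡) (cong (λ n → withRect r n (dissected rs ws′)) (sym eN))))
    done : code ≡ code′
    done with unmerge-injective cs bs cs′ bs′ l l′ (cong₂ _,_ ex ey)
    ... | refl , refl = cong (λ ws → cs , bs , ws) ew

  overpartition-surj : ∀ λs → T (isOverpartition λs) → T (dissects r rs λs) →
    Σ[ cs ∈ _ ] Σ[ bs ∈ _ ] Σ[ ws ∈ _ ] (length cs ≡ length bs × Chain rs (length cs) ws ×
        overpartition (cs , bs , ws) ≡ λs)
  overpartition-surj λs ov ds with split-ordered λs ov
  ... | (so , _) , (dn , _) with durfeeCut (length (overParts λs)) (nonParts λs) dn
  ... | V₁ , V₂ , eV , large , small , d₂
    with dissects⁻ {λs} {V₁} {V₂} (record { nonParts≡ = eV ; size = refl ; large = large ; small =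
        small ; desc = d₂ }) r rs ds
  ... | μ , refl , dμ , hμ , rem with dissected-surj rs (length (overParts λs) + length V₁) μ dμ hμ rem
  ... | ws , c , refl with strictParts-surj (overParts λs) so | weakParts-surj
      (length (overParts λs) + length V₁) V₁ _ large (subst Desc eV dn)
  ... | xs , exs | ys , eys with unmerge-surj (length (reverse xs) + length (reverse ys)) (reverse xs)
      (reverse ys) ≤-refl
  ... | cs , bs , l , e = cs , bs , ws , l , subst (λ n → Chain rs n ws) (sym eN) c ,
      split-injective _ λs (overpartition-valid cs bs ws l (subst (λ n → Chain rs n ws) (sym eN) c)) ov
        (trans (overParts-interleave (overValues (cs , bs , ws)) _)
          (trans (cong strictParts (trans (cong (λ z → reverse (proj₁ z)) e) (reverse-involutive xs))) exs))
        (trans (nonParts-interleave (overValues (cs , bs , ws)) _)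
          (trans (cong₂ _++_ (trans (cong₂ weakParts eN
              (trans (cong (λ z → reverse (proj₂ z)) e) (reverse-involutive ys))) eys)
            (cong (λ n → withRect r n (dissected rs ws)) eN)) (sym eV)))
    where
    eN : length cs ≡ length (overParts λs) + length V₁
    eN = trans l (trans (sym (numTrue+numFalse bs)) (cong₂ _+_
      (trans (sym (proj₁ (unmerge-length cs bs l))) (trans (cong (λ z → length (proj₁ z)) e)
        (trans (length-reverse xs) (trans (sym (strictParts-length xs)) (cong length exs)))))
      (trans (sym (proj₂ (unmerge-length cs bs l))) (trans (cong (λ z → length (proj₂ z)) e)
        (trans (length-reverse ys) (trans (sym (weakParts-length _ ys)) (cong length eys)))))))

  Code↔dissected : ∀ n j → Σ RawCode (Code r rs n j) ↔ Σ (List Part) (λ λs → T (isDissected r rs n j λs))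
  Code↔dissected n j = injSurj-↔ (Code-irr r rs n j) (λ _ → T-irrelevant) overpartition to inj from
    where
    to : ∀ c → Code r rs n j c → T (isDissected r rs n j (overpartition c))
    to (cs , bs , ws) (l , c , e , f) = T-∧⁺ (overpartition-valid cs bs ws l c) (T-∧⁺
      (≡⇒≡ᵇ _ n (+-cancelˡ-≡ (trueCost bs) _ n (trans (overpartition-weight cs bs ws l c) (sym e))))
      (T-∧⁺ (≡⇒≡ᵇ _ j (trans (overpartition-numOverlined cs bs ws l c) f))
          (overpartition-dissects cs bs ws l c)))
    inj : ∀ a b → Code r rs n j a → Code r rs n j b → overpartition a ≡ overpartition b → a ≡ b
    inj (cs , bs , ws) (cs′ , bs′ , ws′) (l , c , _) (l′ , c′ , _) e =
        overpartition-injective cs bs ws cs′ bs′ ws′ l c l′ c′ e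
    from : ∀ λs → T (isDissected r rs n j λs) → Σ[ c ∈ RawCode ] (Code r rs n j c × overpartition c ≡ λs)
    from λs q with T-∧⁻ {isOverpartition λs} q
    ... | ov , q₁ with T-∧⁻ {weight λs ≡ᵇ n} q₁
    ... | wt , q₂ with T-∧⁻ {numOverlined λs ≡ᵇ j} q₂
    ... | nu , di with overpartition-surj λs ov di
    ... | cs , bs , ws , l , c , refl = (cs , bs , ws) , (l , c ,
      trans (cong (trueCost bs +_) (sym (≡ᵇ⇒≡ _ n wt))) (overpartition-weight cs bs ws l c) ,
      trans (sym (overpartition-numOverlined cs bs ws l c)) (≡ᵇ⇒≡ _ j nu)) , refl

noWord : ∀ w → Valid 0 0 w → w ≡ []
noWord []      v       = refl
noWord (H ∷ w) (n , v) with noWord w v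
... | refl = ⊥-elim n

-- For k = 1 there are no blocks, so not even the generalized one that a `Code` describes; both
-- sides contain only the empty object.
Word↔D̄-trivial : ∀ n j → Σ (List Letter) (Word 0 0 n j) ↔ D̄ 1 1 n j
Word↔D̄-trivial n j = subset-↔ (Word-irr 0 0 n j) (λ _ → T-irrelevant) (λ _ → []) (λ _ → []) to from
  (λ w (v , _) → sym (noWord w v)) (λ λs q → sym (empty λs (proj₂ (proj₂ (proj₂ (parse λs q))))))
  where
  to : ∀ w → Word 0 0 n j w → T (isD 1 1 n j [])
  to w (v , m , f) with noWord w v
  ... | refl = T-∧⁺ (≡⇒≡ᵇ 0 n m) (T-∧⁺ (≡⇒≡ᵇ 0 j f) tt)
  parse : ∀ λs → T (isD 1 1 n j λs) → T (isOverpartition λs) × T (weight λs ≡ᵇ n) × T (numOverlined λs ≡ᵇ j) ×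
      T (isEmptyRem (just (ρ λs)))
  parse λs q with T-∧⁻ {isOverpartition λs} q
  ... | ov , q₁ with T-∧⁻ {weight λs ≡ᵇ n} q₁
  ... | wt , q₂ with T-∧⁻ {numOverlined λs ≡ᵇ j} q₂
  ... | nu , di = ov , wt , nu , di
  empty : ∀ λs → T (isEmptyRem (just (ρ λs))) → λs ≡ []
  empty []                 _ = refl
  empty ((a , true) ∷ λs)  ()
  empty ((a , false) ∷ λs) q with overParts λs
  empty ((a , false) ∷ λs) () | []
  empty ((a , false) ∷ λs) () | _ ∷ _
  from : ∀ λs → T (isD 1 1 n j λs) → Word 0 0 n j []
  from λs q with parse λs q
  ... | _ , wt , nu , di with empty λs di
  ... | refl = refl , ≡ᵇ⇒≡ 0 n wt , ≡ᵇ⇒≡ 0 j nu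

-- Finiteness

Unique-lookup-injective : {A : Set} {xs : List A} → Unique xs → ∀ i j → lookup xs i ≡ lookup xs j → i ≡ j
Unique-lookup-injective (_ ∷ _)        Fin.zero    Fin.zero    e = refl
Unique-lookup-injective (x∉ ∷ _)       Fin.zero    (Fin.suc j) e = ⊥-elim (All.lookup x∉ (∈-lookup j) e)
Unique-lookup-injective (x∉ ∷ _)       (Fin.suc i) Fin.zero    e = ⊥-elim (All.lookup x∉ (∈-lookup i) (sym e))
Unique-lookup-injective (_ ∷ u)        (Fin.suc i) (Fin.suc j) e =
    cong Fin.suc (Unique-lookup-injective u i j e)

finite-subset : {A : Set} → DecidableEquality A → (p : A → Bool) (xs : List A) → (∀ a → T (p a) → a ∈ xs) →
  ∃[ m ] (Fin m ↔ Σ A (T ∘ p))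
finite-subset _≟_ p xs cover = length ys , mk↔ₛ′
  (λ i → lookup ys i , proj₂ (∈-filter⁻ (T? ∘ p) {xs = xs} (∈-deduplicate⁻ _≟_ _ (∈-lookup i))))
  (λ (a , q) → index (mem a q))
  (λ (a , q) → Σ-≡ (λ _ → T-irrelevant) (sym (lookup-index (mem a q))))
  (λ i → Unique-lookup-injective (deduplicate-! _≟_ (filter (T? ∘ p) xs)) _ i
      (sym (lookup-index (mem (lookup ys i) _))))
  where
  ys = deduplicate _≟_ (filter (T? ∘ p) xs)
  mem : ∀ a → T (p a) → a ∈ ys
  mem a q = ∈-deduplicate⁺ _≟_ (∈-filter⁺ (T? ∘ p) (cover a q) q)

listsUpTo : {A : Set} → List A → ℕ → List (List A)
listsUpTo as zero    = [] ∷ []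
listsUpTo as (suc m) = [] ∷ cartesianProductWith _∷_ as (listsUpTo as m)

∈-listsUpTo : {A : Set} {as xs : List A} → All (_∈ as) xs → ∀ m → length xs ≤ m → xs ∈ listsUpTo as m
∈-listsUpTo []       zero    _        = here refl
∈-listsUpTo []       (suc m) _        = here refl
∈-listsUpTo (a ∷ al) (suc m) (s≤s le) = there (∈-cartesianProductWith⁺ _∷_ a (∈-listsUpTo al m le))

over-length : ∀ xs → T (isOverpartition xs) → length xs ≤ weight xs
over-length [] t = z≤n
over-length (x ∷ xs) t with over-∷⁻ x xs t
... | (p , _) , t′ = +-mono-≤ p (over-length xs t′)

partsUpTo : ℕ → List Part
partsUpTo n = cartesianProduct (upTo (suc n)) (true ∷ false ∷ [])

∈-partsUpTo : ∀ n p → value p ≤ n → p ∈ partsUpTo n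
∈-partsUpTo n (a , o) le = ∈-cartesianProduct⁺ (∈-upTo⁺ (s≤s le)) (mem o)
  where
  mem : ∀ o → o ∈ true ∷ false ∷ []
  mem true  = here refl
  mem false = there (here refl)

parts-bounded : ∀ n xs → weight xs ≤ n → All (_∈ partsUpTo n) xs
parts-bounded n []       le = []
parts-bounded n (x ∷ xs) le = ∈-partsUpTo n x (≤-trans (m≤m+n _ _) le) ∷ parts-bounded n xs
    (≤-trans (m≤n+m _ (value x)) le)

-- Parts are positive, so an overpartition of `n` has at most `n` parts, each at most `n`.
B̄-finite : ∀ k i n j → ∃[ m ] (Fin m ↔ B̄ k i n j)
B̄-finite k i n j = finite-subset (List.≡-dec (Product.≡-dec ℕ._≟_ Bool._≟_)) (isB k i n j)
    (listsUpTo (partsUpTo n) n) cover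
  where
  cover : ∀ xs → T (isB k i n j xs) → xs ∈ listsUpTo (partsUpTo n) n
  cover xs t with T-∧⁻ {isOverpartition xs} t
  ... | ov , t₁ with ≡ᵇ⇒≡ (weight xs) n (proj₁ (T-∧⁻ {weight xs ≡ᵇ n} t₁))
  ... | refl = ∈-listsUpTo (parts-bounded n xs ≤-refl) n (over-length xs ov)

-- The blocks belonging to k and i, and the conclusion

levels : ℕ → ℕ → List Bool
levels s t = replicate s false ++ replicate t true

levels-counts : ∀ s t → length (levels s t) ≡ s + t × numTrue (levels s t) ≡ t
levels-counts zero    zero    = refl , refl
levels-counts zero    (suc t) = let (l , n) = levels-counts zero t in cong suc l , cong suc n
levels-counts (suc s) t       = let (l , n) = levels-counts s t in cong suc l , n

rects-full : ∀ t → numTrue (levels 0 t) ≡ length (levels 0 t)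
rects-full t = let (l , n) = levels-counts 0 t in trans n (sym l)

levels-SquaresFirst : ∀ s t → SquaresFirst (levels s t)
levels-SquaresFirst zero    zero    = tt
levels-SquaresFirst zero    (suc t) = (λ _ → rects-full t) , levels-SquaresFirst zero t
levels-SquaresFirst (suc s) t       = (λ ()) , levels-SquaresFirst s t

subset-cong : {A : Set} {p q : A → Bool} → (∀ a → p a ≡ q a) → Σ A (T ∘ p) ↔ Σ A (T ∘ q)
subset-cong e = subset-↔ (λ _ → T-irrelevant) (λ _ → T-irrelevant) (λ a → a) (λ a → a)
  (λ a → subst T (e a)) (λ a → subst T (sym (e a))) (λ _ _ → refl) (λ _ _ → refl)

-- The starting height k - i is the number of rectangles, a generalized one included. For i = 1
-- every block is a rectangle and the path starts at the maximal height.
Word↔D̄ : ∀ K i n j → i ≤ K → Σ (List Letter) (Word K (K ∸ i) n j) ↔ D̄ (suc K) (suc i) n j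
Word↔D̄ zero    zero    n j _       = Word↔D̄-trivial n j
Word↔D̄ (suc K) zero    n j _       = subset-cong same ↔-∘ (Code↔dissected true (levels 0 K) n j ↔-∘ ↔-sym
  (subst₂ (λ l y → Σ _ (Code true (levels 0 K) n j) ↔ Σ _ (Word (suc l) (suc y) n j))
    (proj₁ (levels-counts 0 K)) (proj₂ (levels-counts 0 K))
    (Code↔Word true (levels 0 K) (λ _ → rects-full K) (levels-SquaresFirst 0 K) n j)))
  where
  same : ∀ λs → isDissected true (levels 0 K) n j λs ≡ isD (suc (suc K)) 1 n j λs
  same λs = cong (λ m → isOverpartition λs ∧ (weight λs ≡ᵇ n) ∧ (numOverlined λs ≡ᵇ j) ∧
    (if entry (ρ λs) (suc (genDurfeeSize λs)) ≡ᵇ genDurfeeSize λs then isEmptyRem m else false))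
    (blocksRem≡ 0 K (drop (suc (genDurfeeSize λs)) (ρ λs)))
Word↔D̄ (suc K) (suc i) n j (s≤s h) =
    subset-cong same ↔-∘ (Code↔dissected false (levels i (K ∸ i)) n j ↔-∘ ↔-sym
  (subst₂ (λ l y → Σ _ (Code false (levels i (K ∸ i)) n j) ↔ Σ _ (Word (suc l) y n j))
    (trans (proj₁ (levels-counts i (K ∸ i))) (m+[n∸m]≡n h)) (proj₂ (levels-counts i (K ∸ i)))
    (Code↔Word false (levels i (K ∸ i)) (λ ()) (levels-SquaresFirst i (K ∸ i)) n j)))
  where
  same : ∀ λs → isDissected false (levels i (K ∸ i)) n j λs ≡ isD (suc (suc K)) (suc (suc i)) n j λs
  same λs = cong (λ m → isOverpartition λs ∧ (weight λs ≡ᵇ n) ∧ (numOverlined λs ≡ᵇ j) ∧ isEmptyRem m)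
    (blocksRem≡ i (K ∸ i) (drop (genDurfeeSize λs) (ρ λs)))

theorem1p4 : (k i : ℕ) → 1 ≤ k → 1 ≤ i → i ≤ k → (n j : ℕ) →
    ∃[ m ] ((Fin m ↔ B̄ k i n j) × (Fin m ↔ C̄ k i n j)
    × (Fin m ↔ D̄ k i n j) × (Fin m ↔ Ē k i n j))
theorem1p4 (suc K) (suc i) _ 1≤i (s≤s i≤K) n j = let (m , e) = B̄-finite (suc K) (suc i) n j in
  m , e , C↔W ↔-∘ (toWord ↔-∘ e) , Word↔D̄ K i n j i≤K ↔-∘ (toWord ↔-∘ e) ,
      Word↔Ē K (suc i) n j 1≤i ↔-∘ (toWord ↔-∘ e)
  where
  y≤K : K ∸ i ≤ K
  y≤K = m∸n≤m K i
  toWord : B̄ (suc K) (suc i) n j ↔ Σ _ (Word K (K ∸ i) n j)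
  toWord = ↔-sym (Word↔Freq K (K ∸ i) n j y≤K) ↔-∘
      (FreqR↔Freq K (K ∸ i) n j y≤K ↔-∘ ↔-sym (FreqR↔B̄ K i i≤K n j))
  C↔W : Σ _ (Word K (K ∸ i) n j) ↔ C̄ (suc K) (suc i) n j
  C↔W = GapListR↔C̄ K i i≤K n j ↔-∘ (↔-sym (GapListR↔GapList K (K ∸ i) n j) ↔-∘ Word↔GapList K (K ∸ i) n j y≤K)
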